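{- Let $q\ge5$ be a power of $3$. Then $\Lambda_{\mathrm{EA},3_{\mathcal C}}=q-2$, $\Lambda_{\mathrm{EA},\overline{1_{\mathcal C}}}=q$, $\Lambda_{\mathrm{EA},0_{\mathcal C}}=q+1$; $\Lambda_{\mathrm{En}\Gamma,3_{\mathcal C}}=q^2-3q+3$, $\Lambda_{\mathrm{En}\Gamma,\overline{1_{\mathcal C}}}=q^2-q-1$, $\Lambda_{\mathrm{En}\Gamma,0_{\mathcal C}}=q^2$; $\Pi_{3_{\mathcal C},\mathrm{EA}}=\frac{q(q-2)}{6(q+1)}$, $\Pi_{\overline{1_{\mathcal C}},\mathrm{EA}}=\frac{q^2}{2(q+1)}$, $\Pi_{0_{\mathcal C},\mathrm{EA}}=\frac{q}{3}$; $\Pi_{3_{\mathcal C},\mathrm{En}\Gamma}=\frac{q^2-3q+3}{6(q-1)}$, $\Pi_{\overline{1_{\mathcal C}},\mathrm{En}\Gamma}=\frac{q^2-q-1}{2(q-1)}$, $\Pi_{0_{\mathcal C},\mathrm{En}\Gamma}=\frac{q^2}{3(q-1)}$.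
   Context: Let $\mathrm{PG}(3,q)$ have points $\mathbf{P}(x_0,x_1,x_2,x_3)$; put $P(t)=\mathbf{P}(t^3,t^2,t,1)$ ($t\in\mathbb{F}_q$), $P(\infty)=\mathbf{P}(1,0,0,0)$, $\mathcal{C}=\{P(t):t\in\mathbb{F}_q\cup\{\infty\}\}$ the twisted cubic, $G_q$ the group of projectivities fixing $\mathcal C$. Write $\boldsymbol{\pi}(c_0,c_1,c_2,c_3)$ for the plane $c_0x_0+c_1x_1+c_2x_2+c_3x_3=0$. $\Gamma$-planes: the osculating planes $\boldsymbol{\pi}(1,-3t,3t^2,-t^3)$ ($t\in\mathbb{F}_q$) and $\boldsymbol{\pi}(0,0,0,1)$; for $q\equiv0\pmod3$ they share a common line, the axis $\mathrm{A}$. A $d_{\mathcal C}$-plane ($d\in\{0,3\}$) contains exactly $d$ points of $\mathcal C$; a $\overline{1_{\mathcal C}}$-plane is a non-$\Gamma$-plane containing exactly one point of $\mathcal C$ (each type is a $G_q$-orbit for $q\ge5$). An EA-line is a line with no point of $\mathcal C$, different from $\mathrm{A}$, meeting $\mathrm{A}$. An imaginary chord is the line joining $P(s),P(s^q)$, $s\in\mathbb{F}_{q^2}\setminus\mathbb{F}_q$. An En$\Gamma$-line is a line with no point of $\mathcal C$, lying in no $\Gamma$-plane, which is not an imaginary chord. Notation: $\Lambda_{\lambda,\pi}$ is the number of $\lambda$-lines in a $\pi$-plane; $\Pi_{\pi,\lambda}$ is the average, over all $\lambda$-lines, of the number of $\pi$-planes through the line. -}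

module Defs where

open import Data.Nat using (ℕ)
open import Data.Product using (Σ; _×_; _,_; ∃₂)
open import Data.Sum using (_⊎_)
open import Data.List using (List; length)
open import Data.List.Membership.Propositional using (_∈_)
open import Data.List.Relation.Unary.Unique.Propositional using (Unique)
open import Relation.Binary.PropositionalEquality using (_≡_; _≢_)
open import Relation.Binary.Definitions using (DecidableEquality)
open import Relation.Nullary using (¬_)
open import Function.Bundles using (_⇔_)
import Algebra.Structures as AS

record FiniteField : Set₁ where
  infixl 6 _+_
  infixl 7 _*_
  field
    Carrier : Set
    _+_ _*_ : Carrier → Carrier → Carrier
    -_      : Carrier → Carrier
    0# 1#   : Carrier
    isCommutativeRing : AS.IsCommutativeRing {A = Carrier} _≡_ _+_ _*_ -_ 0# 1#
    0≢1     : 0# ≢ 1#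
    inverse : ∀ x → x ≢ 0# → Σ Carrier λ y → x * y ≡ 1#
    _≟_     : DecidableEquality Carrier
    elements : List Carrier
    complete : ∀ x → x ∈ elements
    distinct : Unique elements

  q : ℕ
  q = length elements

-- "There are exactly n objects of type A satisfying P" (A with
-- propositional equality, so objects must be canonical representatives).

HasCount : {A : Set} → (A → Set) → ℕ → Set
HasCount {A} P n =
  Σ (List A) λ xs → Unique xs × (∀ x → (x ∈ xs) ⇔ P x) × (length xs ≡ n)

module Geometry (F : FiniteField) where
  open FiniteField F public

  V4 : Set
  V4 = Carrier × Carrier × Carrier × Carrier

  _•_ : Carrier → V4 → V4
  c • (a , b , d , e) = (c * a , c * b , c * d , c * e)

  _⊕_ : V4 → V4 → V4
  (a , b , c , d) ⊕ (a' , b' , c' , d') = (a + a' , b + b' , c + c' , d + d')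

  dot : V4 → V4 → Carrier
  dot (a , b , c , d) (a' , b' , c' , d') = a * a' + b * b' + c * c' + d * d'

  -- Canonical representative of a projective point / plane: nonzero
  -- vector whose last nonzero coordinate is 1.
  Normalized : V4 → Set
  Normalized (a , b , c , d) =
    (d ≡ 1#) ⊎ (d ≡ 0# × c ≡ 1#) ⊎ (d ≡ 0# × c ≡ 0# × b ≡ 1#)
    ⊎ (d ≡ 0# × c ≡ 0# × b ≡ 0# × a ≡ 1#)

  IsPoint : V4 → Set
  IsPoint = Normalized

  IsPlane : V4 → Set
  IsPlane = Normalized

  InPlane : V4 → V4 → Set
  InPlane π x = dot π x ≡ 0#

  -- Lines = 2-dimensional subspaces of F^4, represented canonically by
  -- the reduced row echelon form (r1 , r2) of a basis (6 pivot patterns).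
  Line : Set
  Line = V4 × V4

  IsLine : Line → Set
  IsLine (r1 , r2) =
      (Σ Carrier λ a → Σ Carrier λ b → Σ Carrier λ c → Σ Carrier λ d →
         r1 ≡ (1# , 0# , a , b) × r2 ≡ (0# , 1# , c , d))
    ⊎ (Σ Carrier λ a → Σ Carrier λ b → Σ Carrier λ c →
         r1 ≡ (1# , a , 0# , b) × r2 ≡ (0# , 0# , 1# , c))
    ⊎ (Σ Carrier λ a → Σ Carrier λ b →
         r1 ≡ (1# , a , b , 0#) × r2 ≡ (0# , 0# , 0# , 1#))
    ⊎ (Σ Carrier λ a → Σ Carrier λ b →
         r1 ≡ (0# , 1# , 0# , a) × r2 ≡ (0# , 0# , 1# , b))
    ⊎ (Σ Carrier λ a →
         r1 ≡ (0# , 1# , a , 0#) × r2 ≡ (0# , 0# , 0# , 1#))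
    ⊎ (r1 ≡ (0# , 0# , 1# , 0#) × r2 ≡ (0# , 0# , 0# , 1#))

  InSpan : V4 → V4 → V4 → Set
  InSpan u v x = ∃₂ λ a b → x ≡ (a • u) ⊕ (b • v)

  OnLine : Line → V4 → Set
  OnLine (r1 , r2) x = InSpan r1 r2 x

  LineInPlane : Line → V4 → Set
  LineInPlane (r1 , r2) π = dot π r1 ≡ 0# × dot π r2 ≡ 0#

  P : Carrier → V4
  P t = (t * t * t , t * t , t , 1#)

  P∞ : V4
  P∞ = (1# , 0# , 0# , 0#)

  OnC : V4 → Set
  OnC x = (Σ Carrier λ t → x ≡ P t) ⊎ (x ≡ P∞)

  3# : Carrier
  3# = 1# + 1# + 1#

  Osc : Carrier → V4
  Osc t = (1# , - (3# * t) , 3# * (t * t) , - (t * t * t))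

  IsΓPlane : V4 → Set
  IsΓPlane π =
      (Σ Carrier λ c → c ≢ 0# × Σ Carrier λ t → π ≡ c • Osc t)
    ⊎ (Σ Carrier λ c → c ≢ 0# × π ≡ c • (0# , 0# , 0# , 1#))

  Is-dC : ℕ → V4 → Set
  Is-dC d π = HasCount (λ x → IsPoint x × OnC x × InPlane π x) d

  Is3C : V4 → Set
  Is3C = Is-dC 3

  Is0C : V4 → Set
  Is0C = Is-dC 0

  Is1barC : V4 → Set
  Is1barC π = ¬ IsΓPlane π × Is-dC 1 π

  -- The axis A (q ≡ 0 mod 3): the common line of all Γ-planes.

  OnAxis : V4 → Set
  OnAxis x = ∀ π → IsPlane π → IsΓPlane π → InPlane π x

  IsAxis : Line → Set
  IsAxis L = ∀ x → IsPoint x → (OnLine L x ⇔ OnAxis x)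

  NoCPoint : Line → Set
  NoCPoint L = ∀ x → IsPoint x → OnLine L x → ¬ OnC x

  IsEALine : Line → Set
  IsEALine L = IsLine L × NoCPoint L × ¬ IsAxis L
             × Σ V4 λ x → IsPoint x × OnLine L x × OnAxis x

  -- Imaginary chords.  F_{q²} is realised as F[θ]/(θ² - uθ - w) with
  -- x² - ux - w irreducible over F; an element s = a + bθ is encoded as
  -- the pair (a , b), and s ∉ F_q iff b ≠ 0.

  Irreducible : Carrier → Carrier → Set
  Irreducible u w = ∀ t → t * t ≢ u * t + w

  -- multiplication in F[θ]/(θ² - uθ - w)
  mulE : Carrier → Carrier → Carrier × Carrier → Carrier × Carrier
       → Carrier × Carrier
  mulE u w (a , b) (c , d) = (a * c + b * d * w , a * d + b * c + b * d * u)

  re im : Carrier × Carrier → Carrier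
  re (a , _) = a
  im (_ , b) = b

  -- P(s) = R + θ I with R, I ∈ F^4 ; returns (R , I)
  PE : Carrier → Carrier → Carrier × Carrier → V4 × V4
  PE u w s =
    let s2 = mulE u w s s
        s3 = mulE u w s2 s
    in (re s3 , re s2 , re s , 1#) , (im s3 , im s2 , im s , 0#)

  -- The line P(s)P(s^q) is defined over F; its F-points are those of
  -- the F-span of R and I (since P(s^q) = R + θ^q I, θ^q ≠ θ).
  IsImaginaryChord : Line → Set
  IsImaginaryChord L =
    Σ Carrier λ u → Σ Carrier λ w → Irreducible u w ×
    Σ Carrier λ a → Σ Carrier λ b → b ≢ 0# ×
      (∀ x → IsPoint x →
         (OnLine L x ⇔ InSpan (Data.Product.proj₁ (PE u w (a , b)))
                               (Data.Product.proj₂ (PE u w (a , b))) x))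

  IsEnΓLine : Line → Set
  IsEnΓLine L = IsLine L × NoCPoint L
              × (∀ π → IsPlane π → IsΓPlane π → ¬ LineInPlane L π)
              × ¬ IsImaginaryChord L

  LinesIn : (Line → Set) → V4 → ℕ → Set
  LinesIn λ-line π n = HasCount (λ L → λ-line L × LineInPlane L π) n

  -- Π_{π,λ} = I / N where N = number of λ-lines and I = number of
  -- incident pairs (λ-line L, π-plane π' ⊇ L).  Stated as
  --   N > 0  and  I * den ≡ num * N   (i.e. Π = num / den).
  AvgPlanes : (V4 → Set) → (Line → Set) → ℕ → ℕ → Set
  AvgPlanes π-plane λ-line num den =
    Σ ℕ λ N → Σ ℕ λ I →
      HasCount λ-line N
    × HasCount (λ (p : Line × V4) →
         λ-line (Data.Product.proj₁ p) × IsPlane (Data.Product.proj₂ p)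
         × π-plane (Data.Product.proj₂ p)
         × LineInPlane (Data.Product.proj₁ p) (Data.Product.proj₂ p)) I
    × Data.Nat._<_ 0 N
    × I Data.Nat.* den ≡ num Data.Nat.* N

module Submission where

-- All incidence numbers are obtained by double counting. A plane is read as the binary cubic form obtained by
-- restricting it to the cubic, so the planes through one, two or three given points of the cubic are counted by
-- linear algebra, and the factorial moments of the number of points of the cubic in a plane determine how many
-- planes are of each type. In characteristic 3 the Γ-planes are exactly the planes through the axis, so the
-- EnΓ-lines are among the q⁴ lines skew to the axis; each of these meets the cubic in at most two points, whence
-- the first two moments count those missing the cubic, in the whole space and in a plane. The imaginary chords
-- correspond to the irreducible quadratics T² − uT − w, and such a chord lies in a plane iff the quadratic divides
-- the cubic form. An EA-line is determined by its axis point, the point of the cubic in its Γ-plane, and a nonzero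
-- displacement; in a plane not through the axis these lines correspond to the points of the cubic off the plane.

-- The number of lines in a plane is computed for each plane by itself from the number of points of
-- the cubic in it, so that its constancy on a type of planes is a result; the incident pairs are
-- then a product, and the averages follow. Since `HasCount` counts up to propositional equality,
-- every family of lines is parametrised injectively (2×2 matrices, pairs (u , w), triples (b , α ,
-- k)) through convenient unreduced bases; uniqueness of the reduced echelon form turns equality of
-- spans into equality of lines. Characteristic 3 acts through cubing, which is additive and
-- bijective: x³y′³ - y³x′³ = (xy′ - yx′)³, so the outer coordinates x₀, x₃ alone tell the points of
-- the cubic apart. Hence each plane through the axis meets the cubic exactly once, and incidence of
-- a skew line with points of the cubic is a nonsingular linear system. Inclusion-exclusion is
-- stated without division or subtraction: each equation is multiplied by 2 or 6 and its negative
-- terms stand on the other side.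

open import Defs
open import Data.Bool using (if_then_else_; true; false)
open import Data.Empty using (⊥; ⊥-elim)
open import Data.Fin using (Fin; zero; suc; _<_)
import Data.Fin.Properties as Finₚ
open import Data.List using (List; []; _∷_; map; foldr; length; filter; _++_)
open import Data.List.Properties using (length-map; length-++)
open import Data.List.Membership.Propositional using (_∈_)
open import Data.List.Membership.Propositional.Properties
  using (∈-map⁺; ∈-map⁻; ∈-++⁺ˡ; ∈-++⁺ʳ; ∈-++⁻; ∈-filter⁺; ∈-filter⁻)
open import Data.List.Membership.Propositional.Properties.WithK using (unique∧set⇒bag)
open import Data.List.Relation.Binary.BagAndSetEquality using (∼bag⇒↭)
open import Data.List.Relation.Binary.Permutation.Propositional using (↭⇒↭ₛ)
open import Data.List.Relation.Binary.Permutation.Propositional.Properties using (↭-length)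
open import Data.List.Relation.Binary.Permutation.Setoid.Properties using (foldr-commMonoid)
import Data.List.Relation.Unary.All as All
open import Data.List.Relation.Unary.All using ([]; _∷_)
import Data.List.Relation.Unary.All.Properties as Allₚ
open import Data.List.Relation.Unary.AllPairs using ([]; _∷_)
open import Data.List.Relation.Unary.Any using (here; there)
open import Data.List.Relation.Unary.Unique.Propositional using (Unique)
import Data.List.Relation.Unary.Unique.Propositional.Properties as Uniqueₚ
open import Data.Maybe using (Maybe; just; nothing)
import Data.Maybe.Properties as Maybeₚ
open import Data.Nat using (ℕ; zero; suc; _∸_; NonZero)
import Data.Nat as ℕ
open import Data.Nat.ListAction using (sum)
import Data.Nat.Properties as ℕₚ
open import Data.Nat.Solver using (module +-*-Solver)
open import Data.Product using (Σ; _×_; _,_; proj₁; proj₂; ∃; ∃₂; swap)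
import Data.Product.Properties as ×ₚ
open import Data.Sum using (_⊎_; inj₁; inj₂; [_,_]′)
open import Data.Unit using (⊤; tt)
open import Function using (_∘_; id)
open import Function.Bundles using (_⇔_; mk⇔; Equivalence)
open import Level using (0ℓ)
open import Relation.Binary.Definitions using (DecidableEquality; tri<; tri≈; tri>)
open import Relation.Binary.PropositionalEquality
open import Relation.Nullary using (¬_; Dec; yes; no; ¬?; contradiction; _×-dec_)
open import Relation.Nullary.Decidable using (map′; decidable-stable)
open import Relation.Unary using (Decidable)
open import Algebra.Bundles using (CommutativeRing; RawRing)
import Algebra.Properties.Ring as RingProperties
import Algebra.Properties.Semiring.Mult as Mult
import Algebra.Solver.Ring as RingSolver
open import Algebra.Solver.Ring.AlmostCommutativeRing using (fromCommutativeRing; _-Raw-AlmostCommutative⟶_)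

-- Finite counting, double counting and factorial moments

module Counting where
  open import Data.Nat using (_+_; _*_; _≤_; z≤n; s≤s; _≡ᵇ_)

  private variable
    A B : Set
    P Q : A → Set
    m n : ℕ

  -- Two repetition-free enumerations of one predicate are permutations of each other. Every double
  -- count below ends here: one set, counted in two ways, yields an equation.
  count-unique : HasCount P m → HasCount P n → m ≡ n
  count-unique (xs , ux , px , refl) (ys , uy , py , refl) =
    ↭-length (∼bag⇒↭ (unique∧set⇒bag ux uy λ {z} →
      mk⇔ (Equivalence.from (py z) ∘ Equivalence.to (px z))
          (Equivalence.from (px z) ∘ Equivalence.to (py z))))

  -- Injectivity is asked only on `P`, so `f` may take junk values elsewhere, as `chordMatrix` and
  -- `eaLine` do.
  count-image : (f : A → B) → HasCount P n →
    (∀ {x y} → P x → P y → f x ≡ f y → x ≡ y) →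
    (∀ {x} → P x → Q (f x)) →
    (∀ {y} → Q y → ∃ λ x → P x × f x ≡ y) → HasCount Q n
  count-image {P = P} {Q = Q} f (xs , ux , px , refl) inj into onto =
    map f xs , unique-map xs (Equivalence.to (px _)) ux , correct , length-map f xs
    where
    unique-map : ∀ ys → (∀ {y} → y ∈ ys → P y) → Unique ys → Unique (map f ys)
    unique-map [] _ _ = []
    unique-map (y ∷ ys) py (y∉ ∷ u) =
      Allₚ.map⁺ (All.tabulate λ z∈ e →
        All.lookup y∉ z∈ (inj (py (here refl)) (py (there z∈)) e))
      ∷ unique-map ys (py ∘ there) u
    correct : ∀ y → (y ∈ map f xs) ⇔ Q y
    correct y = mk⇔
      (λ y∈ → let (x , x∈ , e) = ∈-map⁻ f y∈ in subst Q (sym e) (into (Equivalence.to (px x) x∈)))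
      (λ qy → let (x , p , e) = onto qy in subst (_∈ map f xs) e (∈-map⁺ f (Equivalence.from (px x) p)))

  count-cong : (∀ {x} → P x → Q x) → (∀ {x} → Q x → P x) → HasCount P n → HasCount Q n
  count-cong to from h = count-image id h (λ _ _ e → e) to (λ {y} q → y , from q , refl)

  count-length : (h : HasCount P n) → length (proj₁ h) ≡ n
  count-length = proj₂ ∘ proj₂ ∘ proj₂

  count-none : (∀ x → ¬ P x) → HasCount P 0
  count-none none = [] , [] , (λ x → mk⇔ (λ ()) (⊥-elim ∘ none x)) , refl

  count-one : (a : A) → P a → (∀ {x} → P x → x ≡ a) → HasCount P 1
  count-one {P = P} a pa only =
    a ∷ [] , [] ∷ [] , (λ x → mk⇔ (λ { (here e) → subst P (sym e) pa ; (there ()) }) (here ∘ only)) , refl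

  count-⊎ : HasCount P m → HasCount Q n → (∀ {x} → P x → Q x → ⊥) →
    HasCount (λ x → P x ⊎ Q x) (m + n)
  count-⊎ (xs , ux , px , refl) (ys , uy , py , refl) disjoint =
    xs ++ ys ,
    Uniqueₚ.++⁺ ux uy (λ (x∈ , y∈) → disjoint (Equivalence.to (px _) x∈) (Equivalence.to (py _) y∈)) ,
    (λ z → mk⇔ (to z) (from z)) , length-++ xs
    where
    to : ∀ z → z ∈ xs ++ ys → _
    to z z∈ with ∈-++⁻ xs z∈
    ... | inj₁ z∈xs = inj₁ (Equivalence.to (px z) z∈xs)
    ... | inj₂ z∈ys = inj₂ (Equivalence.to (py z) z∈ys)
    from : ∀ z → _ → z ∈ xs ++ ys
    from z (inj₁ p) = ∈-++⁺ˡ (Equivalence.from (px z) p)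
    from z (inj₂ q) = ∈-++⁺ʳ xs (Equivalence.from (py z) q)

  count-filter : (h : HasCount P m) (Q? : Decidable Q) →
    HasCount (λ x → P x × Q x) (length (filter Q? (proj₁ h)))
  count-filter (xs , ux , px , refl) Q? =
    filter Q? xs , Uniqueₚ.filter⁺ Q? ux ,
    (λ x → mk⇔ (λ x∈ → let (x∈xs , q) = ∈-filter⁻ Q? x∈ in Equivalence.to (px x) x∈xs , q)
               (λ (p , q) → ∈-filter⁺ Q? (Equivalence.from (px x) p) q)) , refl

  record Finite (A : Set) : Set where
    field
      size : ℕ
      all  : HasCount {A} (λ _ → ⊤) size
      _≟_  : DecidableEquality A

    count : Decidable {A = A} P → ℕ
    count P? = length (filter P? (proj₁ all))

    has-count : (P? : Decidable {A = A} P) → HasCount P (count P?)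
    has-count P? = count-cong proj₂ (λ p → tt , p) (count-filter all P?)

    exists? : Decidable {A = A} P → Dec (∃ P)
    exists? P? with has-count P?
    ... | [] , _ , px , _ = no λ (x , p) → contradiction (Equivalence.from (px x) p) λ ()
    ... | x ∷ _ , _ , px , _ = yes (x , Equivalence.to (px x) (here refl))

  -- Serves as subtraction: the part outside `Q` is known once the whole and the part inside `Q`
  -- are.
  count-split : HasCount P n → Decidable Q →
    ∃₂ λ i j → HasCount (λ x → P x × Q x) i × HasCount (λ x → P x × ¬ Q x) j × i + j ≡ n
  count-split {P = P} {Q = Q} h Q? =
    _ , _ , yeses , noes , count-unique (count-cong merge divide both) h
    where
    yeses = count-filter h Q?
    noes = count-filter h (¬? ∘ Q?)
    both = count-⊎ yeses noes (λ (_ , q) (_ , ¬q) → ¬q q)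
    merge : ∀ {x} → (P x × Q x) ⊎ (P x × ¬ Q x) → P x
    merge (inj₁ (p , _)) = p
    merge (inj₂ (p , _)) = p
    divide : ∀ {x} → P x → (P x × Q x) ⊎ (P x × ¬ Q x)
    divide {x} p with Q? x
    ... | yes q = inj₁ (p , q)
    ... | no ¬q = inj₂ (p , ¬q)

  count-zero : HasCount P 0 → ∀ x → ¬ P x
  count-zero ([] , _ , p , _) x px = contradiction (Equivalence.from (p x) px) λ ()

  unique-element : {P : A → Set} → HasCount P 1 → ∃ λ x → P x × (∀ y → P y → y ≡ x)
  unique-element {P = P} (x ∷ [] , _ , p , refl) = x , Equivalence.to (p x) (here refl) , only
    where
    only : ∀ y → P y → y ≡ x
    only y py with Equivalence.from (p y) py
    ... | here e = e

  two-elements : {P : A → Set} → HasCount P n → 2 ≤ n → ∃₂ λ x y → y ≢ x × P x × P y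
  two-elements (x ∷ y ∷ _ , (x∉ ∷ _) , p , refl) _ =
    x , y , (λ e → All.lookup x∉ (here refl) (sym e)) , Equivalence.to (p x) (here refl) , Equivalence.to (p y) (there (here refl))
  two-elements (_ ∷ [] , _ , _ , refl) (s≤s ())
  two-elements ([] , _ , _ , refl) ()

  -- The image has as many elements as `A`, so the complement of the image has count 0.
  injective⇒surjective : Finite A → (f : A → A) → (∀ {x y} → f x ≡ f y → x ≡ y) → ∀ y → ∃ λ x → f x ≡ y
  injective⇒surjective finA f inj y
    with i , j , hit , missed , e ←
      count-split (Finite.all finA) (λ y → Finite.exists? finA (λ x → Finite._≟_ finA (f x) y))
    with refl ← count-unique hit (count-image f (Finite.all finA) (λ _ _ → inj) (λ {x} _ → tt , x , refl)
                                   (λ (_ , x , e) → x , tt , e))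
    with refl ← ℕₚ.+-cancelˡ-≡ (Finite.size finA) j 0 (trans e (sym (ℕₚ.+-identityʳ _)))
    with Finite.exists? finA (λ x → Finite._≟_ finA (f x) y)
  ... | yes p = p
  ... | no ¬p = contradiction (tt , ¬p) (count-zero missed y)

  count-remove : DecidableEquality A → {P : A → Set} → HasCount P n → (a : A) → P a →
    HasCount (λ x → P x × x ≢ a) (n ∸ 1)
  count-remove _≟_ {P} h a pa
    with i , j , one , rest , e ← count-split h (_≟ a)
    with refl ← count-unique one (count-one {P = λ x → P x × x ≡ a} a (pa , refl) proj₂)
    = subst (HasCount _) (cong (_∸ 1) e) rest

  -- The sum runs over the very list of the enumeration `h`, so that sums obtained from the same `h`
  -- can be combined term by term.
  count-∑ : {P : A → Set} {R : A → B → Set} (h : HasCount P n) (c : A → ℕ) →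
    (∀ {a} → P a → HasCount (R a) (c a)) →
    HasCount (λ ((a , b) : A × B) → P a × R a b) (sum (map c (proj₁ h)))
  count-∑ {A = A} {B = B} {P = P} {R = R} (xs , ux , px , _) c fibre =
    count-cong (λ {(a , b)} (a∈ , r) → Equivalence.to (px a) a∈ , r)
               (λ {(a , b)} (p , r) → Equivalence.from (px a) p , r)
               (over xs ux (fibre ∘ Equivalence.to (px _)))
    where
    over : ∀ ys → Unique ys → (∀ {a} → a ∈ ys → HasCount (R a) (c a)) →
      HasCount (λ ((a , b) : A × B) → a ∈ ys × R a b) (sum (map c ys))
    over [] _ _ = count-none λ { _ (() , _) }
    over (y ∷ ys) (y∉ ∷ u) fib = count-cong
      (λ { (inj₁ (refl , r)) → here refl , r ; (inj₂ (a∈ , r)) → there a∈ , r })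
      (λ { (here refl , r) → inj₁ (refl , r) ; (there a∈ , r) → inj₂ (a∈ , r) })
      (count-⊎
        (count-image {Q = λ ((a , b) : A × B) → y ≡ a × R a b} (y ,_) (fib (here refl))
          (λ { _ _ refl → refl }) (λ r → refl , r) (λ { {(_ , b)} (refl , r) → b , r , refl }))
        (over ys u (fib ∘ there))
        (λ { (refl , _) (y∈ , _) → All.lookup y∉ y∈ refl }))

  ∑-cong : (xs : List A) {f g : A → ℕ} → (∀ {x} → x ∈ xs → f x ≡ g x) → sum (map f xs) ≡ sum (map g xs)
  ∑-cong [] e = refl
  ∑-cong (x ∷ xs) e = cong₂ _+_ (e (here refl)) (∑-cong xs (e ∘ there))

  ∑-+ : (xs : List A) (f g : A → ℕ) → sum (map (λ x → f x + g x) xs) ≡ sum (map f xs) + sum (map g xs)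
  ∑-+ [] f g = refl
  ∑-+ (x ∷ xs) f g rewrite ∑-+ xs f g =
    solve 4 (λ a b s t → (a :+ b) :+ (s :+ t) := (a :+ s) :+ (b :+ t)) refl (f x) (g x) _ _
    where open +-*-Solver

  ∑-* : (xs : List A) (k : ℕ) (f : A → ℕ) → sum (map (λ x → k * f x) xs) ≡ k * sum (map f xs)
  ∑-* [] k f = sym (ℕₚ.*-zeroʳ k)
  ∑-* (x ∷ xs) k f rewrite ∑-* xs k f = sym (ℕₚ.*-distribˡ-+ k (f x) _)

  ∑-const : (xs : List A) (k : ℕ) → sum (map (λ _ → k) xs) ≡ length xs * k
  ∑-const [] k = refl
  ∑-const (x ∷ xs) k = cong (k +_) (∑-const xs k)

  count-Σ : {P : A → Set} {R : A → B → Set} → HasCount P m →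
    (∀ {a} → P a → HasCount (R a) n) → HasCount (λ ((a , b) : A × B) → P a × R a b) (m * n)
  count-Σ {n = n} h fibre =
    subst (HasCount _) (trans (∑-const (proj₁ h) n) (cong (_* n) (count-length h)))
      (count-∑ h (λ _ → n) fibre)

  count-swap : {R : A × B → Set} → HasCount R n → HasCount (R ∘ swap) n
  count-swap h = count-image swap h (λ { _ _ refl → refl }) id (λ {(b , a)} r → (a , b) , r , refl)

  finite-× : Finite A → Finite B → Finite (A × B)
  finite-× a b = record
    { all = count-cong (λ _ → tt) (λ _ → tt , tt) (count-Σ (Finite.all a) λ _ → Finite.all b)
    ; _≟_ = ×ₚ.≡-dec (Finite._≟_ a) (Finite._≟_ b) }

  finite-Maybe : Finite A → Finite (Maybe A)
  finite-Maybe {A = A} a = record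
    { all = count-cong {P = λ x → (x ≡ nothing) ⊎ (∃ λ y → just y ≡ x)} (λ _ → tt)
        (λ { {nothing} _ → inj₁ refl ; {just y} _ → inj₂ (y , refl) })
        (count-⊎ (count-one nothing refl id)
                 (count-image just (Finite.all a) (λ { _ _ refl → refl }) (λ {x} _ → x , refl)
                   λ { (x , e) → x , tt , e })
                 λ { refl (_ , ()) })
    ; _≟_ = Maybeₚ.≡-dec (Finite._≟_ a) }

  δ : ℕ → ℕ → ℕ
  δ d n = if n ≡ᵇ d then 1 else 0

  count-level : {P : A → Set} (h : HasCount P n) (c : A → ℕ) (d : ℕ) →
    HasCount (λ a → P a × c a ≡ d) (sum (map (λ a → δ d (c a)) (proj₁ h)))
  count-level {P = P} h c d =
    subst (HasCount _) (length-filter (proj₁ h)) (count-filter h λ a → c a ℕₚ.≟ d)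
    where
    length-filter : ∀ xs → length (filter (λ a → c a ℕₚ.≟ d) xs) ≡ sum (map (λ a → δ d (c a)) xs)
    length-filter [] = refl
    length-filter (x ∷ xs) with c x ≡ᵇ d
    ... | true = cong suc (length-filter xs)
    ... | false = length-filter xs

  Pairs : (A → Set) → A × A → Set
  Pairs P (x , y) = P x × (P y × y ≢ x)

  -- The inequalities are nested so that each further entry is drawn from a predicate with one
  -- element removed; `count-remove` then gives the falling factorials.
  Triples : (A → Set) → A × A × A → Set
  Triples P (x , y , z) = P x × Pairs (λ w → P w × w ≢ x) (y , z)

  count-pairs : DecidableEquality A → {P : A → Set} → HasCount P n → HasCount (Pairs P) (n * (n ∸ 1))
  count-pairs _≟_ h = count-Σ h (count-remove _≟_ h _)

  count-triples : DecidableEquality A → {P : A → Set} → HasCount P n →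
    HasCount (Triples P) (n * ((n ∸ 1) * (n ∸ 1 ∸ 1)))
  count-triples _≟_ h = count-Σ h λ p → count-pairs _≟_ (count-remove _≟_ h _ p)

  at-most-two : {P : A → Set} → HasCount P n → (∀ {t} → Triples P t → ⊥) → n ≤ 2
  at-most-two ([] , _ , _ , refl) _ = z≤n
  at-most-two (_ ∷ [] , _ , _ , refl) _ = s≤s z≤n
  at-most-two (_ ∷ _ ∷ [] , _ , _ , refl) _ = s≤s (s≤s z≤n)
  at-most-two (x ∷ y ∷ z ∷ _ , (x∉ ∷ y∉ ∷ _) , p , refl) none = ⊥-elim (none
    (Equivalence.to (p x) (here refl) ,
     (Equivalence.to (p y) (there (here refl)) , λ e → All.lookup x∉ (here refl) (sym e)) ,
     (Equivalence.to (p z) (there (there (here refl))) , λ e → All.lookup x∉ (there (here refl)) (sym e)) ,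
     λ e → All.lookup y∉ (here refl) (sym e)))

  at-most-three : {P : A → Set} → HasCount P n →
    (∀ {x t} → P x → Triples (λ w → P w × w ≢ x) t → ⊥) → n ≤ 3
  at-most-three ([] , _ , _ , refl) _ = z≤n
  at-most-three {P = P} (x ∷ xs , (x∉ ∷ u) , p , refl) none = s≤s
    (at-most-two {P = λ w → P w × w ≢ x}
      (xs , u , (λ y → mk⇔
        (λ y∈ → Equivalence.to (p y) (there y∈) , λ e → All.lookup x∉ y∈ (sym e))
        λ (py , y≢x) → tail y≢x (Equivalence.from (p y) py)) , refl)
      (none (Equivalence.to (p x) (here refl))))
    where
    tail : ∀ {y} → y ≢ x → y ∈ x ∷ xs → y ∈ xs
    tail y≢x (here e) = contradiction e y≢x
    tail _ (there y∈) = y∈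

  -- Double counting of the pairs (a , b), (a , b , b′), (a , b , b′ , b″) with b, b′, b″ distinct
  -- and incident with a gives the first three factorial moments of the degree c a.
  module Moments {A B : Set} (finB : Finite B) {S : A → Set} {s₀ : ℕ} (countS : HasCount S s₀)
    {R : A → B → Set} (R? : ∀ a → Decidable (R a))
    -- `T` holds every b that can be incident with some element of `S`: the whole projective line in
    -- most uses, the points of the cubic in a fixed plane when lines of that plane are counted.
    {T : B → Set} {n : ℕ} (countT : HasCount T n) (supported : ∀ {a b} → S a → R a b → T b)
    {m₁ m₂ : ℕ}
    (through₁ : ∀ {b} → T b → HasCount (λ a → S a × R a b) m₁)
    (through₂ : ∀ {b b′} → Pairs T (b , b′) → HasCount (λ a → S a × R a b × R a b′) m₂)
    where

    open Finite finB

    private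
      ∑ : (A → ℕ) → ℕ
      ∑ f = sum (map f (proj₁ countS))

    degree : A → ℕ
    degree a = count (R? a)

    count-degree : ∀ a → HasCount (R a) (degree a)
    count-degree a = has-count (R? a)

    level : ∀ d → HasCount (λ a → S a × degree a ≡ d) (∑ (δ d ∘ degree))
    level = count-level countS degree

    moment₁ : ∑ degree ≡ n * m₁
    moment₁ = count-unique (count-∑ countS degree λ {a} _ → count-degree a)
      (count-cong (λ (_ , s , r) → s , r) (λ (s , r) → supported s r , s , r)
        (count-swap (count-Σ countT through₁)))

    moment₂ : ∑ (λ a → degree a * (degree a ∸ 1)) ≡ n * (n ∸ 1) * m₂
    moment₂ = count-unique
      (count-∑ {R = λ a → Pairs (R a)} countS _ λ {a} _ → count-pairs _≟_ (count-degree a))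
      (count-cong (λ ((_ , _ , ne) , s , r , r′) → s , r , r′ , ne)
                  (λ (s , r , r′ , ne) → (supported s r , supported s r′ , ne) , s , r , r′)
        (count-swap (count-Σ (count-pairs _≟_ countT) through₂)))

    ∑-δ : ∀ d k → (f : A → ℕ) → k * ∑ (δ d ∘ degree) + ∑ f ≡ ∑ (λ a → k * δ d (degree a) + f a)
    ∑-δ d k f = trans (cong (_+ ∑ f) (sym (∑-* (proj₁ countS) k _)))
                      (sym (∑-+ (proj₁ countS) (λ a → k * δ d (degree a)) f))

    ∑-≡ : {f g : A → ℕ} → (∀ {a} → S a → f a ≡ g a) → ∑ f ≡ ∑ g
    ∑-≡ e = ∑-cong (proj₁ countS) (e ∘ Equivalence.to (proj₁ (proj₂ (proj₂ countS)) _))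

    ∑-constant : ∀ k → ∑ (λ _ → k) ≡ s₀ * k
    ∑-constant k = trans (∑-const (proj₁ countS) k) (cong (_* k) (count-length countS))

    -- Inclusion-exclusion that stops after two terms: for a degree c at most 2, the number 1 - c +
    -- c(c - 1)/2 is 1 if c = 0 and 0 otherwise. The equation is doubled.
    avoiding : (∀ {a t} → S a → Triples (R a) t → ⊥) →
      ∃ λ u → HasCount (λ a → S a × (∀ b → ¬ R a b)) u ×
        2 * u + 2 * (n * m₁) ≡ s₀ * 2 + n * (n ∸ 1) * m₂
    avoiding none = _ ,
      count-cong (λ {a} (s , e) → s , λ b r → count-zero (subst (HasCount _) e (count-degree a)) b r)
                 (λ {a} (s , e) → s , count-unique (count-degree a) (count-none e)) (level 0) ,
      (begin
        2 * ∑ (δ 0 ∘ degree) + 2 * (n * m₁)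
          ≡⟨ cong (λ k → 2 * ∑ (δ 0 ∘ degree) + 2 * k) moment₁ ⟨
        2 * ∑ (δ 0 ∘ degree) + 2 * ∑ degree
          ≡⟨ cong (2 * ∑ (δ 0 ∘ degree) +_) (∑-* (proj₁ countS) 2 degree) ⟨
        2 * ∑ (δ 0 ∘ degree) + ∑ (λ a → 2 * degree a)
          ≡⟨ ∑-δ 0 2 _ ⟩
        ∑ (λ a → 2 * δ 0 (degree a) + 2 * degree a)
          ≡⟨ ∑-≡ (λ {a} s → identity (at-most-two (count-degree a) (none s))) ⟩
        ∑ (λ a → 2 + degree a * (degree a ∸ 1))
          ≡⟨ ∑-+ (proj₁ countS) (λ _ → 2) _ ⟩
        ∑ (λ _ → 2) + ∑ (λ a → degree a * (degree a ∸ 1))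
          ≡⟨ cong₂ _+_ (∑-constant 2) moment₂ ⟩
        s₀ * 2 + n * (n ∸ 1) * m₂ ∎)
      where
      open ≡-Reasoning
      identity : ∀ {c} → c ≤ 2 → 2 * δ 0 c + 2 * c ≡ 2 + c * (c ∸ 1)
      identity {0} _ = refl
      identity {1} _ = refl
      identity {2} _ = refl
      identity {suc (suc (suc _))} (s≤s (s≤s ()))

    module Three {m₃ : ℕ}
      (through₃ : ∀ {b b′ b″} → Triples T (b , b′ , b″) → HasCount (λ a → S a × R a b × R a b′ × R a b″) m₃)
      (none : ∀ {a x t} → S a → R a x → Triples (λ w → R a w × w ≢ x) t → ⊥) where

      private
        c₁ c₂ c₃ : A → ℕ
        c₁ a = degree a
        c₂ a = degree a * (degree a ∸ 1)
        c₃ a = degree a * ((degree a ∸ 1) * (degree a ∸ 1 ∸ 1))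
        bound : ∀ {a} → S a → degree a ≤ 3
        bound {a} s = at-most-three (count-degree a) (none s)
        ∑*+∑* : ∀ k f l g → k * ∑ f + l * ∑ g ≡ ∑ (λ a → k * f a + l * g a)
        ∑*+∑* k f l g = trans (cong₂ _+_ (sym (∑-* (proj₁ countS) k f)) (sym (∑-* (proj₁ countS) l g)))
          (sym (∑-+ (proj₁ countS) (λ a → k * f a) (λ a → l * g a)))

      moment₃ : ∑ c₃ ≡ n * ((n ∸ 1) * (n ∸ 1 ∸ 1)) * m₃
      moment₃ = count-unique
        (count-∑ {R = λ a → Triples (R a)} countS _ λ {a} _ → count-triples _≟_ (count-degree a))
        (count-cong
          (λ ((_ , (_ , ne) , (_ , ne′) , ne″) , s , r , r′ , r″) → s , r , (r′ , ne) , (r″ , ne′) , ne″)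
          (λ (s , r , (r′ , ne) , (r″ , ne′) , ne″) →
            (supported s r , (supported s r′ , ne) , (supported s r″ , ne′) , ne″) , s , r , r′ , r″)
          (count-swap (count-Σ (count-triples _≟_ countT) through₃)))

      -- For c at most 3 the product c(c - 1)(c - 2) vanishes except at c = 3, where it is 6.
      degree-3 : ∃ λ e → HasCount (λ a → S a × HasCount (R a) 3) e ×
        6 * e ≡ n * ((n ∸ 1) * (n ∸ 1 ∸ 1)) * m₃
      degree-3 = _ , count-cong (λ {a} (s , e) → s , subst (HasCount _) e (count-degree a))
                                (λ {a} (s , h) → s , count-unique (count-degree a) h) (level 3) , (begin
        6 * ∑ (δ 3 ∘ degree)        ≡⟨ ∑-* (proj₁ countS) 6 _ ⟨
        ∑ (λ a → 6 * δ 3 (c₁ a))    ≡⟨ ∑-≡ (λ s → identity (bound s)) ⟩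
        ∑ c₃                        ≡⟨ moment₃ ⟩
        n * ((n ∸ 1) * (n ∸ 1 ∸ 1)) * m₃ ∎)
        where
        open ≡-Reasoning
        identity : ∀ {c} → c ≤ 3 → 6 * δ 3 c ≡ c * ((c ∸ 1) * (c ∸ 1 ∸ 1))
        identity {0} _ = refl
        identity {1} _ = refl
        identity {2} _ = refl
        identity {3} _ = refl
        identity {suc (suc (suc (suc _)))} (s≤s (s≤s (s≤s ())))

      -- For c at most 3 the indicator of c = 1 is c - c(c - 1) + c(c - 1)(c - 2)/2; this is
      -- doubled.
      degree-1 : ∃ λ e → HasCount (λ a → S a × HasCount (R a) 1) e ×
        2 * e + 2 * (n * (n ∸ 1) * m₂) ≡ 2 * (n * m₁) + n * ((n ∸ 1) * (n ∸ 1 ∸ 1)) * m₃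
      degree-1 = _ , count-cong (λ {a} (s , e) → s , subst (HasCount _) e (count-degree a))
                                (λ {a} (s , h) → s , count-unique (count-degree a) h) (level 1) , (begin
        2 * ∑ (δ 1 ∘ degree) + 2 * (n * (n ∸ 1) * m₂)
          ≡⟨ cong (λ k → 2 * ∑ (δ 1 ∘ degree) + 2 * k) moment₂ ⟨
        2 * ∑ (δ 1 ∘ degree) + 2 * ∑ c₂
          ≡⟨ ∑*+∑* 2 (δ 1 ∘ degree) 2 c₂ ⟩
        ∑ (λ a → 2 * δ 1 (c₁ a) + 2 * c₂ a)
          ≡⟨ ∑-≡ (λ s → identity (bound s)) ⟩
        ∑ (λ a → 2 * c₁ a + 1 * c₃ a)
          ≡⟨ ∑*+∑* 2 c₁ 1 c₃ ⟨
        2 * ∑ c₁ + 1 * ∑ c₃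
          ≡⟨ cong₂ (λ x y → 2 * x + y) moment₁ (trans (ℕₚ.*-identityˡ _) moment₃) ⟩
        2 * (n * m₁) + n * ((n ∸ 1) * (n ∸ 1 ∸ 1)) * m₃ ∎)
        where
        open ≡-Reasoning
        identity : ∀ {c} → c ≤ 3 →
          2 * δ 1 c + 2 * (c * (c ∸ 1)) ≡ 2 * c + 1 * (c * ((c ∸ 1) * (c ∸ 1 ∸ 1)))
        identity {0} _ = refl
        identity {1} _ = refl
        identity {2} _ = refl
        identity {3} _ = refl
        identity {suc (suc (suc (suc _)))} (s≤s (s≤s (s≤s ())))

      -- For c at most 3 the indicator of c = 0 is 1 - c + c(c - 1)/2 - c(c - 1)(c - 2)/6; this is
      -- multiplied by 6.
      degree-0 : ∃ λ e → HasCount (λ a → S a × HasCount (R a) 0) e ×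
        6 * e + (6 * (n * m₁) + n * ((n ∸ 1) * (n ∸ 1 ∸ 1)) * m₃) ≡ s₀ * 6 + 3 * (n * (n ∸ 1) * m₂)
      degree-0 = _ , count-cong (λ {a} (s , e) → s , subst (HasCount _) e (count-degree a))
                                (λ {a} (s , h) → s , count-unique (count-degree a) h) (level 0) , (begin
        6 * ∑ (δ 0 ∘ degree) + (6 * (n * m₁) + n * ((n ∸ 1) * (n ∸ 1 ∸ 1)) * m₃)
          ≡⟨ cong₂ (λ x y → 6 * ∑ (δ 0 ∘ degree) + (6 * x + y)) moment₁ (trans (ℕₚ.*-identityˡ _) moment₃) ⟨
        6 * ∑ (δ 0 ∘ degree) + (6 * ∑ c₁ + 1 * ∑ c₃)
          ≡⟨ cong (6 * ∑ (δ 0 ∘ degree) +_) (∑*+∑* 6 c₁ 1 c₃) ⟩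
        6 * ∑ (δ 0 ∘ degree) + ∑ (λ a → 6 * c₁ a + 1 * c₃ a)
          ≡⟨ ∑-δ 0 6 _ ⟩
        ∑ (λ a → 6 * δ 0 (c₁ a) + (6 * c₁ a + 1 * c₃ a))
          ≡⟨ ∑-≡ (λ s → identity (bound s)) ⟩
        ∑ (λ a → 6 + 3 * c₂ a)
          ≡⟨ ∑-+ (proj₁ countS) (λ _ → 6) _ ⟩
        ∑ (λ _ → 6) + ∑ (λ a → 3 * c₂ a)
          ≡⟨ cong₂ _+_ (∑-constant 6) (∑-* (proj₁ countS) 3 c₂) ⟩
        s₀ * 6 + 3 * ∑ c₂
          ≡⟨ cong (λ k → s₀ * 6 + 3 * k) moment₂ ⟩
        s₀ * 6 + 3 * (n * (n ∸ 1) * m₂) ∎)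
        where
        open ≡-Reasoning
        identity : ∀ {c} → c ≤ 3 →
          6 * δ 0 c + (6 * c + 1 * (c * ((c ∸ 1) * (c ∸ 1 ∸ 1)))) ≡ 6 + 3 * (c * (c ∸ 1))
        identity {0} _ = refl
        identity {1} _ = refl
        identity {2} _ = refl
        identity {3} _ = refl
        identity {suc (suc (suc (suc _)))} (s≤s (s≤s (s≤s ())))

open Counting


-- The characteristic of the field

module FieldProperties (F : FiniteField) where
  open FiniteField F

  commutativeRing : CommutativeRing 0ℓ 0ℓ
  commutativeRing = record { isCommutativeRing = isCommutativeRing }

  open CommutativeRing commutativeRing
    using (ring; semiring; +-assoc; +-comm; +-identityˡ; +-identityʳ; *-assoc; *-comm; *-identityˡ; *-identityʳ;
           zeroʳ; -‿inverseʳ)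
  open RingProperties ring using (+-cancelʳ)

  no-zero-divisors : ∀ {x y} → x * y ≡ 0# → x ≢ 0# → y ≡ 0#
  no-zero-divisors {x} {y} xy≡0 x≢0 with i , xi≡1 ← inverse x x≢0 = begin
    y            ≡⟨ *-identityˡ y ⟨
    1# * y       ≡⟨ cong (_* y) (trans (*-comm i x) xi≡1) ⟨
    i * x * y    ≡⟨ *-assoc i x y ⟩
    i * (x * y)  ≡⟨ cong (i *_) xy≡0 ⟩
    i * 0#       ≡⟨ zeroʳ i ⟩
    0#           ∎
    where open ≡-Reasoning

  open Mult semiring using (×1-homo-*) renaming (_×_ to _·_)

  -- Translation by 1 permutes the elements, so their sum equals itself plus q · 1.
  q·1≡0 : q · 1# ≡ 0#
  q·1≡0 = +-cancelʳ (total elements) (q · 1#) 0# (begin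
    q · 1# + total elements       ≡⟨ translate elements ⟨
    total (map (1# +_) elements)  ≡⟨ foldr-commMonoid (setoid Carrier) +-isCommutativeMonoid (↭⇒↭ₛ permuted) ⟩
    total elements                ≡⟨ +-identityˡ _ ⟨
    0# + total elements           ∎)
    where
    open ≡-Reasoning
    open CommutativeRing commutativeRing using (+-isCommutativeMonoid; +-commutativeSemigroup)
    open import Algebra.Properties.CommutativeSemigroup +-commutativeSemigroup using (interchange)
    total : List Carrier → Carrier
    total = foldr _+_ 0#
    translate : ∀ xs → total (map (1# +_) xs) ≡ length xs · 1# + total xs
    translate [] = sym (+-identityˡ 0#)
    translate (x ∷ xs) = trans (cong (1# + x +_) (translate xs)) (interchange 1# x _ _)
    +-cancelˡ′ : ∀ {x y} → 1# + x ≡ 1# + y → x ≡ y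
    +-cancelˡ′ {x} {y} e = +-cancelʳ 1# x y (trans (+-comm x 1#) (trans e (+-comm 1# y)))
    permuted = ∼bag⇒↭ (unique∧set⇒bag (Uniqueₚ.map⁺ +-cancelˡ′ distinct) distinct λ {x} → mk⇔
      (λ _ → complete x)
      (λ _ → subst (_∈ _)
        (trans (sym (+-assoc 1# (- 1#) x)) (trans (cong (_+ x) (-‿inverseʳ 1#)) (+-identityˡ x)))
        (∈-map⁺ (1# +_) (complete (- 1# + x)))))

  -- The multiple 3ᵏ · 1 = q · 1 is zero; without zero divisors one factor 3 · 1 after another can
  -- be stripped off, and running out of factors would give 1 = 0.
  characteristic-3 : ∀ k → q ≡ 3 ℕ.^ k → 1# + 1# + 1# ≡ 0#
  characteristic-3 k e = trans unfold (prime-power k (trans (cong (_· 1#) (sym e)) q·1≡0))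
    where
    unfold : 1# + 1# + 1# ≡ 3 · 1#
    unfold = trans (+-assoc 1# 1# 1#) (cong (λ x → 1# + (1# + x)) (sym (+-identityʳ 1#)))
    prime-power : ∀ k → (3 ℕ.^ k) · 1# ≡ 0# → 3 · 1# ≡ 0#
    prime-power zero e = contradiction (trans (sym e) (+-identityʳ 1#)) 0≢1
    prime-power (suc k) e with (3 · 1#) ≟ 0#
    ... | yes z = z
    ... | no nz = prime-power k (no-zero-divisors (trans (sym (×1-homo-* 3 (3 ℕ.^ k))) e) nz)

-- Polynomial identities in characteristic 3

data Z₃ : Set where
  𝟘 𝟙 𝟚 : Z₃

-- Coefficient ring of the solver: normal forms are taken modulo 3, so an identity such as (x - y)³
-- = x³ - y³ is decided like any other.
z₃ : RawRing 0ℓ 0ℓ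
z₃ = record { Carrier = Z₃ ; _≈_ = _≡_ ; _+_ = add ; _*_ = mul ; -_ = neg ; 0# = 𝟘 ; 1# = 𝟙 }
  where
  add mul : Z₃ → Z₃ → Z₃
  add 𝟘 y = y
  add 𝟙 𝟘 = 𝟙
  add 𝟙 𝟙 = 𝟚
  add 𝟙 𝟚 = 𝟘
  add 𝟚 𝟘 = 𝟚
  add 𝟚 𝟙 = 𝟘
  add 𝟚 𝟚 = 𝟙
  mul 𝟘 y = 𝟘
  mul 𝟙 y = y
  mul 𝟚 𝟘 = 𝟘
  mul 𝟚 𝟙 = 𝟚
  mul 𝟚 𝟚 = 𝟙
  neg : Z₃ → Z₃
  neg 𝟘 = 𝟘
  neg 𝟙 = 𝟚
  neg 𝟚 = 𝟙

Characteristic-3 : FiniteField → Set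
Characteristic-3 F = 1# + 1# + 1# ≡ 0#
  where open FiniteField F

module Char3 (F : FiniteField) (3≡0 : Characteristic-3 F) where
  open FiniteField F
  open FieldProperties F public
  open CommutativeRing commutativeRing public
    using (+-identityˡ; +-identityʳ; *-identityˡ; *-identityʳ; *-assoc; *-comm; zeroˡ; zeroʳ; -‿inverseʳ)
  private
    module R = CommutativeRing commutativeRing
    open RingProperties R.ring using (-0#≈0#; -‿involutive; -‿distribˡ-*; +-cancelʳ)

    1+1≡-1 : 1# + 1# ≡ - 1#
    1+1≡-1 = +-cancelʳ 1# _ _ (trans 3≡0 (sym (R.-‿inverseˡ 1#)))

    -1-1≡1 : - 1# + - 1# ≡ 1#
    -1-1≡1 = begin
      - 1# + - 1#          ≡⟨ cong (- 1# +_) (sym 1+1≡-1) ⟩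
      - 1# + (1# + 1#)     ≡⟨ R.+-assoc _ _ _ ⟨
      - 1# + 1# + 1#       ≡⟨ cong (_+ 1#) (R.-‿inverseˡ 1#) ⟩
      0# + 1#              ≡⟨ +-identityˡ 1# ⟩
      1#                   ∎
      where open ≡-Reasoning

    embed : z₃ -Raw-AlmostCommutative⟶ fromCommutativeRing commutativeRing
    embed = record
      { ⟦_⟧ = ⟦_⟧
      ; +-homo = λ { 𝟘 y → sym (+-identityˡ _) ; 𝟙 𝟘 → sym (+-identityʳ _) ; 𝟙 𝟙 → sym 1+1≡-1
                   ; 𝟙 𝟚 → sym (-‿inverseʳ 1#) ; 𝟚 𝟘 → sym (+-identityʳ _) ; 𝟚 𝟙 → sym (R.-‿inverseˡ 1#)
                   ; 𝟚 𝟚 → sym -1-1≡1 }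
      ; *-homo = λ { 𝟘 y → sym (zeroˡ _) ; 𝟙 y → sym (*-identityˡ _) ; 𝟚 𝟘 → sym (zeroʳ _)
                   ; 𝟚 𝟙 → sym (*-identityʳ _)
                   ; 𝟚 𝟚 → sym (trans (sym (-‿distribˡ-* _ _)) (trans (cong -_ (*-identityˡ _)) (-‿involutive 1#))) }
      ; -‿homo = λ { 𝟘 → sym -0#≈0# ; 𝟙 → refl ; 𝟚 → sym (-‿involutive 1#) }
      ; 0-homo = refl
      ; 1-homo = refl
      }
      where
      ⟦_⟧ : Z₃ → Carrier
      ⟦ 𝟘 ⟧ = 0#
      ⟦ 𝟙 ⟧ = 1#
      ⟦ 𝟚 ⟧ = - 1#

    decide : (x y : Z₃) → Maybe (_-Raw-AlmostCommutative⟶_.⟦_⟧ embed x ≡ _-Raw-AlmostCommutative⟶_.⟦_⟧ embed y)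
    decide 𝟘 𝟘 = just refl
    decide 𝟙 𝟙 = just refl
    decide 𝟚 𝟚 = just refl
    decide _ _ = nothing

  open RingSolver z₃ (fromCommutativeRing commutativeRing) embed decide public
    using (solve; _:=_; con; _:+_; _:*_; _:-_; :-_)

  infixl 6 _-_
  _-_ : Carrier → Carrier → Carrier
  x - y = x + - y

  -- To deduce a ≡ b from hypotheses lᵢ ≡ rᵢ, exhibit a − b as a combination of the lᵢ − rᵢ.
  infixr 7 _⊛_
  _⊛_ : ∀ c {l r} → l ≡ r → c * (l - r) ≡ 0#
  c ⊛ refl = trans (cong (c *_) (-‿inverseʳ _)) (zeroʳ c)

  infixr 6 _⊞_
  _⊞_ : ∀ {x y} → x ≡ 0# → y ≡ 0# → x + y ≡ 0#
  refl ⊞ refl = +-identityˡ 0#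

  combine : ∀ {a b z} → z ≡ 0# → a ≡ b + z → a ≡ b
  combine refl e = trans e (+-identityʳ _)

  *-nonzero : ∀ {x y} → x ≢ 0# → y ≢ 0# → x * y ≢ 0#
  *-nonzero x≢0 y≢0 e = y≢0 (no-zero-divisors e x≢0)

  1≢0 : 1# ≢ 0#
  1≢0 = 0≢1 ∘ sym

  *-cancelˡ : ∀ {c x y} → c ≢ 0# → c * x ≡ c * y → x ≡ y
  *-cancelˡ {c} {x} {y} c≢0 e =
    combine (1# ⊛ no-zero-divisors {c} {x - y} (combine (1# ⊛ e)
        (solve 3 (λ c x y → c :* (x :- y) := con 𝟘 :+ con 𝟙 :* (c :* x :- c :* y)) refl c x y)) c≢0)
      (solve 2 (λ x y → x := y :+ con 𝟙 :* (x :- y :- con 𝟘)) refl x y)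

  inv : ∀ {x} → x ≢ 0# → Carrier
  inv {x} x≢0 = proj₁ (inverse x x≢0)

  inv-* : ∀ {x} (x≢0 : x ≢ 0#) → x * inv x≢0 ≡ 1#
  inv-* {x} x≢0 = proj₂ (inverse x x≢0)

  factor-≢0 : ∀ {x y} → x * y ≡ 1# → x ≢ 0#
  factor-≢0 {y = y} e refl = 0≢1 (trans (sym (zeroˡ y)) e)

  inv-≢0 : ∀ {x} (x≢0 : x ≢ 0#) → inv x≢0 ≢ 0#
  inv-≢0 {x} x≢0 = factor-≢0 (trans (*-comm _ x) (inv-* x≢0))

  difference-≢0 : ∀ {x y} → x ≢ y → x - y ≢ 0#
  difference-≢0 {x} {y} x≢y e = x≢y (combine (1# ⊛ e)
    (solve 2 (λ x y → x := y :+ con 𝟙 :* (x :- y :- con 𝟘)) refl x y))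

  finite : Finite Carrier
  finite = record
    { all = elements , distinct , (λ x → mk⇔ (λ _ → tt) (λ _ → complete x)) , refl
    ; _≟_ = _≟_ }

  -- The cube of x - y is x³ - y³, and a nonzero element has a nonzero cube.
  cube-injective : ∀ {x y} → x * x * x ≡ y * y * y → x ≡ y
  cube-injective {x} {y} e with x ≟ y
  ... | yes x≡y = x≡y
  ... | no x≢y = contradiction (combine (1# ⊛ e)
      (solve 2 (λ x y → (x :- y) :* ((x :- y) :* (x :- y)) := con 𝟘 :+ con 𝟙 :* (x :* x :* x :- y :* y :* y)) refl x y))
    (*-nonzero (difference-≢0 x≢y) (*-nonzero (difference-≢0 x≢y) (difference-≢0 x≢y)))

  cube-root : ∀ y → ∃ λ x → x * x * x ≡ y
  cube-root = injective⇒surjective finite (λ x → x * x * x) cube-injective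

-- Homogeneous vectors and the twisted cubic

module Points (F : FiniteField) (3≡0 : Characteristic-3 F) where
  open Geometry F
  open Char3 F 3≡0 public

  vector-≡ : ∀ {a b c d a′ b′ c′ d′ : Carrier} → a ≡ a′ → b ≡ b′ → c ≡ c′ → d ≡ d′ →
    _≡_ {A = V4} (a , b , c , d) (a′ , b′ , c′ , d′)
  vector-≡ refl refl refl refl = refl

  0⃗ : V4
  0⃗ = 0# , 0# , 0# , 0#

  finiteV4 : Finite V4
  finiteV4 = finite-× finite (finite-× finite (finite-× finite finite))

  q-nonZero : NonZero q
  q-nonZero = ℕ.≢-nonZero λ e →
    count-zero (subst (HasCount _) e (Finite.all finite)) 0# tt

  dot-linear : ∀ v k e x → dot (v ⊕ (k • e)) x ≡ dot v x + k * dot e x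
  dot-linear (a , b , c , d) k (a′ , b′ , c′ , d′) (x , y , z , w) =
    trans (cong₂ _+_ (cong₂ _+_ (cong₂ _+_ (expand a a′ x) (expand b b′ y)) (expand c c′ z)) (expand d d′ w))
      (solve 9 (λ k a b c d x y z w → (a :+ k :* x) :+ (b :+ k :* y) :+ (c :+ k :* z) :+ (d :+ k :* w) :=
        (a :+ b :+ c :+ d) :+ k :* (x :+ y :+ z :+ w)) refl k _ _ _ _ _ _ _ _)
    where
    expand : ∀ a a′ x → (a + k * a′) * x ≡ a * x + k * (a′ * x)
    expand a a′ x = solve 4 (λ a k a′ x → (a :+ k :* a′) :* x := a :* x :+ k :* (a′ :* x)) refl a k a′ x

  dot-• : ∀ k v x → dot (k • v) x ≡ k * dot v x
  dot-• k (a , b , c , d) (x , y , z , w) =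
    solve 9 (λ k a b c d x y z w → k :* a :* x :+ k :* b :* y :+ k :* c :* z :+ k :* d :* w :=
      k :* (a :* x :+ b :* y :+ c :* z :+ d :* w)) refl k a b c d x y z w

  dot-comm : ∀ v x → dot v x ≡ dot x v
  dot-comm (a , b , c , d) (x , y , z , w) =
    solve 8 (λ a b c d x y z w → a :* x :+ b :* y :+ c :* z :+ d :* w := x :* a :+ y :* b :+ z :* c :+ w :* d)
      refl a b c d x y z w

  dot-zero : ∀ x → dot 0⃗ x ≡ 0#
  dot-zero (x , y , z , w) =
    solve 4 (λ x y z w → con 𝟘 :* x :+ con 𝟘 :* y :+ con 𝟘 :* z :+ con 𝟘 :* w := con 𝟘) refl x y z w

  -- Normalisation of homogeneous coordinates

  private
    pick : Carrier → Carrier → Carrier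
    pick x r with x ≟ 0#
    ... | yes _ = r
    ... | no _ = x

    pick-zero : ∀ r → pick 0# r ≡ r
    pick-zero r with 0# ≟ 0#
    ... | yes _ = refl
    ... | no 0≢0 = contradiction refl 0≢0

    pick-≢0 : ∀ {x} r → x ≢ 0# → pick x r ≡ x
    pick-≢0 {x} r x≢0 with x ≟ 0#
    ... | yes x≡0 = contradiction x≡0 x≢0
    ... | no _ = refl

    pick-* : ∀ {k} x r → k ≢ 0# → pick (k * x) (k * r) ≡ k * pick x r
    pick-* {k} x r k≢0 with x ≟ 0#
    ... | yes refl = trans (cong (λ z → pick z (k * r)) (zeroʳ k)) (pick-zero _)
    ... | no x≢0 = pick-≢0 _ (*-nonzero k≢0 x≢0)

  -- The last nonzero coordinate, or 0 for the zero vector. Being normalised amounts to having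
  -- leading coordinate 1, a decidable condition that behaves well under scaling.
  leading : V4 → Carrier
  leading (a , b , c , d) = pick d (pick c (pick b a))

  leading-• : ∀ {k} v → k ≢ 0# → leading (k • v) ≡ k * leading v
  leading-• {k} (a , b , c , d) k≢0 = trans
    (cong (pick (k * d)) (trans (cong (pick (k * c)) (pick-* b a k≢0)) (pick-* c _ k≢0)))
    (pick-* d _ k≢0)

  normalized⇒leading : ∀ {v} → Normalized v → leading v ≡ 1#
  normalized⇒leading (inj₁ refl) = pick-≢0 _ 1≢0
  normalized⇒leading (inj₂ (inj₁ (refl , refl))) = trans (pick-zero _) (pick-≢0 _ 1≢0)
  normalized⇒leading (inj₂ (inj₂ (inj₁ (refl , refl , refl)))) =
    trans (pick-zero _) (trans (pick-zero _) (pick-≢0 _ 1≢0))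
  normalized⇒leading (inj₂ (inj₂ (inj₂ (refl , refl , refl , refl)))) =
    trans (pick-zero _) (trans (pick-zero _) (pick-zero _))

  leading⇒normalized : ∀ v → leading v ≡ 1# → Normalized v
  leading⇒normalized (a , b , c , d) e with d ≟ 0#
  ... | no _ = inj₁ e
  ... | yes d≡0 with c ≟ 0#
  ...   | no _ = inj₂ (inj₁ (d≡0 , e))
  ...   | yes c≡0 with b ≟ 0#
  ...     | no _ = inj₂ (inj₂ (inj₁ (d≡0 , c≡0 , e)))
  ...     | yes b≡0 = inj₂ (inj₂ (inj₂ (d≡0 , c≡0 , b≡0 , e)))

  normalized? : Decidable Normalized
  normalized? v = map′ (leading⇒normalized v) normalized⇒leading (leading v ≟ 1#)

  leading-≢0 : ∀ v → v ≢ 0⃗ → leading v ≢ 0#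
  leading-≢0 (a , b , c , d) v≢0 with d ≟ 0#
  ... | no d≢0 = d≢0
  ... | yes refl with c ≟ 0#
  ...   | no c≢0 = c≢0
  ...   | yes refl with b ≟ 0#
  ...     | no b≢0 = b≢0
  ...     | yes refl = λ { refl → v≢0 refl }

  •-• : ∀ k l v → k • (l • v) ≡ (k * l) • v
  •-• k l (a , b , c , d) =
    vector-≡ (sym (*-assoc k l a)) (sym (*-assoc k l b)) (sym (*-assoc k l c)) (sym (*-assoc k l d))

  1• : ∀ v → 1# • v ≡ v
  1• (a , b , c , d) = vector-≡ (*-identityˡ a) (*-identityˡ b) (*-identityˡ c) (*-identityˡ d)

  •-zero : ∀ k → k • 0⃗ ≡ 0⃗
  •-zero k = vector-≡ (zeroʳ k) (zeroʳ k) (zeroʳ k) (zeroʳ k)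

  •-cancel : ∀ {k} → k ≢ 0# → ∀ v w → k • v ≡ k • w → v ≡ w
  •-cancel k≢0 (a , b , c , d) (a′ , b′ , c′ , d′) e = vector-≡
    (*-cancelˡ k≢0 (cong proj₁ e)) (*-cancelˡ k≢0 (cong (proj₁ ∘ proj₂) e))
    (*-cancelˡ k≢0 (cong (proj₁ ∘ proj₂ ∘ proj₂) e)) (*-cancelˡ k≢0 (cong (proj₂ ∘ proj₂ ∘ proj₂) e))

  normalized-≢0 : ∀ {v} → Normalized v → v ≢ 0⃗
  normalized-≢0 nv refl =
    0≢1 (trans (sym (trans (pick-zero _) (trans (pick-zero _) (pick-zero _)))) (normalized⇒leading nv))

  normalize : ∀ v → v ≢ 0⃗ → ∃₂ λ k w → k ≢ 0# × Normalized w × k • w ≡ v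
  normalize v v≢0 =
    leading v , i • v , l≢0 ,
    leading⇒normalized (i • v) (trans (leading-• v i≢0) (trans (*-comm i _) (inv-* l≢0))) ,
    trans (•-• _ i v) (trans (cong (_• v) (inv-* l≢0)) (1• v))
    where
    l≢0 = leading-≢0 v v≢0
    i = inv l≢0
    i≢0 = inv-≢0 l≢0

  normalize-unique : ∀ {k l v w} → k ≢ 0# → l ≢ 0# → Normalized v → Normalized w →
    k • v ≡ l • w → k ≡ l × v ≡ w
  normalize-unique {k} {l} {v} {w} k≢0 l≢0 nv nw e =
    k≡l , •-cancel k≢0 v w (trans e (cong (_• w) (sym k≡l)))
    where
    lead : ∀ {k v} → k ≢ 0# → Normalized v → leading (k • v) ≡ k
    lead k≢0 nv = trans (leading-• _ k≢0) (trans (cong (_ *_) (normalized⇒leading nv)) (*-identityʳ _))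
    k≡l = trans (sym (lead k≢0 nv)) (trans (cong leading e) (lead l≢0 nw))

  -- In a cone `Z` each nonzero vector is a nonzero scalar times a normalised vector of `Z` in
  -- exactly one way.
  count-normalized : {Z : V4 → Set} {n : ℕ} → HasCount Z n → Decidable Z → Z 0⃗ →
    (∀ k v → k ≢ 0# → Z v → Z (k • v)) →
    ∃ λ m → HasCount (λ v → Normalized v × Z v) m × m ℕ.* (q ∸ 1) ≡ n ∸ 1
  count-normalized {Z} h Z? z0 scale =
    _ , hn , count-unique
      (count-image {Q = λ v → Z v × v ≢ 0⃗} (λ ((v , k) : V4 × Carrier) → k • v)
        (count-Σ hn λ _ → count-remove _≟_ (Finite.all finite) 0# tt)
        (λ { {v , k} {w , l} ((nv , _) , _ , k≢0) ((nw , _) , _ , l≢0) e →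
             let (k≡l , v≡w) = normalize-unique k≢0 l≢0 nv nw e in cong₂ _,_ v≡w k≡l })
        (λ {(v , k)} ((nv , z) , _ , k≢0) → scale k v k≢0 z , λ e →
             normalized-≢0 nv (•-cancel k≢0 v 0⃗ (trans e (sym (•-zero k)))))
        onto)
      (count-remove (Finite._≟_ finiteV4) h 0⃗ z0)
    where
    hn = Finite.has-count finiteV4 (λ v → normalized? v ×-dec Z? v)
    onto : ∀ {v} → Z v × v ≢ 0⃗ → ∃ λ ((w , k) : V4 × Carrier) → ((Normalized w × Z w) × _ × k ≢ 0#) × k • w ≡ v
    onto {v} (z , v≢0) with k , w , k≢0 , nw , e ← normalize v v≢0 =
      (w , k) , ((nw , subst Z unscale (scale i v (inv-≢0 k≢0) z)) , tt , k≢0) , e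
      where
      i = inv k≢0
      unscale : i • v ≡ w
      unscale = trans (cong (i •_) (sym e)) (trans (•-• i k w) (trans (cong (_• w) (trans (*-comm i k) (inv-* k≢0))) (1• w)))

  -- Homogeneous parametrisation of the twisted cubic by the projective line

  ℙ¹ : Set
  ℙ¹ = Maybe Carrier

  finiteℙ¹ : Finite ℙ¹
  finiteℙ¹ = finite-Maybe finite

  X Y : ℙ¹ → Carrier
  X nothing = 1#
  X (just t) = t
  Y nothing = 0#
  Y (just _) = 1#

  cubic : Carrier → Carrier → V4
  cubic x y = x * x * x , x * x * y , x * y * y , y * y * y

  pt : ℙ¹ → V4
  pt nothing = P∞
  pt (just t) = P t

  pt-cubic : ∀ b → pt b ≡ cubic (X b) (Y b)
  pt-cubic nothing = vector-≡ (solve 0 (con 𝟙 := con 𝟙 :* con 𝟙 :* con 𝟙) refl)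
    (solve 0 (con 𝟘 := con 𝟙 :* con 𝟙 :* con 𝟘) refl) (solve 0 (con 𝟘 := con 𝟙 :* con 𝟘 :* con 𝟘) refl)
    (solve 0 (con 𝟘 := con 𝟘 :* con 𝟘 :* con 𝟘) refl)
  pt-cubic (just t) = vector-≡ refl (solve 1 (λ t → t :* t := t :* t :* con 𝟙) refl t)
    (solve 1 (λ t → t := t :* con 𝟙 :* con 𝟙) refl t) (solve 0 (con 𝟙 := con 𝟙 :* con 𝟙 :* con 𝟙) refl)

  det : ℙ¹ → ℙ¹ → Carrier
  det b b′ = X b * Y b′ - Y b * X b′

  det-self : ∀ b → det b b ≡ 0#
  det-self b = solve 2 (λ x y → x :* y :- y :* x := con 𝟘) refl (X b) (Y b)

  det-≢0 : ∀ {b b′} → b ≢ b′ → det b b′ ≢ 0#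
  det-≢0 {nothing} {nothing} ne = contradiction refl ne
  det-≢0 {nothing} {just t} _ e = 1≢0 (trans (solve 1 (λ t → con 𝟙 := con 𝟙 :* con 𝟙 :- con 𝟘 :* t) refl t) e)
  det-≢0 {just s} {nothing} _ e = 1≢0 (combine (- 1# ⊛ e)
    (solve 1 (λ s → con 𝟙 := con 𝟘 :+ :- con 𝟙 :* (s :* con 𝟘 :- con 𝟙 :* con 𝟙 :- con 𝟘)) refl s))
  det-≢0 {just s} {just t} ne e = difference-≢0 (λ s≡t → ne (cong just s≡t))
    (trans (solve 2 (λ s t → s :- t := s :* con 𝟙 :- con 𝟙 :* t) refl s t) e)

  pt-injective : ∀ {b b′} → pt b ≡ pt b′ → b ≡ b′
  pt-injective {nothing} {nothing} _ = refl
  pt-injective {nothing} {just _} e = contradiction (cong (proj₂ ∘ proj₂ ∘ proj₂) e) 0≢1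
  pt-injective {just _} {nothing} e = contradiction (sym (cong (proj₂ ∘ proj₂ ∘ proj₂) e)) 0≢1
  pt-injective {just _} {just _} e = cong (just ∘ proj₁ ∘ proj₂ ∘ proj₂) e

  pt-isPoint : ∀ b → IsPoint (pt b)
  pt-isPoint nothing = inj₂ (inj₂ (inj₂ (refl , refl , refl , refl)))
  pt-isPoint (just _) = inj₁ refl

  pt-OnC : ∀ b → OnC (pt b)
  pt-OnC nothing = inj₂ refl
  pt-OnC (just t) = inj₁ (t , refl)

  OnC-pt : ∀ {x} → OnC x → ∃ λ b → pt b ≡ x
  OnC-pt (inj₁ (t , refl)) = just t , refl
  OnC-pt (inj₂ refl) = nothing , refl

  On : V4 → ℙ¹ → Set
  On π b = InPlane π (pt b)

  dC⇒count : ∀ {d π} → Is-dC d π → HasCount (On π) d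
  dC⇒count h = count-image toPt h
    (λ { (_ , c , _) (_ , c′ , _) e → trans (sym (toPt-pt c)) (trans (cong pt e) (toPt-pt c′)) })
    (λ { {x} (_ , c , z) → subst (InPlane _) (sym (toPt-pt c)) z })
    (λ {b} z → pt b , (pt-isPoint b , pt-OnC b , z) , pt-injective (toPt-pt (pt-OnC b)))
    where
    -- The third coordinate of P(t) is t itself; a vanishing last coordinate marks P(∞).
    toPt : V4 → ℙ¹
    toPt (_ , _ , c , d) with d ≟ 0#
    ... | yes _ = nothing
    ... | no _ = just c
    toPt-pt : ∀ {x} → OnC x → pt (toPt x) ≡ x
    toPt-pt (inj₁ (t , refl)) with 1# ≟ 0#
    ... | yes e = contradiction e 1≢0
    ... | no _ = refl
    toPt-pt (inj₂ refl) with 0# ≟ 0#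
    ... | yes _ = refl
    ... | no ne = contradiction refl ne

  count⇒dC : ∀ {d π} → HasCount (On π) d → Is-dC d π
  count⇒dC h = count-image pt h (λ _ _ → pt-injective) (λ {b} z → pt-isPoint b , pt-OnC b , z)
    λ { (_ , c , z) → let (b , e) = OnC-pt c in b , subst (InPlane _) (sym e) z , e }

  -- The plane with binary form ∏ᵢ (Y bᵢ · x − X bᵢ · y).
  secant : ℙ¹ → ℙ¹ → ℙ¹ → V4
  secant b₁ b₂ b₃ =
    Y b₁ * Y b₂ * Y b₃ ,
    - (Y b₁ * Y b₂ * X b₃ + Y b₁ * X b₂ * Y b₃ + X b₁ * Y b₂ * Y b₃) ,
    Y b₁ * X b₂ * X b₃ + X b₁ * Y b₂ * X b₃ + X b₁ * X b₂ * Y b₃ ,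
    - (X b₁ * X b₂ * X b₃)

  dot-secant : ∀ b₁ b₂ b₃ b → dot (secant b₁ b₂ b₃) (pt b) ≡ det b b₁ * (det b b₂ * det b b₃)
  dot-secant b₁ b₂ b₃ b = trans (cong (dot (secant b₁ b₂ b₃)) (pt-cubic b))
    (solve 8 (λ x₁ y₁ x₂ y₂ x₃ y₃ x y →
      y₁ :* y₂ :* y₃ :* (x :* x :* x)
      :+ (:- (y₁ :* y₂ :* x₃ :+ y₁ :* x₂ :* y₃ :+ x₁ :* y₂ :* y₃)) :* (x :* x :* y)
      :+ (y₁ :* x₂ :* x₃ :+ x₁ :* y₂ :* x₃ :+ x₁ :* x₂ :* y₃) :* (x :* y :* y)
      :+ (:- (x₁ :* x₂ :* x₃)) :* (y :* y :* y)
      := (x :* y₁ :- y :* x₁) :* ((x :* y₂ :- y :* x₂) :* (x :* y₃ :- y :* x₃)))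
      refl (X b₁) (Y b₁) (X b₂) (Y b₂) (X b₃) (Y b₃) (X b) (Y b))

  -- A rescaled secant plane, acting as a Lagrange basis vector. The three points may coincide, so
  -- the lemma also serves when fewer than three conditions are imposed.
  separate : ∀ b₁ b₂ b₃ {b} → b ≢ b₁ → b ≢ b₂ → b ≢ b₃ →
    ∃ λ e → dot e (pt b) ≡ 1# × On e b₁ × On e b₂ × On e b₃
  separate b₁ b₂ b₃ {b} ≢₁ ≢₂ ≢₃ = i • s ,
    trans (dot-• i s (pt b)) (trans (*-comm i _) (inv-* value≢0)) ,
    vanish {b₁} (trans (cong (_* (det b₁ b₂ * det b₁ b₃)) (det-self b₁)) (zeroˡ _)) ,
    vanish {b₂} (trans (cong (λ z → det b₂ b₁ * (z * det b₂ b₃)) (det-self b₂)) (trans (cong (det b₂ b₁ *_) (zeroˡ _)) (zeroʳ _))) ,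
    vanish {b₃} (trans (cong (λ z → det b₃ b₁ * (det b₃ b₂ * z)) (det-self b₃)) (trans (cong (det b₃ b₁ *_) (zeroʳ _)) (zeroʳ _)))
    where
    s = secant b₁ b₂ b₃
    value≢0 : dot s (pt b) ≢ 0#
    value≢0 e = *-nonzero (det-≢0 ≢₁) (*-nonzero (det-≢0 ≢₂) (det-≢0 ≢₃)) (trans (sym (dot-secant b₁ b₂ b₃ b)) e)
    i = inv value≢0
    vanish : ∀ {b′} → det b′ b₁ * (det b′ b₂ * det b′ b₃) ≡ 0# → On (i • s) b′
    vanish {b′} z≡0 = trans (dot-• i s (pt b′))
      (trans (cong (i *_) (trans (dot-secant b₁ b₂ b₃ b′) z≡0)) (zeroʳ i))

  -- The fibres of a linear functional on S are translates of each other along e.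
  count-kernel : ∀ {S : V4 → Set} {n} b e → HasCount S (q ℕ.* n) → dot e (pt b) ≡ 1# →
    (∀ k v → S v → S (v ⊕ (k • e))) → HasCount (λ v → S v × On v b) n
  count-kernel {S} {n} b e h value shift = conclude (count-filter h (λ v → dot v (pt b) ≟ 0#))
    where
    Kernel : V4 → Set
    Kernel v = S v × On v b
    move : ∀ k v → dot (v ⊕ (k • e)) (pt b) ≡ dot v (pt b) + k
    move k v = trans (dot-linear v k e (pt b)) (cong (dot v (pt b) +_) (trans (cong (k *_) value) (*-identityʳ k)))
    shift-back : ∀ v k → (v ⊕ ((- k) • e)) ⊕ (k • e) ≡ v
    shift-back (a , b , c , d) k = vector-≡ (cancel a _) (cancel b _) (cancel c _) (cancel d _)
      where
      cancel : ∀ a e → a + - k * e + k * e ≡ a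
      cancel a e = solve 3 (λ a k e → a :+ :- k :* e :+ k :* e := a) refl a k e
    ⊕-cancel : ∀ k v w → v ⊕ (k • e) ≡ w ⊕ (k • e) → v ≡ w
    ⊕-cancel k (a , b , c , d) (a′ , b′ , c′ , d′) eq = vector-≡
      (cancel (cong proj₁ eq)) (cancel (cong (proj₁ ∘ proj₂) eq))
      (cancel (cong (proj₁ ∘ proj₂ ∘ proj₂) eq)) (cancel (cong (proj₂ ∘ proj₂ ∘ proj₂) eq))
      where
      cancel : ∀ {a a′ x} → a + x ≡ a′ + x → a ≡ a′
      cancel {a} {a′} {x} eq = combine (1# ⊛ eq)
        (solve 3 (λ a a′ x → a := a′ :+ con 𝟙 :* (a :+ x :- (a′ :+ x))) refl a a′ x)
    same : ∀ {v} k → On v b → dot (v ⊕ (k • e)) (pt b) ≡ k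
    same {v} k z = trans (move k v) (trans (cong (_+ k) z) (+-identityˡ k))
    Source : V4 × Carrier → Set
    Source (v , k) = Kernel v × ⊤
    injective : ∀ {x y} → Source x → Source y → proj₁ x ⊕ (proj₂ x • e) ≡ proj₁ y ⊕ (proj₂ y • e) → x ≡ y
    injective {v , k} {w , l} ((_ , z) , _) ((_ , z′) , _) eq = cong₂ _,_
      (⊕-cancel k v w (trans eq (cong (λ l → w ⊕ (l • e)) (sym k≡l)))) k≡l
      where
      k≡l : k ≡ l
      k≡l = trans (sym (same {v} k z)) (trans (cong (λ u → dot u (pt b)) eq) (same {w} l z′))
    spread : ∀ {m} → HasCount Kernel m → HasCount S (m ℕ.* q)
    spread kernel = count-image {P = Source} (λ (v , k) → v ⊕ (k • e)) (count-Σ kernel λ _ → Finite.all finite)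
      injective (λ {(v , k)} ((s , _) , _) → shift k v s)
      (λ {v} s → (v ⊕ ((- dot v (pt b)) • e) , dot v (pt b)) ,
        ((shift _ v s , trans (move _ v) (-‿inverseʳ _)) , tt) , shift-back v _)
    conclude : ∀ {m} → HasCount Kernel m → HasCount Kernel n
    conclude {m} kernel = subst (HasCount Kernel)
      (ℕₚ.*-cancelˡ-≡ m n q {{q-nonZero}} (trans (ℕₚ.*-comm q m) (count-unique (spread kernel) h))) kernel

  On-shift : ∀ b {e} → On e b → ∀ k v → On v b → On (v ⊕ (k • e)) b
  On-shift b {e} ze k v zv = trans (dot-linear v k e (pt b))
    (trans (cong₂ (λ x y → x + k * y) zv ze) (trans (+-identityˡ _) (zeroʳ k)))

  count-V4 : HasCount {V4} (λ _ → ⊤) (q ℕ.* (q ℕ.* (q ℕ.* q)))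
  count-V4 = Finite.all finiteV4

  -- Here and in the next three counts a further point divides the number of vectors by q, since
  -- `separate` supplies a vector that vanishes at the earlier points but not at the new one.
  count-K₁ : ∀ b → HasCount (λ v → On v b) (q ℕ.* (q ℕ.* q))
  count-K₁ b =
    let b₁ , ne = other b
        e , value , _ = separate b₁ b₁ b₁ ne ne ne
    in count-cong proj₂ (tt ,_) (count-kernel {S = λ _ → ⊤} b e count-V4 value λ _ _ _ → tt)
    where
    other : (b : ℙ¹) → ∃ λ b₁ → b ≢ b₁
    other nothing = just 0# , λ ()
    other (just _) = nothing , λ ()

  count-K₂ : ∀ b b′ → b′ ≢ b → HasCount (λ v → On v b × On v b′) (q ℕ.* q)
  count-K₂ b b′ ne =
    let e , value , z , _ = separate b b b ne ne ne
    in count-kernel b′ e (count-K₁ b) value (On-shift b z)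

  count-K₃ : ∀ b b′ b″ → b′ ≢ b → b″ ≢ b → b″ ≢ b′ → HasCount (λ v → (On v b × On v b′) × On v b″) q
  count-K₃ b b′ b″ ne ne₁ ne₂ =
    let e , value , z , z′ , _ = separate b b′ b ne₁ ne₂ ne₁
    in count-kernel b″ e (count-K₂ b b′ ne) value λ k v (o , o′) → On-shift b z k v o , On-shift b′ z′ k v o′

  count-K₄ : ∀ b b′ b″ b‴ → b′ ≢ b → b″ ≢ b → b″ ≢ b′ → b‴ ≢ b → b‴ ≢ b′ → b‴ ≢ b″ →
    HasCount (λ v → ((On v b × On v b′) × On v b″) × On v b‴) 1
  count-K₄ b b′ b″ b‴ ne ne₁ ne₂ ≢₁ ≢₂ ≢₃ =
    let e , value , z , z′ , z″ = separate b b′ b″ ≢₁ ≢₂ ≢₃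
    in count-kernel b‴ e (subst (HasCount _) (sym (ℕₚ.*-identityʳ q)) (count-K₃ b b′ b″ ne ne₁ ne₂)) value
      λ k v ((o , o′) , o″) → (On-shift b z k v o , On-shift b′ z′ k v o′) , On-shift b″ z″ k v o″

-- Planes of each type

module PlaneCounts (F : FiniteField) (3≡0 : Characteristic-3 F)
  (p : ℕ) (q≡1+p : FiniteField.q F ≡ suc p) (1≤p : 1 ℕ.≤ p) where
  open Geometry F
  open Points F 3≡0 public

  private instance
    p-nonZero : NonZero p
    p-nonZero = ℕ.>-nonZero 1≤p

  On? : ∀ π → Decidable (On π)
  On? π b = dot π (pt b) ≟ 0#

  -- With p = q - 1 the last hypothesis reads n = 1 + k(q - 1). Keeping p as a separate number lets
  -- the semiring solver replace q by 1 + p and so handle what would otherwise be subtractions.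
  count-planes : {Z : V4 → Set} {n k : ℕ} → HasCount Z n → Decidable Z → Z 0⃗ →
    (∀ k v → k ≢ 0# → Z v → Z (k • v)) → suc (k ℕ.* p) ≡ n → HasCount (λ v → IsPlane v × Z v) k
  count-planes {Z} {n} {k} h Z? z0 scale e =
    let m , hm , em = count-normalized h Z? z0 scale
    in subst (HasCount _) (ℕₚ.*-cancelʳ-≡ m k p (trans (subst (λ r → m ℕ.* r ≡ n ∸ 1) (cong (_∸ 1) q≡1+p) em)
         (cong (_∸ 1) (sym e)))) hm

  private
    On-0⃗ : ∀ b → On 0⃗ b
    On-0⃗ b = dot-zero (pt b)

    On-• : ∀ b k v → On v b → On (k • v) b
    On-• b k v z = trans (dot-• k v (pt b)) (trans (cong (k *_) z) (zeroʳ k))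

    open +-*-Solver using () renaming (solve to solveℕ; _:=_ to _:≡_; con to conℕ; _:+_ to _⊹_; _:*_ to _⊗_)

  planes₀ : HasCount IsPlane (1 ℕ.+ q ℕ.+ q ℕ.* q ℕ.+ q ℕ.* (q ℕ.* q))
  planes₀ = count-cong proj₁ (_, tt) (count-planes {Z = λ _ → ⊤} count-V4 (λ _ → yes tt) tt (λ _ _ _ _ → tt)
    (subst (λ q → suc ((1 ℕ.+ q ℕ.+ q ℕ.* q ℕ.+ q ℕ.* (q ℕ.* q)) ℕ.* p) ≡ q ℕ.* (q ℕ.* (q ℕ.* q))) (sym q≡1+p)
      (solveℕ 1 (λ p → let q = conℕ 1 ⊹ p in
        conℕ 1 ⊹ (conℕ 1 ⊹ q ⊹ q ⊗ q ⊹ q ⊗ (q ⊗ q)) ⊗ p :≡ q ⊗ (q ⊗ (q ⊗ q))) refl p)))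

  planes₁ : ∀ b → HasCount (λ π → IsPlane π × On π b) (1 ℕ.+ q ℕ.+ q ℕ.* q)
  planes₁ b = count-planes (count-K₁ b) (λ v → On? v b) (On-0⃗ b) (λ k v _ → On-• b k v)
    (subst (λ q → suc ((1 ℕ.+ q ℕ.+ q ℕ.* q) ℕ.* p) ≡ q ℕ.* (q ℕ.* q)) (sym q≡1+p)
      (solveℕ 1 (λ p → let q = conℕ 1 ⊹ p in conℕ 1 ⊹ (conℕ 1 ⊹ q ⊹ q ⊗ q) ⊗ p :≡ q ⊗ (q ⊗ q)) refl p))

  planes₂ : ∀ b b′ → b′ ≢ b → HasCount (λ π → IsPlane π × On π b × On π b′) (1 ℕ.+ q)
  planes₂ b b′ ne = count-planes (count-K₂ b b′ ne) (λ v → On? v b ×-dec On? v b′) (On-0⃗ b , On-0⃗ b′)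
    (λ k v _ (z , z′) → On-• b k v z , On-• b′ k v z′)
    (subst (λ q → suc ((1 ℕ.+ q) ℕ.* p) ≡ q ℕ.* q) (sym q≡1+p)
      (solveℕ 1 (λ p → let q = conℕ 1 ⊹ p in conℕ 1 ⊹ (conℕ 1 ⊹ q) ⊗ p :≡ q ⊗ q) refl p))

  planes₃ : ∀ b b′ b″ → b′ ≢ b → b″ ≢ b → b″ ≢ b′ →
    HasCount (λ π → IsPlane π × On π b × On π b′ × On π b″) 1
  planes₃ b b′ b″ ne ne₁ ne₂ = count-cong
    (λ (n , (z , z′) , z″) → n , z , z′ , z″) (λ (n , z , z′ , z″) → n , (z , z′) , z″)
    (count-planes (count-K₃ b b′ b″ ne ne₁ ne₂) (λ v → (On? v b ×-dec On? v b′) ×-dec On? v b″)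
      ((On-0⃗ b , On-0⃗ b′) , On-0⃗ b″)
      (λ k v _ ((z , z′) , z″) → (On-• b k v z , On-• b′ k v z′) , On-• b″ k v z″)
      (trans (cong suc (ℕₚ.*-identityˡ p)) (sym q≡1+p)))

  -- A nonzero binary cubic form has at most three roots: four independent conditions leave only the
  -- zero vector, hence `k = 0` planes.
  planes₄ : ∀ b b′ b″ b‴ {π} → b′ ≢ b → b″ ≢ b → b″ ≢ b′ → b‴ ≢ b → b‴ ≢ b′ → b‴ ≢ b″ →
    IsPlane π → On π b → On π b′ → On π b″ → On π b‴ → ⊥
  planes₄ b b′ b″ b‴ {π} ne ne₁ ne₂ ≢₁ ≢₂ ≢₃ n z z′ z″ z‴ =
    count-zero (count-planes {k = 0} (count-K₄ b b′ b″ b‴ ne ne₁ ne₂ ≢₁ ≢₂ ≢₃)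
      (λ v → ((On? v b ×-dec On? v b′) ×-dec On? v b″) ×-dec On? v b‴)
      (((On-0⃗ b , On-0⃗ b′) , On-0⃗ b″) , On-0⃗ b‴)
      (λ k v _ (((z , z′) , z″) , z‴) → ((On-• b k v z , On-• b′ k v z′) , On-• b″ k v z″) , On-• b‴ k v z‴)
      refl) π (n , ((z , z′) , z″) , z‴)

  private
    no-four : ∀ {π b t} → IsPlane π → On π b → Triples (λ c → On π c × c ≢ b) t → ⊥
    no-four {π} {b} {b′ , b″ , b‴} n z ((z′ , ne) , ((z″ , ne₁) , ne₂) , ((z‴ , ≢₁) , ≢₂) , ≢₃) =
      planes₄ b b′ b″ b‴ {π} ne ne₁ ne₂ ≢₁ ≢₂ ≢₃ n z z′ z″ z‴

    module M = Moments finiteℙ¹ {S = IsPlane} planes₀ {R = On} On? {T = λ _ → ⊤} (Finite.all finiteℙ¹) (λ _ _ → tt)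
      (λ {b} _ → planes₁ b) (λ {b} {b′} (_ , _ , ne) → planes₂ b b′ ne)
    module M₃ = M.Three
      (λ {b} {b′} {b″} (_ , (_ , ne) , (_ , ne₁) , ne₂) → planes₃ b b′ b″ ne ne₁ ne₂)
      (λ {π} {b} {t} → no-four {π} {b} {t})

  -- There are (q + 1)q(q - 1) ordered triples of points of the cubic, each spans one plane, and
  -- each such plane receives 6 of them. The other two types will number the same product divided by
  -- 3 and by 2.
  count-3C : ∃ λ a → HasCount (λ π → IsPlane π × Is3C π) a × 6 ℕ.* a ≡ suc q ℕ.* (q ℕ.* p)
  count-3C = let a , h , e = M₃.degree-3 in
    a , count-cong (λ (n , c) → n , count⇒dC c) (λ (n , c) → n , dC⇒count c) h ,
    trans e (trans (ℕₚ.*-identityʳ _) (cong (λ r → suc q ℕ.* (q ℕ.* r)) (cong (_∸ 1) q≡1+p)))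

  count-0C : ∃ λ a → HasCount (λ π → IsPlane π × Is0C π) a × 3 ℕ.* a ≡ suc q ℕ.* (q ℕ.* p)
  count-0C = let a , h , e = M₃.degree-0 in
    a , count-cong (λ (n , c) → n , count⇒dC c) (λ (n , c) → n , dC⇒count c) h ,
    simplify q≡1+p a e
    where
    simplify : ∀ {q} → q ≡ suc p → ∀ a →
      6 ℕ.* a ℕ.+ (6 ℕ.* (suc q ℕ.* (1 ℕ.+ q ℕ.+ q ℕ.* q)) ℕ.+ suc q ℕ.* (q ℕ.* (q ∸ 1)) ℕ.* 1) ≡
        (1 ℕ.+ q ℕ.+ q ℕ.* q ℕ.+ q ℕ.* (q ℕ.* q)) ℕ.* 6 ℕ.+ 3 ℕ.* (suc q ℕ.* q ℕ.* (1 ℕ.+ q)) →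
      3 ℕ.* a ≡ suc q ℕ.* (q ℕ.* p)
    simplify refl a e = ℕₚ.*-cancelˡ-≡ _ _ 2 (ℕₚ.+-cancelʳ-≡ (6 ℕ.* (suc (suc p) ℕ.* (1 ℕ.+ suc p ℕ.+ suc p ℕ.* suc p)) ℕ.+ suc
        (suc p) ℕ.* (suc p ℕ.* p) ℕ.* 1) _ _
      (trans (solveℕ 2 (λ a p → let q = conℕ 1 ⊹ p ; q+1 = conℕ 1 ⊹ q ; r = conℕ 6 ⊗ (q+1 ⊗ (conℕ 1 ⊹ q ⊹ q ⊗ q)) ⊹ q+1 ⊗ (q ⊗ p) ⊗ conℕ 1 in
          conℕ 2 ⊗ (conℕ 3 ⊗ a) ⊹ r :≡ conℕ 6 ⊗ a ⊹ r) refl a p)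
        (trans e (solveℕ 1 (λ p → let q = conℕ 1 ⊹ p ; q+1 = conℕ 1 ⊹ q in
          (conℕ 1 ⊹ q ⊹ q ⊗ q ⊹ q ⊗ (q ⊗ q)) ⊗ conℕ 6 ⊹ conℕ 3 ⊗ (q+1 ⊗ q ⊗ (conℕ 1 ⊹ q)) :≡
          conℕ 2 ⊗ (q+1 ⊗ (q ⊗ p)) ⊹ (conℕ 6 ⊗ (q+1 ⊗ (conℕ 1 ⊹ q ⊹ q ⊗ q)) ⊹ q+1 ⊗ (q ⊗ p) ⊗ conℕ 1))
          refl p))))

  -- In characteristic 3 the Γ-planes are the planes p₀ x₀ + p₃ x₃ = 0 through the axis x₀ = x₃ = 0.

  ThroughAxis : V4 → Set
  ThroughAxis (_ , p₁ , p₂ , _) = p₁ ≡ 0# × p₂ ≡ 0#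

  throughAxis? : Decidable ThroughAxis
  throughAxis? (_ , p₁ , p₂ , _) = (p₁ ≟ 0#) ×-dec (p₂ ≟ 0#)

  Γ⇒throughAxis : ∀ {π} → IsΓPlane π → ThroughAxis π
  Γ⇒throughAxis (inj₁ (c , _ , t , refl)) = lemma₁ , lemma₂
    where
    lemma₁ : c * - (3# * t) ≡ 0#
    lemma₁ = trans (cong (λ z → c * - (z * t)) 3≡0) (solve 2 (λ c t → c :* (:- (con 𝟘 :* t)) := con 𝟘) refl c t)
    lemma₂ : c * (3# * (t * t)) ≡ 0#
    lemma₂ = trans (cong (λ z → c * (z * (t * t))) 3≡0) (solve 2 (λ c t → c :* (con 𝟘 :* (t :* t)) := con 𝟘) refl c t)
  Γ⇒throughAxis (inj₂ (c , _ , refl)) = zeroʳ c , zeroʳ c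

  -- The normalised representatives of the planes p₀ x₀ + p₃ x₃ = 0, indexed by the ratio of p₀ to
  -- p₃.
  axisPlane : ℙ¹ → V4
  axisPlane nothing = 1# , 0# , 0# , 0#
  axisPlane (just a) = a , 0# , 0# , 1#

  axisPlane-isPlane : ∀ b → IsPlane (axisPlane b)
  axisPlane-isPlane nothing = inj₂ (inj₂ (inj₂ (refl , refl , refl , refl)))
  axisPlane-isPlane (just _) = inj₁ refl

  throughAxis⇒axisPlane : ∀ {π} → IsPlane π → ThroughAxis π → ∃ λ b → axisPlane b ≡ π
  throughAxis⇒axisPlane {a , _} (inj₁ refl) (refl , refl) = just a , refl
  throughAxis⇒axisPlane (inj₂ (inj₁ (refl , e))) (refl , e′) = contradiction (trans (sym e) e′) 1≢0
  throughAxis⇒axisPlane (inj₂ (inj₂ (inj₁ (refl , refl , e)))) (e′ , refl) = contradiction (trans (sym e) e′) 1≢0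
  throughAxis⇒axisPlane (inj₂ (inj₂ (inj₂ (refl , refl , refl , refl)))) (refl , refl) = nothing , refl

  axisPlane-Γ : ∀ b → IsΓPlane (axisPlane b)
  axisPlane-Γ nothing = inj₁ (1# , 1≢0 , 0# , vector-≡ (sym (*-identityˡ 1#))
    (trans (solve 0 (con 𝟘 := con 𝟙 :* (:- (con 𝟘 :* con 𝟘))) refl) (cong (λ z → 1# * - (z * 0#)) (sym 3≡0)))
    (trans (solve 0 (con 𝟘 := con 𝟙 :* (con 𝟘 :* (con 𝟘 :* con 𝟘))) refl) (cong (λ z → 1# * (z * (0# * 0#))) (sym 3≡0)))
    (solve 0 (con 𝟘 := con 𝟙 :* (:- (con 𝟘 :* con 𝟘 :* con 𝟘))) refl))
  axisPlane-Γ (just a) with a ≟ 0#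
  ... | yes refl = inj₂ (1# , 1≢0 , vector-≡ (sym (zeroʳ 1#)) (sym (zeroʳ 1#)) (sym (zeroʳ 1#)) (sym (*-identityˡ 1#)))
  -- The plane a x₀ + x₃ = 0 is a times the osculating plane at -s as soon as s³ = 1/a; such an s
  -- exists because cubing is surjective.
  ... | no a≢0 with s , s³≡1/a ← cube-root (inv a≢0) =
    inj₁ (a , a≢0 , - s , vector-≡ (sym (*-identityʳ a))
      (trans (solve 2 (λ a s → con 𝟘 := a :* (:- (con 𝟘 :* (:- s)))) refl a s) (cong (λ z → a * - (z * - s)) (sym 3≡0)))
      (trans (solve 2 (λ a s → con 𝟘 := a :* (con 𝟘 :* ((:- s) :* (:- s)))) refl a s)
        (cong (λ z → a * (z * (- s * - s))) (sym 3≡0)))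
      (trans (sym (inv-* a≢0)) (trans (cong (a *_) (sym s³≡1/a))
        (solve 2 (λ a s → a :* (s :* s :* s) := a :* (:- ((:- s) :* (:- s) :* (:- s)))) refl a s))))

  throughAxis⇒Γ : ∀ {π} → IsPlane π → ThroughAxis π → IsΓPlane π
  throughAxis⇒Γ n t = let b , e = throughAxis⇒axisPlane n t in subst IsΓPlane e (axisPlane-Γ b)

  count-Γ : HasCount (λ π → IsPlane π × IsΓPlane π) (suc q)
  count-Γ = count-image axisPlane (Finite.all finiteℙ¹)
    (λ { {nothing} {nothing} _ _ _ → refl
       ; {nothing} {just _} _ _ e → contradiction (cong (proj₂ ∘ proj₂ ∘ proj₂) e) 0≢1
       ; {just _} {nothing} _ _ e → contradiction (sym (cong (proj₂ ∘ proj₂ ∘ proj₂) e)) 0≢1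
       ; {just _} {just _} _ _ e → cong (just ∘ proj₁) e })
    (λ {b} _ → axisPlane-isPlane b , axisPlane-Γ b)
    (λ (n , g) → let b , e = throughAxis⇒axisPlane n (Γ⇒throughAxis g) in b , tt , e)

  -- On the cubic the plane becomes a X³ + Y³ = 0, or X³ = 0; since cubing is bijective there is
  -- exactly one solution on the projective line.
  axisPlane-meets : ∀ b → HasCount (On (axisPlane b)) 1
  axisPlane-meets nothing = count-one (just 0#)
    (solve 0 (con 𝟙 :* (con 𝟘 :* con 𝟘 :* con 𝟘) :+ con 𝟘 :* (con 𝟘 :* con 𝟘) :+ con 𝟘 :* con 𝟘 :+ con 𝟘 :* con 𝟙 := con 𝟘) refl)
    λ { {nothing} z → contradiction (trans
        (solve 0 (con 𝟙 := con 𝟙 :* con 𝟙 :+ con 𝟘 :* con 𝟘 :+ con 𝟘 :* con 𝟘 :+ con 𝟘 :* con 𝟘) refl) z) 1≢0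
      ; {just t} z → cong just (cube-injective (trans
          (solve 1 (λ t → t :* t :* t := con 𝟙 :* (t :* t :* t) :+ con 𝟘 :* (t :* t) :+ con 𝟘 :* t :+ con 𝟘 :* con 𝟙) refl t)
          (trans z (solve 0 (con 𝟘 := con 𝟘 :* con 𝟘 :* con 𝟘) refl)))) }
  axisPlane-meets (just a) with a ≟ 0#
  ... | yes refl = count-one nothing
    (solve 0 (con 𝟘 :* con 𝟙 :+ con 𝟘 :* con 𝟘 :+ con 𝟘 :* con 𝟘 :+ con 𝟙 :* con 𝟘 := con 𝟘) refl)
    λ { {nothing} z → refl
      ; {just t} z → contradiction (trans
          (solve 1 (λ t → con 𝟙 := con 𝟘 :* (t :* t :* t) :+ con 𝟘 :* (t :* t) :+ con 𝟘 :* t :+ con 𝟙 :* con 𝟙) refl t) z) 1≢0 }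
  ... | no a≢0 with s , s³≡1/a ← cube-root (inv a≢0) = count-one (just (- s))
    (combine ((- a) ⊛ s³≡1/a ⊞ (- 1#) ⊛ inv-* a≢0) (solve 3 (λ a s i →
      a :* ((:- s) :* (:- s) :* (:- s)) :+ con 𝟘 :* ((:- s) :* (:- s)) :+ con 𝟘 :* (:- s) :+ con 𝟙 :* con 𝟙 :=
      con 𝟘 :+ ((:- a) :* (s :* s :* s :- i) :+ (:- con 𝟙) :* (a :* i :- con 𝟙))) refl a s (inv a≢0)))
    λ { {nothing} z → contradiction (trans
        (solve 1 (λ a → a := a :* con 𝟙 :+ con 𝟘 :* con 𝟘 :+ con 𝟘 :* con 𝟘 :+ con 𝟙 :* con 𝟘) refl a) z) a≢0
      ; {just t} z → cong just (cube-injective (*-cancelˡ a≢0 (combine (1# ⊛ z ⊞ a ⊛ s³≡1/a ⊞ 1# ⊛ inv-* a≢0)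
          (solve 4 (λ a s i t → a :* (t :* t :* t) := a :* ((:- s) :* (:- s) :* (:- s)) :+
            (con 𝟙 :* (a :* (t :* t :* t) :+ con 𝟘 :* (t :* t) :+ con 𝟘 :* t :+ con 𝟙 :* con 𝟙 :- con 𝟘) :+
             (a :* (s :* s :* s :- i) :+ con 𝟙 :* (a :* i :- con 𝟙)))) refl a s (inv a≢0) t)))) }

  Γ-meets : ∀ {π} → IsPlane π → IsΓPlane π → HasCount (On π) 1
  Γ-meets n g = let b , e = throughAxis⇒axisPlane n (Γ⇒throughAxis g) in
    subst (λ π → HasCount (On π) 1) e (axisPlane-meets b)

  -- The moments count all planes with exactly one point of the cubic; these include all q + 1
  -- Γ-planes, which are split off.
  count-1C : ∃ λ a → HasCount (λ π → IsPlane π × Is1barC π) a × 2 ℕ.* a ≡ suc q ℕ.* (q ℕ.* p)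
  count-1C =
    let a , h , e = M₃.degree-1
        g , a′ , hg , ha , split = count-split h throughAxis?
        g≡1+q = count-unique (count-cong axial⇒ axial⇐ hg) count-Γ
    in a′ , count-cong other⇒ other⇐ ha ,
       simplify q≡1+p a′ (trans (cong (λ a → 2 ℕ.* a ℕ.+ 2 ℕ.* (suc q ℕ.* q ℕ.* (1 ℕ.+ q)))
                                      (trans (cong (ℕ._+ a′) (sym g≡1+q)) split)) e)
    where
    Single : V4 → Set
    Single π = IsPlane π × HasCount (On π) 1
    axial⇒ : ∀ {π} → Single π × ThroughAxis π → IsPlane π × IsΓPlane π
    axial⇒ ((n , _) , t) = n , throughAxis⇒Γ n t
    axial⇐ : ∀ {π} → IsPlane π × IsΓPlane π → Single π × ThroughAxis π
    axial⇐ (n , γ) = (n , Γ-meets n γ) , Γ⇒throughAxis γ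
    other⇒ : ∀ {π} → Single π × ¬ ThroughAxis π → IsPlane π × Is1barC π
    other⇒ {π} ((n , c) , ¬t) = n , (λ γ → ¬t (Γ⇒throughAxis γ)) , count⇒dC {π = π} c
    other⇐ : ∀ {π} → IsPlane π × Is1barC π → Single π × ¬ ThroughAxis π
    other⇐ {π} (n , ¬γ , c) = (n , dC⇒count {π = π} c) , λ t → ¬γ (throughAxis⇒Γ n t)
    simplify : ∀ {q} → q ≡ suc p → ∀ a →
      2 ℕ.* (suc q ℕ.+ a) ℕ.+ 2 ℕ.* (suc q ℕ.* q ℕ.* (1 ℕ.+ q)) ≡
        2 ℕ.* (suc q ℕ.* (1 ℕ.+ q ℕ.+ q ℕ.* q)) ℕ.+ suc q ℕ.* (q ℕ.* (q ∸ 1)) ℕ.* 1 →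
      2 ℕ.* a ≡ suc q ℕ.* (q ℕ.* p)
    simplify refl a e = ℕₚ.+-cancelʳ-≡ (2 ℕ.* suc (suc p) ℕ.+ 2 ℕ.* (suc (suc p) ℕ.* suc p ℕ.* (1 ℕ.+ suc p))) _ _
      (trans (solveℕ 2 (λ a p → let q = conℕ 1 ⊹ p ; q+1 = conℕ 1 ⊹ q in
          conℕ 2 ⊗ a ⊹ (conℕ 2 ⊗ q+1 ⊹ conℕ 2 ⊗ (q+1 ⊗ q ⊗ (conℕ 1 ⊹ q))) :≡
          conℕ 2 ⊗ (q+1 ⊹ a) ⊹ conℕ 2 ⊗ (q+1 ⊗ q ⊗ (conℕ 1 ⊹ q))) refl a p)
        (trans e (solveℕ 1 (λ p → let q = conℕ 1 ⊹ p ; q+1 = conℕ 1 ⊹ q in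
          conℕ 2 ⊗ (q+1 ⊗ (conℕ 1 ⊹ q ⊹ q ⊗ q)) ⊹ q+1 ⊗ (q ⊗ p) ⊗ conℕ 1 :≡
          q+1 ⊗ (q ⊗ p) ⊹ (conℕ 2 ⊗ q+1 ⊹ conℕ 2 ⊗ (q+1 ⊗ q ⊗ (conℕ 1 ⊹ q)))) refl p)))

-- Lines, spans and echelon forms

module LineGeometry (F : FiniteField) (3≡0 : Characteristic-3 F)
  (p : ℕ) (q≡1+p : FiniteField.q F ≡ suc p) (1≤p : 1 ℕ.≤ p) where
  open Geometry F
  open PlaneCounts F 3≡0 p q≡1+p 1≤p public

  -- Equality of spans

  left-∈ : ∀ u v → InSpan u v u
  left-∈ (a , b , c , d) (a′ , b′ , c′ , d′) = 1# , 0# , vector-≡ (lemma a a′) (lemma b b′) (lemma c c′) (lemma d d′)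
    where
    lemma : ∀ a b → a ≡ 1# * a + 0# * b
    lemma = solve 2 (λ a b → a := con 𝟙 :* a :+ con 𝟘 :* b) refl

  right-∈ : ∀ u v → InSpan u v v
  right-∈ (a , b , c , d) (a′ , b′ , c′ , d′) = 0# , 1# , vector-≡ (lemma a a′) (lemma b b′) (lemma c c′) (lemma d d′)
    where
    lemma : ∀ a b → b ≡ 0# * a + 1# * b
    lemma = solve 2 (λ a b → b := con 𝟘 :* a :+ con 𝟙 :* b) refl

  span-closed : ∀ {u v x y} → InSpan u v x → InSpan u v y → ∀ {z} → InSpan x y z → InSpan u v z
  span-closed {a , b , c , d} {a′ , b′ , c′ , d′} (k , l , refl) (m , n , refl) (s , t , refl) =
    s * k + t * m , s * l + t * n , vector-≡ (lemma a a′) (lemma b b′) (lemma c c′) (lemma d d′)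
    where
    lemma : ∀ a a′ → s * (k * a + l * a′) + t * (m * a + n * a′) ≡ (s * k + t * m) * a + (s * l + t * n) * a′
    lemma a a′ = solve 8 (λ s t k l m n a a′ →
      s :* (k :* a :+ l :* a′) :+ t :* (m :* a :+ n :* a′) := (s :* k :+ t :* m) :* a :+ (s :* l :+ t :* n) :* a′)
      refl s t k l m n a a′

  infix 4 _~_
  -- Equality of spans, tested on generators. It applies to arbitrary pairs of vectors, so lines can
  -- be handled through bases that are not reduced.
  _~_ : Line → Line → Set
  (u , v) ~ (u′ , v′) = (InSpan u v u′ × InSpan u v v′) × (InSpan u′ v′ u × InSpan u′ v′ v)

  ~-refl : ∀ {L} → L ~ L
  ~-refl {u , v} = (left-∈ u v , right-∈ u v) , (left-∈ u v , right-∈ u v)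

  ~-sym : ∀ {L L′} → L ~ L′ → L′ ~ L
  ~-sym (to , from) = from , to

  ~-trans : ∀ {L L′ L″} → L ~ L′ → L′ ~ L″ → L ~ L″
  ~-trans ((a , b) , (a′ , b′)) ((c , d) , (c′ , d′)) =
    (span-closed a b c , span-closed a b d) , (span-closed c′ d′ a′ , span-closed c′ d′ b′)

  ~-on : ∀ {L L′} → L ~ L′ → ∀ {x} → OnLine L x → OnLine L′ x
  ~-on (_ , (a , b)) = span-closed a b

  ~-swap : ∀ u v → (u , v) ~ (v , u)
  ~-swap u v = (right-∈ u v , left-∈ u v) , (right-∈ v u , left-∈ v u)

  ~-scaleˡ : ∀ {k} → k ≢ 0# → ∀ u v → (u , v) ~ (k • u , v)
  ~-scaleˡ {k} k≢0 u@(a , b , c , d) v@(a′ , b′ , c′ , d′) =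
    ((k , 0# , vector-≡ (lemma a a′) (lemma b b′) (lemma c c′) (lemma d d′)) , right-∈ u v) ,
    ((inv k≢0 , 0# , vector-≡ (lemma′ a a′) (lemma′ b b′) (lemma′ c c′) (lemma′ d d′)) , right-∈ (k • u) v)
    where
    lemma : ∀ a b → k * a ≡ k * a + 0# * b
    lemma = solve 3 (λ k a b → k :* a := k :* a :+ con 𝟘 :* b) refl k
    lemma′ : ∀ a b → a ≡ inv k≢0 * (k * a) + 0# * b
    lemma′ a b = combine ((- a) ⊛ inv-* k≢0)
      (solve 4 (λ k a b i → a := i :* (k :* a) :+ con 𝟘 :* b :+ (:- a) :* (k :* i :- con 𝟙)) refl k a b (inv k≢0))

  ~-addˡ : ∀ k u v → (u , v) ~ (u ⊕ (k • v) , v)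
  ~-addˡ k u@(a , b , c , d) v@(a′ , b′ , c′ , d′) =
    ((1# , k , vector-≡ (lemma a a′) (lemma b b′) (lemma c c′) (lemma d d′)) , right-∈ u v) ,
    ((1# , - k , vector-≡ (lemma′ a a′) (lemma′ b b′) (lemma′ c c′) (lemma′ d d′)) , right-∈ (u ⊕ (k • v)) v)
    where
    lemma : ∀ a b → a + k * b ≡ 1# * a + k * b
    lemma = solve 3 (λ k a b → a :+ k :* b := con 𝟙 :* a :+ k :* b) refl k
    lemma′ : ∀ a b → a ≡ 1# * (a + k * b) + - k * b
    lemma′ = solve 3 (λ k a b → a := con 𝟙 :* (a :+ k :* b) :+ :- k :* b) refl k

  ~-scaleʳ : ∀ {k} → k ≢ 0# → ∀ u v → (u , v) ~ (u , k • v)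
  ~-scaleʳ {k} k≢0 u v = ~-trans (~-swap u v) (~-trans (~-scaleˡ k≢0 v u) (~-swap (k • v) u))

  dot-span : ∀ {π u v x} → dot π u ≡ 0# → dot π v ≡ 0# → InSpan u v x → dot π x ≡ 0#
  dot-span {π} {u} {v} zu zv (k , l , refl) = begin
    dot π ((k • u) ⊕ (l • v))    ≡⟨ dot-comm π ((k • u) ⊕ (l • v)) ⟩
    dot ((k • u) ⊕ (l • v)) π    ≡⟨ dot-linear (k • u) l v π ⟩
    dot (k • u) π + l * dot v π  ≡⟨ cong₂ (λ x y → x + l * y) (dot-• k u π) (trans (dot-comm v π) zv) ⟩
    k * dot u π + l * 0#         ≡⟨ cong (λ x → k * x + l * 0#) (trans (dot-comm u π) zu) ⟩
    k * 0# + l * 0#              ≡⟨ cong₂ _+_ (zeroʳ k) (zeroʳ l) ⟩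
    0# + 0#                      ≡⟨ +-identityˡ 0# ⟩
    0#                           ∎
    where open ≡-Reasoning

  ~-inPlane : ∀ {L L′ π} → L ~ L′ → LineInPlane L π → LineInPlane L′ π
  ~-inPlane {π = π} ((a , b) , _) (z , z′) = dot-span {π} z z′ a , dot-span {π} z z′ b

  -- Uniqueness of the reduced echelon form

  private
    at : V4 → Fin 4 → Carrier
    at (a , _) zero = a
    at (_ , b , _) (suc zero) = b
    at (_ , _ , c , _) (suc (suc zero)) = c
    at (_ , _ , _ , d) (suc (suc (suc zero))) = d

    at-comb : ∀ k u l v i → at ((k • u) ⊕ (l • v)) i ≡ k * at u i + l * at v i
    at-comb k u l v zero = refl
    at-comb k u l v (suc zero) = refl
    at-comb k u l v (suc (suc zero)) = refl
    at-comb k u l v (suc (suc (suc zero))) = refl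

    -- One description of the six pivot patterns, with pivot columns i and j. The entries of a
    -- vector of the span in these columns are its coefficients, which is the content of
    -- `coordinates`.
    record Echelon (r₁ r₂ : V4) : Set where
      field
        i j : Fin 4
        i<j : i < j
        r₁i : at r₁ i ≡ 1#
        r₁j : at r₁ j ≡ 0#
        r₂i : at r₂ i ≡ 0#
        r₂j : at r₂ j ≡ 1#
        before₁ : ∀ {k} → k < i → at r₁ k ≡ 0#
        before₂ : ∀ {k} → k < j → at r₂ k ≡ 0#

      coordinates : ∀ {x} → InSpan r₁ r₂ x → x ≡ (at x i • r₁) ⊕ (at x j • r₂)
      coordinates (k , l , refl) = cong₂ (λ k l → (k • r₁) ⊕ (l • r₂)) (sym x-i) (sym x-j)
        where
        x-i : at ((k • r₁) ⊕ (l • r₂)) i ≡ k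
        x-i = trans (at-comb k r₁ l r₂ i) (trans (cong₂ (λ a b → k * a + l * b) r₁i r₂i)
          (solve 2 (λ k l → k :* con 𝟙 :+ l :* con 𝟘 := k) refl k l))
        x-j : at ((k • r₁) ⊕ (l • r₂)) j ≡ l
        x-j = trans (at-comb k r₁ l r₂ j) (trans (cong₂ (λ a b → k * a + l * b) r₁j r₂j)
          (solve 2 (λ k l → k :* con 𝟘 :+ l :* con 𝟙 := l) refl k l))

      vanish-before-i : ∀ {x k} → InSpan r₁ r₂ x → k < i → at x k ≡ 0#
      vanish-before-i {k = k} (s , t , refl) k<i = trans (at-comb s r₁ t r₂ k)
        (trans (cong₂ (λ a b → s * a + t * b) (before₁ k<i) (before₂ (Finₚ.<-trans k<i i<j)))
          (solve 2 (λ k l → k :* con 𝟘 :+ l :* con 𝟘 := con 𝟘) refl s t))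

      vanish-before-j : ∀ {x k} → InSpan r₁ r₂ x → at x i ≡ 0# → k < j → at x k ≡ 0#
      vanish-before-j {x} {k} x∈ xi≡0 k<j = trans (cong (λ y → at y k) (coordinates x∈))
        (trans (at-comb (at x i) r₁ (at x j) r₂ k) (trans (cong₂ (λ a b → a * at r₁ k + at x j * b) xi≡0 (before₂ k<j))
          (solve 2 (λ k l → con 𝟘 :* k :+ l :* con 𝟘 := con 𝟘) refl (at r₁ k) (at x j))))

    echelon : ∀ {r₁ r₂} → IsLine (r₁ , r₂) → Echelon r₁ r₂
    echelon (inj₁ (a , b , c , d , refl , refl)) = record
      { i = zero ; j = suc zero ; i<j = ℕ.s≤s ℕ.z≤n ; r₁i = refl ; r₁j = refl ; r₂i = refl ; r₂j = refl
      ; before₁ = λ () ; before₂ = λ { {zero} _ → refl ; {suc _} (ℕ.s≤s ()) } }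
    echelon (inj₂ (inj₁ (a , b , c , refl , refl))) = record
      { i = zero ; j = suc (suc zero) ; i<j = ℕ.s≤s ℕ.z≤n ; r₁i = refl ; r₁j = refl ; r₂i = refl ; r₂j = refl
      ; before₁ = λ ()
      ; before₂ = λ { {zero} _ → refl ; {suc zero} _ → refl ; {suc (suc _)} (ℕ.s≤s (ℕ.s≤s ())) } }
    echelon (inj₂ (inj₂ (inj₁ (a , b , refl , refl)))) = record
      { i = zero ; j = suc (suc (suc zero)) ; i<j = ℕ.s≤s ℕ.z≤n ; r₁i = refl ; r₁j = refl ; r₂i = refl ; r₂j = refl
      ; before₁ = λ ()
      ; before₂ = λ { {zero} _ → refl ; {suc zero} _ → refl ; {suc (suc zero)} _ → refl
                    ; {suc (suc (suc _))} (ℕ.s≤s (ℕ.s≤s (ℕ.s≤s ()))) } }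
    echelon (inj₂ (inj₂ (inj₂ (inj₁ (a , b , refl , refl))))) = record
      { i = suc zero ; j = suc (suc zero) ; i<j = ℕ.s≤s (ℕ.s≤s ℕ.z≤n) ; r₁i = refl ; r₁j = refl ; r₂i = refl ; r₂j = refl
      ; before₁ = λ { {zero} _ → refl ; {suc _} (ℕ.s≤s ()) }
      ; before₂ = λ { {zero} _ → refl ; {suc zero} _ → refl ; {suc (suc _)} (ℕ.s≤s (ℕ.s≤s ())) } }
    echelon (inj₂ (inj₂ (inj₂ (inj₂ (inj₁ (a , refl , refl)))))) = record
      { i = suc zero ; j = suc (suc (suc zero)) ; i<j = ℕ.s≤s (ℕ.s≤s ℕ.z≤n)
      ; r₁i = refl ; r₁j = refl ; r₂i = refl ; r₂j = refl
      ; before₁ = λ { {zero} _ → refl ; {suc _} (ℕ.s≤s ()) }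
      ; before₂ = λ { {zero} _ → refl ; {suc zero} _ → refl ; {suc (suc zero)} _ → refl
                    ; {suc (suc (suc _))} (ℕ.s≤s (ℕ.s≤s (ℕ.s≤s ()))) } }
    echelon (inj₂ (inj₂ (inj₂ (inj₂ (inj₂ (refl , refl)))))) = record
      { i = suc (suc zero) ; j = suc (suc (suc zero)) ; i<j = ℕ.s≤s (ℕ.s≤s (ℕ.s≤s ℕ.z≤n))
      ; r₁i = refl ; r₁j = refl ; r₂i = refl ; r₂j = refl
      ; before₁ = λ { {zero} _ → refl ; {suc zero} _ → refl ; {suc (suc _)} (ℕ.s≤s (ℕ.s≤s ())) }
      ; before₂ = λ { {zero} _ → refl ; {suc zero} _ → refl ; {suc (suc zero)} _ → refl
                    ; {suc (suc (suc _))} (ℕ.s≤s (ℕ.s≤s (ℕ.s≤s ()))) } }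

  -- The pivots depend only on the span: i is the first position at which some vector of it is
  -- nonzero, and j the first such position among its vectors that vanish at i. With equal pivots,
  -- reading off coefficients identifies the rows.
  line-≡ : ∀ {L L′} → IsLine L → IsLine L′ → L ~ L′ → L ≡ L′
  line-≡ {r₁ , r₂} {r₁′ , r₂′} l l′ ((r₁′∈ , r₂′∈) , (r₁∈ , r₂∈)) = cong₂ _,_
    (trans (E′.coordinates r₁∈) (trans (cong₂ (λ a b → (a • r₁′) ⊕ (b • r₂′))
      (trans (cong (at r₁) (sym i≡i′)) E.r₁i) (trans (cong (at r₁) (sym j≡j′)) E.r₁j))
      (1•⊕0• r₁′ r₂′)))
    (trans (E′.coordinates r₂∈) (trans (cong₂ (λ a b → (a • r₁′) ⊕ (b • r₂′))
      (trans (cong (at r₂) (sym i≡i′)) E.r₂i) (trans (cong (at r₂) (sym j≡j′)) E.r₂j))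
      (0•⊕1• r₁′ r₂′)))
    where
    module E = Echelon (echelon l)
    module E′ = Echelon (echelon l′)
    1•⊕0• : ∀ u v → (1# • u) ⊕ (0# • v) ≡ u
    1•⊕0• u v = sym (proj₂ (proj₂ (left-∈ u v)))
    0•⊕1• : ∀ u v → (0# • u) ⊕ (1# • v) ≡ v
    0•⊕1• u v = sym (proj₂ (proj₂ (right-∈ u v)))
    i≡i′ : E.i ≡ E′.i
    i≡i′ with Finₚ.<-cmp E.i E′.i
    ... | tri< i<i′ _ _ = contradiction (trans (sym (E′.vanish-before-i r₁∈ i<i′)) E.r₁i) 0≢1
    ... | tri≈ _ e _ = e
    ... | tri> _ _ i′<i = contradiction (trans (sym (E.vanish-before-i r₁′∈ i′<i)) E′.r₁i) 0≢1
    j≡j′ : E.j ≡ E′.j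
    j≡j′ with Finₚ.<-cmp E.j E′.j
    ... | tri< j<j′ _ _ = contradiction
      (trans (sym (E′.vanish-before-j r₂∈ (trans (cong (at r₂) (sym i≡i′)) E.r₂i) j<j′)) E.r₂j) 0≢1
    ... | tri≈ _ e _ = e
    ... | tri> _ _ j′<j = contradiction
      (trans (sym (E.vanish-before-j r₂′∈ (trans (cong (at r₂′) i≡i′) E′.r₂i) j′<j)) E′.r₂j) 0≢1

  -- Row reduction of a basis (1 , a , b , c), (0 , x , y , z)

  private
    *inv : ∀ {x} (x≢0 : x ≢ 0#) → inv x≢0 * x ≡ 1#
    *inv x≢0 = trans (*-comm _ _) (inv-* x≢0)

    a-a*1 : ∀ a i x → i * x ≡ 1# → a + - a * (i * x) ≡ 0#
    a-a*1 a i x e = trans (cong (λ z → a + - a * z) e) (solve 1 (λ a → a :+ :- a :* con 𝟙 := con 𝟘) refl a)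

    a-b*0 : ∀ a b i → a + b * (i * 0#) ≡ a
    a-b*0 = solve 3 (λ a b i → a :+ b :* (i :* con 𝟘) := a) refl

  reduce : ∀ a b c x y z → (x , y , z) ≢ (0# , 0# , 0#) →
    ∃ λ L → IsLine L × L ~ ((1# , a , b , c) , (0# , x , y , z))
  reduce a b c x y z ≢0 with x ≟ 0#
  ... | no x≢0 = let i = inv x≢0 ; u = 1# , a , b , c ; v = 0# , x , y , z ; v′ = i • v in
    _ , inj₁ (_ , _ , _ , _ , vector-≡ (a-b*0 1# (- a) i) (a-a*1 a i x (*inv x≢0)) refl refl ,
                              vector-≡ (zeroʳ i) (*inv x≢0) refl refl) ,
    ~-sym (~-trans (~-scaleʳ (inv-≢0 x≢0) u v) (~-addˡ (- a) u v′))
  ... | yes refl with y ≟ 0#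
  ...   | no y≢0 = let i = inv y≢0 ; u = 1# , a , b , c ; v = 0# , 0# , y , z ; v′ = i • v in
    _ , inj₂ (inj₁ (_ , _ , _ , vector-≡ (a-b*0 1# (- b) i) refl (a-a*1 b i y (*inv y≢0)) refl ,
                                vector-≡ (zeroʳ i) (zeroʳ i) (*inv y≢0) refl)) ,
    ~-sym (~-trans (~-scaleʳ (inv-≢0 y≢0) u v) (~-addˡ (- b) u v′))
  ...   | yes refl with z ≟ 0#
  ...     | no z≢0 = let i = inv z≢0 ; u = 1# , a , b , c ; v = 0# , 0# , 0# , z ; v′ = i • v in
    _ , inj₂ (inj₂ (inj₁ (_ , _ , vector-≡ (a-b*0 1# (- c) i) refl refl (a-a*1 c i z (*inv z≢0)) ,
                                  vector-≡ (zeroʳ i) (zeroʳ i) (zeroʳ i) (*inv z≢0)))) ,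
    ~-sym (~-trans (~-scaleʳ (inv-≢0 z≢0) u v) (~-addˡ (- c) u v′))
  ...     | yes refl = contradiction refl ≢0

  -- Lines skew to the axis

  -- A line skew to the axis x₀ = x₃ = 0 projects bijectively to (x₀ , x₃), hence is the graph of a
  -- linear map to (x₁ , x₂); the four entries are the matrix of this map, and `OnSkew` is the
  -- equation of the graph.
  skewBasis : V4 → Line
  skewBasis (a , b , c , d) = (1# , a , b , 0#) , (0# , c , d , 1#)

  private
    reduced : ∀ M → ∃ λ L → IsLine L × L ~ skewBasis M
    reduced (a , b , c , d) = reduce a b 0# c d 1# λ e → 1≢0 (cong (proj₂ ∘ proj₂) e)

  skewLine : V4 → Line
  skewLine M = proj₁ (reduced M)

  skewLine-isLine : ∀ M → IsLine (skewLine M)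
  skewLine-isLine M = proj₁ (proj₂ (reduced M))

  skewLine-~ : ∀ M → skewLine M ~ skewBasis M
  skewLine-~ M = proj₂ (proj₂ (reduced M))

  OnSkew : V4 → V4 → Set
  OnSkew (a , b , c , d) (x₀ , x₁ , x₂ , x₃) = x₁ ≡ x₀ * a + x₃ * c × x₂ ≡ x₀ * b + x₃ * d

  span⇒OnSkew : ∀ M {x} → OnLine (skewBasis M) x → OnSkew M x
  span⇒OnSkew (a , b , c , d) (k , l , refl) = lemma a c , lemma b d
    where
    lemma : ∀ a c → k * a + l * c ≡ (k * 1# + l * 0#) * a + (k * 0# + l * 1#) * c
    lemma = solve 4 (λ k l a c → k :* a :+ l :* c :=
      (k :* con 𝟙 :+ l :* con 𝟘) :* a :+ (k :* con 𝟘 :+ l :* con 𝟙) :* c) refl k l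

  OnSkew⇒span : ∀ M {x} → OnSkew M x → OnLine (skewBasis M) x
  OnSkew⇒span (a , b , c , d) {x₀ , x₁ , x₂ , x₃} (e₁ , e₂) = x₀ , x₃ , vector-≡
    (solve 2 (λ x y → x := x :* con 𝟙 :+ y :* con 𝟘) refl x₀ x₃) e₁ e₂
    (solve 2 (λ x y → y := x :* con 𝟘 :+ y :* con 𝟙) refl x₀ x₃)

  skewBasis-injective : ∀ M M′ → skewBasis M ~ skewBasis M′ → M ≡ M′
  skewBasis-injective M@(a , b , c , d) M′@(a′ , b′ , c′ , d′) (_ , (u∈ , v∈)) =
    let ea , eb = span⇒OnSkew M′ u∈ ; ec , ed = span⇒OnSkew M′ v∈ in
    vector-≡ (trans ea (first a′ c′)) (trans eb (first b′ d′)) (trans ec (second a′ c′)) (trans ed (second b′ d′))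
    where
    first : ∀ a c → 1# * a + 0# * c ≡ a
    first = solve 2 (λ a c → con 𝟙 :* a :+ con 𝟘 :* c := a) refl
    second : ∀ a c → 0# * a + 1# * c ≡ c
    second = solve 2 (λ a c → con 𝟘 :* a :+ con 𝟙 :* c := c) refl

  ≡⇒~ : ∀ {L L′} → L ≡ L′ → L ~ L′
  ≡⇒~ refl = ~-refl

  skewLine-injective : ∀ M M′ → skewLine M ≡ skewLine M′ → M ≡ M′
  skewLine-injective M M′ e = skewBasis-injective M M′
    (~-trans (~-sym (skewLine-~ M)) (~-trans (≡⇒~ e) (skewLine-~ M′)))

  SkewIn : V4 → V4 → Set
  SkewIn π M = LineInPlane (skewBasis M) π

  OnSkew-inPlane : ∀ {π} M {x} → SkewIn π M → OnSkew M x → InPlane π x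
  OnSkew-inPlane {π} M (z , z′) o = dot-span {π} z z′ (OnSkew⇒span M o)

  MissesΓ : Line → Set
  MissesΓ L = ∀ π → IsPlane π → IsΓPlane π → ¬ LineInPlane L π

  skewLine-missesΓ : ∀ M → MissesΓ (skewLine M)
  skewLine-missesΓ M@(a , b , c , d) π@(p₀ , p₁ , p₂ , p₃) n γ l =
    let z , z′ = ~-inPlane {π = π} (skewLine-~ M) l
        e₁ , e₂ = Γ⇒throughAxis γ
    in normalized-≢0 n (vector-≡
      (combine (1# ⊛ z ⊞ (- a) ⊛ e₁ ⊞ (- b) ⊛ e₂) (solve 6 (λ p₀ p₁ p₂ p₃ a b → p₀ := con 𝟘 :+
        (con 𝟙 :* (p₀ :* con 𝟙 :+ p₁ :* a :+ p₂ :* b :+ p₃ :* con 𝟘 :- con 𝟘) :+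
        ((:- a) :* (p₁ :- con 𝟘) :+ (:- b) :* (p₂ :- con 𝟘)))) refl p₀ p₁ p₂ p₃ a b))
      e₁ e₂
      (combine (1# ⊛ z′ ⊞ (- c) ⊛ e₁ ⊞ (- d) ⊛ e₂) (solve 6 (λ p₀ p₁ p₂ p₃ a b → p₃ := con 𝟘 :+
        (con 𝟙 :* (p₀ :* con 𝟘 :+ p₁ :* a :+ p₂ :* b :+ p₃ :* con 𝟙 :- con 𝟘) :+
        ((:- a) :* (p₁ :- con 𝟘) :+ (:- b) :* (p₂ :- con 𝟘)))) refl p₀ p₁ p₂ p₃ c d)))

  in-Γ : ∀ L p₀ p₃ → (p₀ , p₃) ≢ (0# , 0#) → LineInPlane L (p₀ , 0# , 0# , p₃) →
    ∃ λ π → IsPlane π × IsΓPlane π × LineInPlane L π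
  in-Γ (r₁ , r₂) p₀ p₃ ≢0 (z , z′) =
    let k , π , k≢0 , n , e = normalize (p₀ , 0# , 0# , p₃) (λ e → ≢0 (cong₂ _,_ (cong proj₁ e) (cong (proj₂ ∘ proj₂ ∘ proj₂) e)))
        cancel : ∀ x → dot (p₀ , 0# , 0# , p₃) x ≡ 0# → dot π x ≡ 0#
        cancel x z = no-zero-divisors (trans (sym (dot-• k π x)) (trans (cong (λ w → dot w x) e) z)) k≢0
    in π , n , throughAxis⇒Γ n
         (no-zero-divisors (cong (proj₁ ∘ proj₂) e) k≢0 , no-zero-divisors (cong (proj₁ ∘ proj₂ ∘ proj₂) e) k≢0) ,
       cancel r₁ z , cancel r₂ z′

  -- The criterion is the minor in columns 0 and 3 of the given basis. If it is nonzero, Cramer's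
  -- rule gives the matrix; if it is zero, the line lies in a plane through the axis.
  missesΓ⇒skew : ∀ {L} → IsLine L → MissesΓ L → ∃ λ M → skewLine M ≡ L
  missesΓ⇒skew {L@((x₀ , x₁ , x₂ , x₃) , (y₀ , y₁ , y₂ , y₃))} isLine misses with (x₀ * y₃ - x₃ * y₀) ≟ 0#
  ... | no δ≢0 = M , line-≡ (skewLine-isLine M) isLine (~-trans (skewLine-~ M) basis)
    where
    i = inv δ≢0
    δi≡1 = inv-* δ≢0
    M : V4
    M = i * (y₃ * x₁ - x₃ * y₁) , i * (y₃ * x₂ - x₃ * y₂) , i * (x₀ * y₁ - y₀ * x₁) , i * (x₀ * y₂ - y₀ * x₂)
    basis : skewBasis M ~ L
    basis = (OnSkew⇒span M (first x₁ y₁ , first x₂ y₂) , OnSkew⇒span M (second x₁ y₁ , second x₂ y₂)) ,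
      (i * y₃ , - (i * x₃) , vector-≡
        (combine ((- 1#) ⊛ δi≡1) (solve 5 (λ x₀ x₃ y₀ y₃ i → con 𝟙 := i :* y₃ :* x₀ :+ (:- (i :* x₃)) :* y₀ :+ (:- con 𝟙) :*
            ((x₀ :* y₃ :- x₃ :* y₀) :* i :- con 𝟙)) refl x₀ x₃ y₀ y₃ i))
        (solve 5 (λ x₁ x₃ y₁ y₃ i → i :* (y₃ :* x₁ :- x₃ :* y₁) := i :* y₃ :* x₁ :+ (:- (i :* x₃)) :* y₁) refl x₁ x₃ y₁ y₃ i)
        (solve 5 (λ x₁ x₃ y₁ y₃ i → i :* (y₃ :* x₁ :- x₃ :* y₁) := i :* y₃ :* x₁ :+ (:- (i :* x₃)) :* y₁) refl x₂ x₃ y₂ y₃ i)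
        (solve 3 (λ x₃ y₃ i → con 𝟘 := i :* y₃ :* x₃ :+ (:- (i :* x₃)) :* y₃) refl x₃ y₃ i)) ,
      (- (i * y₀) , i * x₀ , vector-≡
        (solve 3 (λ x₀ y₀ i → con 𝟘 := (:- (i :* y₀)) :* x₀ :+ i :* x₀ :* y₀) refl x₀ y₀ i)
        (solve 5 (λ x₁ x₀ y₁ y₀ i → i :* (x₀ :* y₁ :- y₀ :* x₁) := (:- (i :* y₀)) :* x₁ :+ i :* x₀ :* y₁) refl x₁ x₀ y₁ y₀ i)
        (solve 5 (λ x₁ x₀ y₁ y₀ i → i :* (x₀ :* y₁ :- y₀ :* x₁) := (:- (i :* y₀)) :* x₁ :+ i :* x₀ :* y₁) refl x₂ x₀ y₂ y₀ i)
        (combine ((- 1#) ⊛ δi≡1) (solve 5 (λ x₀ x₃ y₀ y₃ i → con 𝟙 := (:- (i :* y₀)) :* x₃ :+ i :* x₀ :* y₃ :+ (:- con 𝟙) :*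
            ((x₀ :* y₃ :- x₃ :* y₀) :* i :- con 𝟙)) refl x₀ x₃ y₀ y₃ i)))
      where
      first : ∀ x₁ y₁ → x₁ ≡ x₀ * (i * (y₃ * x₁ - x₃ * y₁)) + x₃ * (i * (x₀ * y₁ - y₀ * x₁))
      first x₁ y₁ = combine ((- x₁) ⊛ δi≡1) (solve 7 (λ x₀ x₁ x₃ y₀ y₁ y₃ i →
        x₁ := x₀ :* (i :* (y₃ :* x₁ :- x₃ :* y₁)) :+ x₃ :* (i :* (x₀ :* y₁ :- y₀ :* x₁))
              :+ (:- x₁) :* ((x₀ :* y₃ :- x₃ :* y₀) :* i :- con 𝟙)) refl x₀ x₁ x₃ y₀ y₁ y₃ i)
      second : ∀ x₁ y₁ → y₁ ≡ y₀ * (i * (y₃ * x₁ - x₃ * y₁)) + y₃ * (i * (x₀ * y₁ - y₀ * x₁))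
      second x₁ y₁ = combine ((- y₁) ⊛ δi≡1) (solve 7 (λ x₀ x₁ x₃ y₀ y₁ y₃ i →
        y₁ := y₀ :* (i :* (y₃ :* x₁ :- x₃ :* y₁)) :+ y₃ :* (i :* (x₀ :* y₁ :- y₀ :* x₁))
              :+ (:- y₁) :* ((x₀ :* y₃ :- x₃ :* y₀) :* i :- con 𝟙)) refl x₀ x₁ x₃ y₀ y₁ y₃ i)
  ... | yes δ≡0 = ⊥-elim contained
    where
    refute : ∀ p₀ p₃ → (p₀ , p₃) ≢ (0# , 0#) → LineInPlane L (p₀ , 0# , 0# , p₃) → ⊥
    refute p₀ p₃ ≢0 l = let π , n , γ , inπ = in-Γ L p₀ p₃ ≢0 l in misses π n γ inπ
    self : ∀ x₀ x₁ x₂ x₃ → dot (x₃ , 0# , 0# , - x₀) (x₀ , x₁ , x₂ , x₃) ≡ 0#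
    self = solve 4 (λ x₀ x₁ x₂ x₃ → x₃ :* x₀ :+ con 𝟘 :* x₁ :+ con 𝟘 :* x₂ :+ (:- x₀) :* x₃ := con 𝟘) refl
    neg-≢0 : ∀ {x y} → (x , y) ≢ (0# , 0#) → (y , - x) ≢ (0# , 0#)
    neg-≢0 {x} {y} ≢0 e = ≢0 (cong₂ _,_ (combine ((- 1#) ⊛ cong proj₂ e)
      (solve 1 (λ x → x := con 𝟘 :+ (:- con 𝟙) :* (:- x :- con 𝟘)) refl x)) (cong proj₁ e))
    pair-≡ : ∀ {x y} → x ≡ 0# → y ≡ 0# → (x , y) ≡ (0# , 0#)
    pair-≡ refl refl = refl
    -- The plane x₃ X₀ - x₀ X₃ = 0 through the axis contains the first row, and by the vanishing
    -- minor also the second. If the first row lies on the axis, the second row defines the plane;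
    -- if both do, any plane through the axis will do.
    contained : ⊥
    contained with Finite._≟_ (finite-× finite finite) (x₀ , x₃) (0# , 0#)
    ... | no ≢0 = refute x₃ (- x₀) (neg-≢0 ≢0) (self x₀ x₁ x₂ x₃ ,
      combine ((- 1#) ⊛ δ≡0) (solve 6 (λ x₀ x₃ y₀ y₁ y₂ y₃ →
        x₃ :* y₀ :+ con 𝟘 :* y₁ :+ con 𝟘 :* y₂ :+ (:- x₀) :* y₃ := con 𝟘 :+ (:- con 𝟙) :* (x₀ :* y₃ :- x₃ :* y₀ :- con 𝟘))
        refl x₀ x₃ y₀ y₁ y₂ y₃))
    ... | yes refl with Finite._≟_ (finite-× finite finite) (y₀ , y₃) (0# , 0#)
    ...   | no ≢0 = refute y₃ (- y₀) (neg-≢0 ≢0) (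
      solve 4 (λ x₁ x₂ y₀ y₃ → y₃ :* con 𝟘 :+ con 𝟘 :* x₁ :+ con 𝟘 :* x₂ :+ (:- y₀) :* con 𝟘 := con 𝟘) refl x₁ x₂ y₀ y₃ ,
      self y₀ y₁ y₂ y₃)
    ...   | yes refl = refute 1# 0# (λ e → 1≢0 (cong proj₁ e)) (axial x₁ x₂ , axial y₁ y₂)
      where
      axial : ∀ x y → dot (1# , 0# , 0# , 0#) (0# , x , y , 0#) ≡ 0#
      axial = solve 2 (λ x y → con 𝟙 :* con 𝟘 :+ con 𝟘 :* x :+ con 𝟘 :* y :+ con 𝟘 :* con 𝟘 := con 𝟘) refl

-- Lines skew to the axis and the points of the cubic on them

module SkewLines (F : FiniteField) (3≡0 : Characteristic-3 F)
  (p : ℕ) (q≡1+p : FiniteField.q F ≡ suc p) (1≤p : 1 ℕ.≤ p) where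
  open Geometry F
  open LineGeometry F 3≡0 p q≡1+p 1≤p public

  affine-line : ∀ α β γ → (α ≢ 0# ⊎ β ≢ 0#) → HasCount (λ ((x , y) : Carrier × Carrier) → α * x + β * y ≡ γ) q
  affine-line α β γ (inj₂ β≢0) = count-image (λ x → x , inv β≢0 * (γ - α * x)) (Finite.all finite)
    (λ _ _ e → cong proj₁ e)
    (λ {x} _ → combine ((γ - α * x) ⊛ inv-* β≢0) (solve 5 (λ α β γ i x →
      α :* x :+ β :* (i :* (γ :- α :* x)) := γ :+ (γ :- α :* x) :* (β :* i :- con 𝟙)) refl α β γ (inv β≢0) x))
    (λ {(x , y)} e → x , tt , cong (x ,_) (combine ((- inv β≢0) ⊛ e ⊞ y ⊛ inv-* β≢0) (solve 6 (λ α β γ i x y →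
      i :* (γ :- α :* x) := y :+ ((:- i) :* (α :* x :+ β :* y :- γ) :+ y :* (β :* i :- con 𝟙))) refl α β γ (inv β≢0) x y)))
  affine-line α β γ (inj₁ α≢0) = count-image (λ y → inv α≢0 * (γ - β * y) , y) (Finite.all finite)
    (λ _ _ e → cong proj₂ e)
    (λ {y} _ → combine ((γ - β * y) ⊛ inv-* α≢0) (solve 5 (λ α β γ i y →
      α :* (i :* (γ :- β :* y)) :+ β :* y := γ :+ (γ :- β :* y) :* (α :* i :- con 𝟙)) refl α β γ (inv α≢0) y))
    (λ {(x , y)} e → y , tt , cong (_, y) (combine ((- inv α≢0) ⊛ e ⊞ x ⊛ inv-* α≢0) (solve 6 (λ α β γ i x y →
      i :* (γ :- β :* y) := x :+ ((:- i) :* (α :* x :+ β :* y :- γ) :+ x :* (α :* i :- con 𝟙))) refl α β γ (inv α≢0) x y)))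

  cramer-zero : ∀ {α β α′ β′ x y} → α * β′ - β * α′ ≢ 0# →
    α * x + β * y ≡ 0# → α′ * x + β′ * y ≡ 0# → x ≡ 0# × y ≡ 0#
  cramer-zero {α} {β} {α′} {β′} {x} {y} Δ≢0 e e′ =
    no-zero-divisors (combine (β′ ⊛ e ⊞ (- β) ⊛ e′) (solve 6 (λ α β α′ β′ x y → (α :* β′ :- β :* α′) :* x := con 𝟘 :+
      (β′ :* (α :* x :+ β :* y :- con 𝟘) :+ (:- β) :* (α′ :* x :+ β′ :* y :- con 𝟘))) refl α β α′ β′ x y)) Δ≢0 ,
    no-zero-divisors (combine ((- α′) ⊛ e ⊞ α ⊛ e′) (solve 6 (λ α β α′ β′ x y → (α :* β′ :- β :* α′) :* y := con 𝟘 :+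
      ((:- α′) :* (α :* x :+ β :* y :- con 𝟘) :+ α :* (α′ :* x :+ β′ :* y :- con 𝟘))) refl α β α′ β′ x y)) Δ≢0

  cramer : ∀ α β γ α′ β′ γ′ → α * β′ - β * α′ ≢ 0# →
    HasCount (λ ((x , y) : Carrier × Carrier) → (α * x + β * y ≡ γ) × (α′ * x + β′ * y ≡ γ′)) 1
  cramer α β γ α′ β′ γ′ Δ≢0 = count-one (solution (inv Δ≢0)) (solves (inv Δ≢0) (inv-* Δ≢0)) λ {v} e →
    unique v (solution (inv Δ≢0)) e (solves (inv Δ≢0) (inv-* Δ≢0))
    where
    Solves : Carrier × Carrier → Set
    Solves (x , y) = (α * x + β * y ≡ γ) × (α′ * x + β′ * y ≡ γ′)
    solution : Carrier → Carrier × Carrier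
    solution i = i * (γ * β′ - β * γ′) , i * (α * γ′ - γ * α′)
    solves : ∀ i → (α * β′ - β * α′) * i ≡ 1# → Solves (solution i)
    solves i e =
      combine (γ ⊛ e) (solve 7 (λ α β γ α′ β′ γ′ i →
        α :* (i :* (γ :* β′ :- β :* γ′)) :+ β :* (i :* (α :* γ′ :- γ :* α′)) :=
        γ :+ γ :* ((α :* β′ :- β :* α′) :* i :- con 𝟙)) refl α β γ α′ β′ γ′ i) ,
      combine (γ′ ⊛ e) (solve 7 (λ α β γ α′ β′ γ′ i →
        α′ :* (i :* (γ :* β′ :- β :* γ′)) :+ β′ :* (i :* (α :* γ′ :- γ :* α′)) :=
        γ′ :+ γ′ :* ((α :* β′ :- β :* α′) :* i :- con 𝟙)) refl α β γ α′ β′ γ′ i)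
    difference : ∀ α β γ x y x′ y′ → α * x + β * y ≡ γ → α * x′ + β * y′ ≡ γ → α * (x - x′) + β * (y - y′) ≡ 0#
    difference α β γ x y x′ y′ e e′ = combine (1# ⊛ e ⊞ (- 1#) ⊛ e′) (solve 7 (λ α β γ x y x′ y′ →
      α :* (x :- x′) :+ β :* (y :- y′) := con 𝟘 :+
      (con 𝟙 :* (α :* x :+ β :* y :- γ) :+ (:- con 𝟙) :* (α :* x′ :+ β :* y′ :- γ))) refl α β γ x y x′ y′)
    x-y≡0 : ∀ {x y} → x - y ≡ 0# → x ≡ y
    x-y≡0 {x} {y} e = combine (1# ⊛ e) (solve 2 (λ x y → x := y :+ con 𝟙 :* (x :- y :- con 𝟘)) refl x y)
    unique : ∀ v w → Solves v → Solves w → v ≡ w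
    unique (x , y) (x′ , y′) (e , f) (e′ , f′) =
      let zx , zy = cramer-zero Δ≢0 (difference α β γ x y x′ y′ e e′) (difference α′ β′ γ′ x y x′ y′ f f′)
      in cong₂ _,_ (x-y≡0 zx) (x-y≡0 zy)

  Thru : V4 → ℙ¹ → Set
  Thru M b = OnSkew M (cubic (X b) (Y b))

  Thru⇒on : ∀ M b → Thru M b → OnLine (skewLine M) (pt b)
  Thru⇒on M b t = ~-on (~-sym (skewLine-~ M)) (subst (OnLine (skewBasis M)) (sym (pt-cubic b)) (OnSkew⇒span M t))

  on⇒Thru : ∀ M b → OnLine (skewLine M) (pt b) → Thru M b
  on⇒Thru M b o = span⇒OnSkew M (subst (OnLine (skewBasis M)) (pt-cubic b) (~-on (skewLine-~ M) o))

  Thru? : ∀ M → Decidable (Thru M)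
  Thru? M b = (_ ≟ _) ×-dec (_ ≟ _)

  cubes-≢0 : ∀ b → X b * X b * X b ≢ 0# ⊎ Y b * Y b * Y b ≢ 0#
  cubes-≢0 nothing = inj₁ (*-nonzero (*-nonzero 1≢0 1≢0) 1≢0)
  cubes-≢0 (just _) = inj₂ (*-nonzero (*-nonzero 1≢0 1≢0) 1≢0)

  private
    X³ Y³ X²Y XY² : ℙ¹ → Carrier
    X³ b = X b * X b * X b
    Y³ b = Y b * Y b * Y b
    X²Y b = X b * X b * Y b
    XY² b = X b * Y b * Y b

    -- In characteristic 3 this determinant of cubes is the cube of the determinant of the two
    -- points.
    Δ-≢0 : ∀ {b b′} → b′ ≢ b → X³ b * Y³ b′ - Y³ b * X³ b′ ≢ 0#
    Δ-≢0 {b} {b′} ne e = *-nonzero d≢0 (*-nonzero d≢0 d≢0)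
      (trans (solve 4 (λ x y x′ y′ → (x :* y′ :- y :* x′) :* ((x :* y′ :- y :* x′) :* (x :* y′ :- y :* x′)) :=
        x :* x :* x :* (y′ :* y′ :* y′) :- y :* y :* y :* (x′ :* x′ :* x′)) refl (X b) (Y b) (X b′) (Y b′)) e)
      where d≢0 = det-≢0 {b} {b′} (ne ∘ sym)

  count-pair-product : ∀ {P Q : Carrier × Carrier → Set} {m n} → HasCount P m → HasCount Q n →
    HasCount (λ ((a , b , c , d) : V4) → P (a , b) × Q (c , d)) (m ℕ.* n)
  count-pair-product h h′ = count-image (λ ((a , b) , (c , d)) → a , b , c , d) (count-Σ h λ _ → h′)
    (λ { _ _ refl → refl }) id (λ {(a , b , c , d)} pq → ((a , b) , (c , d)) , pq , refl)

  -- Transposition: passing through a point is one linear equation in (a , c) and one in (b , d),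
  -- while the entries are listed by rows.
  exchange : V4 → V4
  exchange (a , b , c , d) = a , c , b , d

  count-exchange : ∀ {P : V4 → Set} {n} → HasCount (P ∘ exchange) n → HasCount P n
  count-exchange {P} h = count-image exchange h (λ { _ _ refl → refl }) id (λ {v} p → exchange v , p , refl)

  through₁ : ∀ b → HasCount (λ M → ⊤ × Thru M b) (q ℕ.* q)
  through₁ b = count-cong (λ (e , e′) → tt , sym e , sym e′) (λ (_ , e , e′) → sym e , sym e′) (count-exchange
    {P = λ (a , b′ , c , d) → (X³ b * a + Y³ b * c ≡ X²Y b) × (X³ b * b′ + Y³ b * d ≡ XY² b)}
    (count-pair-product (affine-line (X³ b) (Y³ b) (X²Y b) (cubes-≢0 b)) (affine-line (X³ b) (Y³ b) (XY² b) (cubes-≢0 b))))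

  through₂ : ∀ b b′ → b′ ≢ b → HasCount (λ M → ⊤ × Thru M b × Thru M b′) 1
  through₂ b b′ ne = count-cong
    (λ ((e , f) , (e′ , f′)) → tt , (sym e , sym e′) , (sym f , sym f′))
    (λ (_ , (e , e′) , (f , f′)) → (sym e , sym f) , (sym e′ , sym f′)) (count-exchange
    {P = λ (a , c , b″ , d) → ((X³ b * a + Y³ b * b″ ≡ X²Y b) × (X³ b′ * a + Y³ b′ * b″ ≡ X²Y b′)) ×
                              ((X³ b * c + Y³ b * d ≡ XY² b) × (X³ b′ * c + Y³ b′ * d ≡ XY² b′))}
    (count-pair-product (cramer (X³ b) (Y³ b) (X²Y b) (X³ b′) (Y³ b′) (X²Y b′) (Δ-≢0 {b} {b′} ne))
                        (cramer (X³ b) (Y³ b) (XY² b) (X³ b′) (Y³ b′) (XY² b′) (Δ-≢0 {b} {b′} ne))))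

  On⇒cubic : ∀ π b → On π b → dot π (cubic (X b) (Y b)) ≡ 0#
  On⇒cubic π b z = trans (cong (dot π) (sym (pt-cubic b))) z

  -- The values of π on the two basis rows satisfy one homogeneous equation for each point, with
  -- nonzero determinant, so both vanish.
  two-points-inPlane : ∀ π M b b′ → b′ ≢ b → Thru M b → Thru M b′ → On π b → On π b′ → SkewIn π M
  two-points-inPlane π M b b′ ne t t′ z z′ = cramer-zero (Δ-≢0 {b} {b′} ne) (expand π M b t z) (expand π M b′ t′ z′)
    where
    expand : ∀ π M b → Thru M b → On π b →
      X³ b * dot π (proj₁ (skewBasis M)) + Y³ b * dot π (proj₂ (skewBasis M)) ≡ 0#
    expand π@(p₀ , p₁ , p₂ , p₃) M@(a , b , c , d) β (e₁ , e₂) z = combine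
      ((1# ⊛ On⇒cubic π β z ⊞ (- p₁) ⊛ e₁) ⊞ (- p₂) ⊛ e₂)
      (trans (regroup (X³ β) (Y³ β) p₀ p₁ p₂ p₃ a b c d) (recombine (X³ β) (Y³ β) (X²Y β) (XY² β) p₀ p₁ p₂ p₃
        (X³ β * a + Y³ β * c) (X³ β * b + Y³ β * d)))
      where
      regroup : ∀ x y p₀ p₁ p₂ p₃ a b c d →
        x * (p₀ * 1# + p₁ * a + p₂ * b + p₃ * 0#) + y * (p₀ * 0# + p₁ * c + p₂ * d + p₃ * 1#) ≡
        p₀ * x + p₁ * (x * a + y * c) + p₂ * (x * b + y * d) + p₃ * y
      regroup x y p₀ p₁ p₂ p₃ a b c d = trans
        (cong₂ _+_ (solve 7 (λ x p₀ p₁ p₂ p₃ a b → x :* (p₀ :* con 𝟙 :+ p₁ :* a :+ p₂ :* b :+ p₃ :* con 𝟘) :=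
            p₀ :* x :+ (p₁ :* (x :* a) :+ p₂ :* (x :* b))) refl x p₀ p₁ p₂ p₃ a b)
          (solve 7 (λ y p₀ p₁ p₂ p₃ c d → y :* (p₀ :* con 𝟘 :+ p₁ :* c :+ p₂ :* d :+ p₃ :* con 𝟙) :=
            (p₁ :* (y :* c) :+ p₂ :* (y :* d)) :+ p₃ :* y) refl y p₀ p₁ p₂ p₃ c d))
        (solve 8 (λ u v p₁ p₂ a b c d → u :+ (p₁ :* a :+ p₂ :* b) :+ ((p₁ :* c :+ p₂ :* d) :+ v) :=
            u :+ p₁ :* (a :+ c) :+ p₂ :* (b :+ d) :+ v) refl (p₀ * x) (p₃ * y) p₁ p₂ (x * a) (x * b) (y * c) (y * d))
      recombine : ∀ x y r s p₀ p₁ p₂ p₃ m n →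
        p₀ * x + p₁ * m + p₂ * n + p₃ * y ≡
        0# + (1# * (p₀ * x + p₁ * r + p₂ * s + p₃ * y - 0#) + (- p₁) * (r - m) + (- p₂) * (s - n))
      recombine x y r s p₀ p₁ p₂ p₃ m n = solve 8 (λ u v r s p₁ p₂ m n →
        u :+ p₁ :* m :+ p₂ :* n :+ v :=
        con 𝟘 :+ (con 𝟙 :* (u :+ p₁ :* r :+ p₂ :* s :+ v :- con 𝟘) :+ (:- p₁) :* (r :- m) :+ (:- p₂) :* (s :- n)))
        refl (p₀ * x) (p₃ * y) r s p₁ p₂ m n

  -- Some plane contains the first two points, hence the line through them, but misses the third.
  no-three-collinear : ∀ M b b′ b″ → b′ ≢ b → b″ ≢ b → b″ ≢ b′ → Thru M b → Thru M b′ → Thru M b″ → ⊥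
  no-three-collinear M b b′ b″ ne ne₁ ne₂ t t′ t″ =
    let e , value , z , z′ , _ = separate b b′ b {b″} ne₁ ne₂ ne₁ in
    1≢0 (trans (sym value) (trans (cong (dot e) (pt-cubic b″))
      (OnSkew-inPlane {e} M (two-points-inPlane e M b b′ ne t t′ z z′) t″)))

  -- Each of the q + 1 points lies on q² of the q⁴ skew lines and each pair on one, whence u = q⁴ -
  -- (q + 1)q² + (q + 1)q/2.
  count-free : ∃ λ u → HasCount (λ M → ⊤ × (∀ b → ¬ Thru M b)) u ×
    2 ℕ.* u ℕ.+ 2 ℕ.* (suc q ℕ.* (q ℕ.* q)) ≡ (q ℕ.* (q ℕ.* (q ℕ.* q))) ℕ.* 2 ℕ.+ suc q ℕ.* q ℕ.* 1
  count-free = Moments.avoiding finiteℙ¹ count-V4 Thru? (Finite.all finiteℙ¹) (λ _ _ → tt)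
    (λ {b} _ → through₁ b) (λ {b} {b′} (_ , _ , ne) → through₂ b b′ ne)
    (λ { {M} {b , b′ , b″} _ (t , (t′ , ne) , (t″ , ne₁) , ne₂) → no-three-collinear M b b′ b″ ne ne₁ ne₂ t t′ t″ })

  module InPlaneCounts (π : V4) (not-axial : ¬ ThroughAxis π) where

    private
      p₀ p₁ p₂ p₃ : Carrier
      p₀ = proj₁ π
      p₁ = proj₁ (proj₂ π)
      p₂ = proj₁ (proj₂ (proj₂ π))
      p₃ = proj₂ (proj₂ (proj₂ π))

      p₁∨p₂ : p₁ ≢ 0# ⊎ p₂ ≢ 0#
      p₁∨p₂ with p₁ ≟ 0#
      ... | no p₁≢0 = inj₁ p₁≢0
      ... | yes p₁≡0 = inj₂ λ p₂≡0 → not-axial (p₁≡0 , p₂≡0)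

      first⇒ : ∀ {a b} → p₁ * a + p₂ * b ≡ - p₀ → p₀ * 1# + p₁ * a + p₂ * b + p₃ * 0# ≡ 0#
      first⇒ {a} {b} e = combine (1# ⊛ e) (solve 6 (λ p₀ p₁ p₂ p₃ a b →
        p₀ :* con 𝟙 :+ p₁ :* a :+ p₂ :* b :+ p₃ :* con 𝟘 := con 𝟘 :+ con 𝟙 :* (p₁ :* a :+ p₂ :* b :- (:- p₀)))
        refl p₀ p₁ p₂ p₃ a b)
      first⇐ : ∀ {a b} → p₀ * 1# + p₁ * a + p₂ * b + p₃ * 0# ≡ 0# → p₁ * a + p₂ * b ≡ - p₀
      first⇐ {a} {b} e = combine (1# ⊛ e) (solve 6 (λ p₀ p₁ p₂ p₃ a b →
        p₁ :* a :+ p₂ :* b := :- p₀ :+ con 𝟙 :* (p₀ :* con 𝟙 :+ p₁ :* a :+ p₂ :* b :+ p₃ :* con 𝟘 :- con 𝟘))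
        refl p₀ p₁ p₂ p₃ a b)
      second⇒ : ∀ {a b} → p₁ * a + p₂ * b ≡ - p₃ → p₀ * 0# + p₁ * a + p₂ * b + p₃ * 1# ≡ 0#
      second⇒ {a} {b} e = combine (1# ⊛ e) (solve 6 (λ p₀ p₁ p₂ p₃ a b →
        p₀ :* con 𝟘 :+ p₁ :* a :+ p₂ :* b :+ p₃ :* con 𝟙 := con 𝟘 :+ con 𝟙 :* (p₁ :* a :+ p₂ :* b :- (:- p₃)))
        refl p₀ p₁ p₂ p₃ a b)
      second⇐ : ∀ {a b} → p₀ * 0# + p₁ * a + p₂ * b + p₃ * 1# ≡ 0# → p₁ * a + p₂ * b ≡ - p₃
      second⇐ {a} {b} e = combine (1# ⊛ e) (solve 6 (λ p₀ p₁ p₂ p₃ a b →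
        p₁ :* a :+ p₂ :* b := :- p₃ :+ con 𝟙 :* (p₀ :* con 𝟘 :+ p₁ :* a :+ p₂ :* b :+ p₃ :* con 𝟙 :- con 𝟘))
        refl p₀ p₁ p₂ p₃ a b)

      half : ∀ γ → HasCount (λ ((x , y) : Carrier × Carrier) → p₁ * x + p₂ * y ≡ γ) q
      half γ = affine-line p₁ p₂ γ p₁∨p₂

    skew : HasCount (SkewIn π) (q ℕ.* q)
    skew = count-cong (λ (e , e′) → first⇒ e , second⇒ e′) (λ (e , e′) → first⇐ e , second⇐ e′)
      (count-pair-product (half (- p₀)) (half (- p₃)))

    private
      -- Passing through P(t) determines the second row from the first; if π contains P(t) and the
      -- first row, it then contains the second row as well.
      residual : ∀ t a b → dot π (P t) ≡ 0# → p₁ * a + p₂ * b ≡ - p₀ →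
        p₁ * (t * t - t * t * t * a) + p₂ * (t - t * t * t * b) ≡ - p₃
      residual t a b z e = combine (1# ⊛ z ⊞ (- (t * t * t)) ⊛ e)
        (trans (solve 6 (λ p₁ p₂ t t³ a b →
            p₁ :* (t :* t :- t³ :* a) :+ p₂ :* (t :- t³ :* b) :=
            p₁ :* (t :* t) :+ p₂ :* t :- t³ :* (p₁ :* a :+ p₂ :* b)) refl p₁ p₂ t (t * t * t) a b)
          (solve 6 (λ p₀ p₃ t³ r s m → r :+ s :- t³ :* m := :- p₃ :+
            (con 𝟙 :* (p₀ :* t³ :+ r :+ s :+ p₃ :* con 𝟙 :- con 𝟘) :+
             (:- t³) :* (m :- (:- p₀)))) refl p₀ p₃ (t * t * t) (p₁ * (t * t)) (p₂ * t) (p₁ * a + p₂ * b)))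

      at-t : ∀ r x a → r ≡ x * a + 1# * 1# * 1# * (r - x * a)
      at-t = solve 3 (λ r x a → r := x :* a :+ con 𝟙 :* con 𝟙 :* con 𝟙 :* (r :- x :* a)) refl

      at-t⇐ : ∀ {r x a c} → r ≡ x * a + 1# * 1# * 1# * c → r - x * a ≡ c
      at-t⇐ {r} {x} {a} {c} e = combine (1# ⊛ e) (solve 4 (λ r x a c →
        r :- x :* a := c :+ con 𝟙 :* (r :- (x :* a :+ con 𝟙 :* con 𝟙 :* con 𝟙 :* c))) refl r x a c)

      t²*1 : ∀ t → t * t * 1# ≡ t * t
      t²*1 t = *-identityʳ (t * t)

      t*1² : ∀ t → t * 1# * 1# ≡ t
      t*1² t = trans (*-identityʳ _) (*-identityʳ t)

      at-∞ : ∀ a c → 1# * 1# * 1# * a + 0# * 0# * 0# * c ≡ a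
      at-∞ = solve 2 (λ a c → con 𝟙 :* con 𝟙 :* con 𝟙 :* a :+ con 𝟘 :* con 𝟘 :* con 𝟘 :* c := a) refl

      Half : Carrier → Carrier × Carrier → Set
      Half γ (x , y) = p₁ * x + p₂ * y ≡ γ

      At : ℙ¹ → V4 → Set
      At b M = SkewIn π M × Thru M b

    -- One basis row stays free on an affine line of q choices and the other is forced: at infinity
    -- the first row is (1 , 0 , 0 , 0), at t the second row is the one treated in `residual`.
    skew-through₁ : ∀ b → On π b → HasCount (At b) q
    skew-through₁ nothing z = count-image {P = Half (- p₃)} {Q = At nothing} (λ (c , d) → 0# , 0# , c , d) (half (- p₃))
      (λ { _ _ refl → refl }) into onto
      where
      p₀≡0 : p₀ ≡ 0#
      p₀≡0 = trans (solve 4 (λ p₀ p₁ p₂ p₃ → p₀ := p₀ :* con 𝟙 :+ p₁ :* con 𝟘 :+ p₂ :* con 𝟘 :+ p₃ :* con 𝟘) refl p₀ p₁ p₂ p₃) z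
      first : p₁ * 0# + p₂ * 0# ≡ - p₀
      first = trans (solve 2 (λ x y → x :* con 𝟘 :+ y :* con 𝟘 := :- con 𝟘) refl p₁ p₂) (cong -_ (sym p₀≡0))
      into : ∀ {v} → Half (- p₃) v → At nothing (0# , 0# , v)
      into {c , d} e = (first⇒ first , second⇒ e) ,
        (trans (zeroʳ _) (sym (at-∞ 0# c)) , trans (zeroʳ _) (sym (at-∞ 0# d)))
      onto : ∀ {M} → At nothing M → ∃ λ v → Half (- p₃) v × (0# , 0# , v) ≡ M
      onto {a , b , c , d} ((_ , e) , (f , g)) = (c , d) , second⇐ e ,
        vector-≡ (trans (sym (zeroʳ _)) (trans f (at-∞ a c))) (trans (sym (zeroʳ _)) (trans g (at-∞ b d))) refl refl
    skew-through₁ (just t) z = count-image {P = Half (- p₀)} {Q = At (just t)} point (half (- p₀))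
      (λ _ _ e → cong₂ _,_ (cong proj₁ e) (cong (proj₁ ∘ proj₂) e)) into onto
      where
      point : Carrier × Carrier → V4
      point (a , b) = a , b , t * t - t * t * t * a , t - t * t * t * b
      into : ∀ {v} → Half (- p₀) v → At (just t) (point v)
      into {a , b} e = (first⇒ e , second⇒ (residual t a b z e)) ,
        (trans (t²*1 t) (at-t (t * t) (t * t * t) a) , trans (t*1² t) (at-t t (t * t * t) b))
      onto : ∀ {M} → At (just t) M → ∃ λ v → Half (- p₀) v × point v ≡ M
      onto {a , b , c , d} ((e , _) , (f , g)) = (a , b) , first⇐ e ,
        vector-≡ refl refl (at-t⇐ (trans (sym (t²*1 t)) f)) (at-t⇐ (trans (sym (t*1² t)) g))

    skew-through₂ : ∀ b b′ → b′ ≢ b → On π b → On π b′ → HasCount (λ M → SkewIn π M × Thru M b × Thru M b′) 1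
    skew-through₂ b b′ ne z z′ = count-cong
      {P = λ M → ⊤ × Thru M b × Thru M b′} {Q = λ M → SkewIn π M × Thru M b × Thru M b′}
      (λ {M} (_ , t , t′) → two-points-inPlane π M b b′ ne t t′ z z′ , t , t′) (λ (_ , t , t′) → tt , t , t′) (through₂ b b′ ne)

    -- Inclusion-exclusion inside the plane, over its d points of the cubic: u = q² - dq + d(d -
    -- 1)/2.
    count-skew-free : ∀ {d} → HasCount (On π) d → ∃ λ u → HasCount (λ M → SkewIn π M × (∀ b → ¬ Thru M b)) u ×
      2 ℕ.* u ℕ.+ 2 ℕ.* (d ℕ.* q) ≡ (q ℕ.* q) ℕ.* 2 ℕ.+ d ℕ.* (d ∸ 1) ℕ.* 1
    count-skew-free h = Moments.avoiding finiteℙ¹ {S = SkewIn π} skew {R = Thru} Thru? {T = On π} h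
      (λ {M} {b} s t → trans (cong (dot π) (pt-cubic b)) (OnSkew-inPlane {π} M s t))
      (λ {b} z → skew-through₁ b z) (λ {b} {b′} (z , z′ , ne) → skew-through₂ b b′ ne z z′)
      (λ { {M} {b , b′ , b″} _ (t , (t′ , ne) , (t″ , ne₁) , ne₂) → no-three-collinear M b b′ b″ ne ne₁ ne₂ t t′ t″ })

-- Imaginary chords as irreducible quadratics

module ImaginaryChords (F : FiniteField) (3≡0 : Characteristic-3 F)
  (p : ℕ) (q≡1+p : FiniteField.q F ≡ suc p) (1≤p : 1 ℕ.≤ p) where
  open Geometry F
  open SkewLines F 3≡0 p q≡1+p 1≤p public

  span-• : ∀ {u v w} k → InSpan u v w → InSpan u v (k • w)
  span-• {w = w@(a , b , c , d)} k w∈ = span-closed w∈ w∈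
    (k , 0# , vector-≡ (lemma a) (lemma b) (lemma c) (lemma d))
    where
    lemma : ∀ a → k * a ≡ k * a + 0# * a
    lemma a = solve 2 (λ k a → k :* a := k :* a :+ con 𝟘 :* a) refl k a

  -- Incidence is given for normalised vectors only; scaling extends it to all nonzero vectors, and
  -- the zero vector lies in every span.
  points⇒~ : ∀ {L L′} → (∀ x → IsPoint x → OnLine L x ⇔ OnLine L′ x) → L ~ L′
  points⇒~ {r₁ , r₂} {r₁′ , r₂′} same =
    (transfer (λ n → Equivalence.from (same _ n)) (left-∈ r₁′ r₂′) , transfer (λ n → Equivalence.from (same _ n)) (right-∈ r₁′ r₂′)) ,
    (transfer (λ n → Equivalence.to (same _ n)) (left-∈ r₁ r₂) , transfer (λ n → Equivalence.to (same _ n)) (right-∈ r₁ r₂))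
    where
    transfer : ∀ {u v u′ v′ x} → (∀ {w} → IsPoint w → InSpan u v w → InSpan u′ v′ w) → InSpan u v x → InSpan u′ v′ x
    transfer {u} {v} {u′} {v′} {x} f x∈ with Finite._≟_ finiteV4 x 0⃗
    ... | yes refl = subst (InSpan u′ v′) zero-• (span-• 0# (left-∈ u′ v′))
      where
      zero-• : 0# • u′ ≡ 0⃗
      zero-• = vector-≡ (zeroˡ _) (zeroˡ _) (zeroˡ _) (zeroˡ _)
    ... | no x≢0 =
      let k , w , k≢0 , n , e = normalize x x≢0
          w≡ : inv k≢0 • x ≡ w
          w≡ = trans (cong (inv k≢0 •_) (sym e)) (trans (•-• _ k w)
                 (trans (cong (_• w) (trans (*-comm _ k) (inv-* k≢0))) (1• w)))
      in subst (InSpan u′ v′) e (span-• k (f n (subst (InSpan u v) w≡ (span-• (inv k≢0) x∈))))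

  -- P(θ) = R + θ I for a root θ of T² − uT − w spans, with its conjugate, the line R I.
  chord : Carrier → Carrier → Line
  chord u w = (u * w , w , 0# , 1#) , (u * u + w , u , 1# , 0#)

  -- Trace and negated norm of a + bθ, so that a + bθ is a root of T² - u′T - w′ for these values
  -- u′, w′.
  minimal-u minimal-w : Carrier → Carrier → Carrier → Carrier → Carrier
  minimal-u u w a b = a + a + b * u
  minimal-w u w a b = b * b * w - a * a - a * b * u

  -- For θ′ = a + bθ with chord generators R′, I′, the point R′ + θ′I′ equals (R′ + aI′) + θ(bI′),
  -- and this change of basis is invertible because b is nonzero.
  PE-~ : ∀ u w a {b} → b ≢ 0# → PE u w (a , b) ~ chord (minimal-u u w a b) (minimal-w u w a b)
  PE-~ u w a {b} b≢0 = ~-sym (~-trans (~-addˡ a R I) (~-trans (~-scaleʳ b≢0 (R ⊕ (a • I)) I) (≡⇒~ (cong₂ _,_ R≡ I≡))))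
    where
    R = proj₁ (chord (minimal-u u w a b) (minimal-w u w a b))
    I = proj₂ (chord (minimal-u u w a b) (minimal-w u w a b))
    R≡ : R ⊕ (a • I) ≡ proj₁ (PE u w (a , b))
    R≡ = vector-≡
      (solve 4 (λ u w a b → let u′ = a :+ a :+ b :* u ; w′ = b :* b :* w :- a :* a :- a :* b :* u in
        u′ :* w′ :+ a :* (u′ :* u′ :+ w′) := (a :* a :+ b :* b :* w) :* a :+ (a :* b :+ b :* a :+ b :* b :* u) :* b :* w)
        refl u w a b)
      (solve 4 (λ u w a b → let u′ = a :+ a :+ b :* u ; w′ = b :* b :* w :- a :* a :- a :* b :* u in
        w′ :+ a :* u′ := a :* a :+ b :* b :* w) refl u w a b)
      (solve 1 (λ a → con 𝟘 :+ a :* con 𝟙 := a) refl a)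
      (solve 1 (λ a → con 𝟙 :+ a :* con 𝟘 := con 𝟙) refl a)
    I≡ : b • I ≡ proj₂ (PE u w (a , b))
    I≡ = vector-≡
      (solve 4 (λ u w a b → let u′ = a :+ a :+ b :* u ; w′ = b :* b :* w :- a :* a :- a :* b :* u in
        b :* (u′ :* u′ :+ w′) := (a :* a :+ b :* b :* w) :* b :+ (a :* b :+ b :* a :+ b :* b :* u) :* a
          :+ (a :* b :+ b :* a :+ b :* b :* u) :* b :* u) refl u w a b)
      (solve 4 (λ u w a b → b :* (a :+ a :+ b :* u) := a :* b :+ b :* a :+ b :* b :* u) refl u w a b)
      (*-identityʳ b) (zeroʳ b)

  -- A root t of the new quadratic would give the root (t - a)/b of the old one.
  minimal-irreducible : ∀ {u w} a {b} → b ≢ 0# → Irreducible u w →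
    Irreducible (minimal-u u w a b) (minimal-w u w a b)
  minimal-irreducible {u} {w} a {b} b≢0 irr t e = irr (i * (t - a)) (combine
    ((i * i) ⊛ e ⊞ (u * (i * (t - a)) + w * (b * i + 1#)) ⊛ inv-* b≢0) (solve 6 (λ u w a b t i →
      i :* (t :- a) :* (i :* (t :- a)) := u :* (i :* (t :- a)) :+ w :+
        (i :* i :* (t :* t :- ((a :+ a :+ b :* u) :* t :+ (b :* b :* w :- a :* a :- a :* b :* u)))
         :+ (u :* (i :* (t :- a)) :+ w :* (b :* i :+ con 𝟙)) :* (b :* i :- con 𝟙)))
      refl u w a b t i))
    where i = inv b≢0

  imaginary⇒chord : ∀ {L} → IsImaginaryChord L → ∃₂ λ u w → Irreducible u w × L ~ chord u w
  imaginary⇒chord (u , w , irr , a , b , b≢0 , same) =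
    minimal-u u w a b , minimal-w u w a b , minimal-irreducible a b≢0 irr , ~-trans (points⇒~ same) (PE-~ u w a b≢0)

  chord⇒imaginary : ∀ {L u w} → Irreducible u w → L ~ chord u w → IsImaginaryChord L
  chord⇒imaginary {L} {u} {w} irr L~ = u , w , irr , 0# , 1# , 1≢0 , λ x _ → mk⇔ (~-on L~PE) (~-on (~-sym L~PE))
    where
    L~PE : L ~ PE u w (0# , 1#)
    L~PE = ~-trans L~ (~-trans (≡⇒~ (cong₂ chord
      (solve 1 (λ u → u := con 𝟘 :+ con 𝟘 :+ con 𝟙 :* u) refl u)
      (solve 2 (λ u w → w := con 𝟙 :* con 𝟙 :* w :- con 𝟘 :* con 𝟘 :- con 𝟘 :* con 𝟙 :* u) refl u w)))
      (~-sym (PE-~ u w 0# 1≢0)))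

  -- The last two coordinates of the generators are (0 , 1) and (1 , 0) for every pair, so they fix
  -- all coefficients; the second coordinate then compares w with w′ and u with u′.
  chord-injective : ∀ {u w u′ w′} → chord u w ~ chord u′ w′ → u ≡ u′ × w ≡ w′
  chord-injective {u} {w} {u′} {w′} (_ , (R∈ , I∈)) = second u′ u w′ w I∈ , first R∈
    where
    first : InSpan (proj₁ (chord u′ w′)) (proj₂ (chord u′ w′)) (proj₁ (chord u w)) → w ≡ w′
    first (k , l , e) = combine (1# ⊛ cong (proj₁ ∘ proj₂) e ⊞ (- u′) ⊛ cong (proj₁ ∘ proj₂ ∘ proj₂) e
        ⊞ (- w′) ⊛ cong (proj₂ ∘ proj₂ ∘ proj₂) e)
      (solve 5 (λ k l u′ w w′ → w := w′ :+ (con 𝟙 :* (w :- (k :* w′ :+ l :* u′)) :+ ((:- u′) :* (con 𝟘 :- (k :* con 𝟘 :+ l :* con 𝟙))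
        :+ (:- w′) :* (con 𝟙 :- (k :* con 𝟙 :+ l :* con 𝟘))))) refl k l u′ w w′)
    second : ∀ u′ u w′ w → InSpan (proj₁ (chord u′ w′)) (proj₂ (chord u′ w′)) (proj₂ (chord u w)) → u ≡ u′
    second u′ u w′ w (k , l , e) = combine (1# ⊛ cong (proj₁ ∘ proj₂) e ⊞ (- u′) ⊛ cong (proj₁ ∘ proj₂ ∘ proj₂) e
        ⊞ (- w′) ⊛ cong (proj₂ ∘ proj₂ ∘ proj₂) e)
      (solve 5 (λ k l u′ u w′ → u := u′ :+ (con 𝟙 :* (u :- (k :* w′ :+ l :* u′)) :+ ((:- u′) :* (con 𝟙 :- (k :* con 𝟘 :+ l :* con 𝟙))
        :+ (:- w′) :* (con 𝟘 :- (k :* con 𝟙 :+ l :* con 𝟘))))) refl k l u′ u w′)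

  -- In characteristic 3 the discriminant u² + 4w is u² + w; if it vanished, -u = u/2 would be a
  -- double root. Up to sign it is also the minor of the chord in columns 0 and 3, so every
  -- imaginary chord is skew to the axis.
  discriminant-≢0 : ∀ {u w} → Irreducible u w → u * u + w ≢ 0#
  discriminant-≢0 {u} {w} irr e = irr (- u) (combine ((- 1#) ⊛ e)
    (solve 2 (λ u w → (:- u) :* (:- u) := u :* (:- u) :+ w :+ (:- con 𝟙) :* (u :* u :+ w :- con 𝟘)) refl u w))

  private
    -- With i = 1/(u² + w), the rows of the skew basis are iI and R - uw·iI for the generators R, I
    -- of the chord.
    chordCoordinates : Carrier → Carrier → Carrier → V4
    chordCoordinates u w i = u * i , i , w - u * u * w * i , - (u * w * i)

  -- Junk value 0⃗ when u² + w = 0, in which case T² − uT − w splits.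
  chordMatrix : Carrier × Carrier → V4
  chordMatrix (u , w) with (u * u + w) ≟ 0#
  ... | yes _ = 0⃗
  ... | no D≢0 = chordCoordinates u w (inv D≢0)

  chordMatrix-~ : ∀ u w → Irreducible u w → skewBasis (chordMatrix (u , w)) ~ chord u w
  chordMatrix-~ u w irr with (u * u + w) ≟ 0#
  ... | yes D≡0 = contradiction D≡0 (discriminant-≢0 irr)
  ... | no D≢0 = general (inv D≢0) (inv-* D≢0)
    where
    general : ∀ i → (u * u + w) * i ≡ 1# → skewBasis (chordCoordinates u w i) ~ chord u w
    general i e =
      (OnSkew⇒span (chordCoordinates u w i)
         (solve 3 (λ u w i → w := u :* w :* (u :* i) :+ con 𝟙 :* (w :- u :* u :* w :* i)) refl u w i ,
          solve 3 (λ u w i → con 𝟘 := u :* w :* i :+ con 𝟙 :* (:- (u :* w :* i))) refl u w i) ,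
       OnSkew⇒span (chordCoordinates u w i)
         (combine ((- u) ⊛ e) (solve 3 (λ u w i → u := (u :* u :+ w) :* (u :* i) :+ con 𝟘 :* (w :- u :* u :* w :* i)
             :+ (:- u) :* ((u :* u :+ w) :* i :- con 𝟙)) refl u w i) ,
          combine ((- 1#) ⊛ e) (solve 3 (λ u w i → con 𝟙 := (u :* u :+ w) :* i :+ con 𝟘 :* (:- (u :* w :* i))
             :+ (:- con 𝟙) :* ((u :* u :+ w) :* i :- con 𝟙)) refl u w i))) ,
      (0# , i , vector-≡
        (combine ((- 1#) ⊛ e) (solve 3 (λ u w i → con 𝟙 := con 𝟘 :* (u :* w) :+ i :* (u :* u :+ w)
             :+ (:- con 𝟙) :* ((u :* u :+ w) :* i :- con 𝟙)) refl u w i))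
        (solve 3 (λ u w i → u :* i := con 𝟘 :* w :+ i :* u) refl u w i)
        (solve 1 (λ i → i := con 𝟘 :* con 𝟘 :+ i :* con 𝟙) refl i)
        (solve 1 (λ i → con 𝟘 := con 𝟘 :* con 𝟙 :+ i :* con 𝟘) refl i)) ,
      (1# , - (u * w * i) , vector-≡
        (combine ((u * w) ⊛ e) (solve 3 (λ u w i → con 𝟘 := con 𝟙 :* (u :* w) :+ (:- (u :* w :* i)) :* (u :* u :+ w)
             :+ (u :* w) :* ((u :* u :+ w) :* i :- con 𝟙)) refl u w i))
        (solve 3 (λ u w i → w :- u :* u :* w :* i := con 𝟙 :* w :+ (:- (u :* w :* i)) :* u) refl u w i)
        (solve 3 (λ u w i → :- (u :* w :* i) := con 𝟙 :* con 𝟘 :+ (:- (u :* w :* i)) :* con 𝟙) refl u w i)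
        (solve 3 (λ u w i → con 𝟙 := con 𝟙 :* con 𝟙 :+ (:- (u :* w :* i)) :* con 𝟘) refl u w i))

  Irr : Carrier × Carrier → Set
  Irr (u , w) = Irreducible u w

  Irr? : Decidable Irr
  Irr? (u , w) = map′ (λ ¬r t e → ¬r (t , e)) (λ irr (t , e) → irr t e)
    (¬? (Finite.exists? finite (λ t → (t * t) ≟ (u * t + w))))

  ImaginarySkew : V4 → Set
  ImaginarySkew M = ∃ λ v → Irr v × chordMatrix v ≡ M

  ImaginarySkew? : Decidable ImaginarySkew
  ImaginarySkew? M = Finite.exists? (finite-× finite finite) (λ v → Irr? v ×-dec Finite._≟_ finiteV4 (chordMatrix v) M)

  imaginary⇒skew : ∀ {M} → IsImaginaryChord (skewLine M) → ImaginarySkew M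
  imaginary⇒skew {M} im = let u , w , irr , L~ = imaginary⇒chord im in
    (u , w) , irr , skewBasis-injective (chordMatrix (u , w)) M
      (~-trans (chordMatrix-~ u w irr) (~-trans (~-sym L~) (skewLine-~ M)))

  skew⇒imaginary : ∀ {M} → ImaginarySkew M → IsImaginaryChord (skewLine M)
  skew⇒imaginary {M} ((u , w) , irr , e) = chord⇒imaginary irr
    (~-trans (skewLine-~ M) (~-trans (≡⇒~ (cong skewBasis (sym e))) (chordMatrix-~ u w irr)))

  chordMatrix-injective : ∀ {v v′} → Irr v → Irr v′ → chordMatrix v ≡ chordMatrix v′ → v ≡ v′
  chordMatrix-injective {u , w} {u′ , w′} irr irr′ e =
    let u≡ , w≡ = chord-injective (~-trans (~-sym (chordMatrix-~ u w irr))
                    (~-trans (≡⇒~ (cong skewBasis e)) (chordMatrix-~ u′ w′ irr′)))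
    in cong₂ _,_ u≡ w≡

  -- A point P(t) on the chord would make t a root of the quadratic; for P(∞) the last two
  -- coordinates make both coefficients zero.
  ImaginarySkew-free : ∀ M → ImaginarySkew M → ∀ b → ¬ Thru M b
  ImaginarySkew-free M ((u , w) , irr , e) b t = off-chord b
    (~-on (chordMatrix-~ u w irr) (subst (λ M → OnLine (skewBasis M) (cubic (X b) (Y b))) (sym e) (OnSkew⇒span M t)))
    where
    off-chord : ∀ b → ¬ OnLine (chord u w) (cubic (X b) (Y b))
    off-chord nothing (k , l , e) = 1≢0 (combine
      (1# ⊛ cong proj₁ e ⊞ (- (u * w)) ⊛ cong (proj₂ ∘ proj₂ ∘ proj₂) e ⊞ (- (u * u + w)) ⊛ cong (proj₁ ∘ proj₂ ∘ proj₂) e)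
      (solve 4 (λ k l u w → con 𝟙 := con 𝟘 :+ (con 𝟙 :* (con 𝟙 :* con 𝟙 :* con 𝟙 :- (k :* (u :* w) :+ l :* (u :* u :+ w)))
        :+ ((:- (u :* w)) :* (con 𝟘 :* con 𝟘 :* con 𝟘 :- (k :* con 𝟙 :+ l :* con 𝟘))
        :+ (:- (u :* u :+ w)) :* (con 𝟙 :* con 𝟘 :* con 𝟘 :- (k :* con 𝟘 :+ l :* con 𝟙))))) refl k l u w))
    off-chord (just t) (k , l , e) = irr t (combine
      (1# ⊛ cong (proj₁ ∘ proj₂) e ⊞ (- w) ⊛ cong (proj₂ ∘ proj₂ ∘ proj₂) e ⊞ (- u) ⊛ cong (proj₁ ∘ proj₂ ∘ proj₂) e)
      (solve 5 (λ k l u w t → t :* t := u :* t :+ w :+ (con 𝟙 :* (t :* t :* con 𝟙 :- (k :* w :+ l :* u))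
        :+ ((:- w) :* (con 𝟙 :* con 𝟙 :* con 𝟙 :- (k :* con 𝟙 :+ l :* con 𝟘))
        :+ (:- u) :* (t :* con 𝟙 :* con 𝟙 :- (k :* con 𝟘 :+ l :* con 𝟙))))) refl k l u w t))

  -- Irreducible means avoiding every t as a root: each t is a root of q monic quadratics and two
  -- distinct roots determine one, so n = q² - q·q + q(q - 1)/2.
  count-irreducible : ∃ λ n → HasCount Irr n × 2 ℕ.* n ℕ.+ 2 ℕ.* (q ℕ.* q) ≡ (q ℕ.* q) ℕ.* 2 ℕ.+ q ℕ.* (q ∸ 1) ℕ.* 1
  count-irreducible =
    let n , h , e = Moments.avoiding finite {S = λ _ → ⊤} (Finite.all (finite-× finite finite)) {R = Root} Root?
                      {T = λ _ → ⊤} (Finite.all finite) (λ _ _ → tt) (λ {t} _ → roots₁ t)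
                      (λ {t} {s} (_ , _ , ne) → roots₂ t s ne) (λ {v} {t} _ → no-three-roots v t)
    in n , count-cong {P = λ v → ⊤ × (∀ t → ¬ Root v t)} {Q = Irr} proj₂ (tt ,_) h , e
    where
    Root : Carrier × Carrier → Carrier → Set
    Root (u , w) t = t * t ≡ u * t + w
    Root? : ∀ v → Decidable (Root v)
    Root? (u , w) t = (t * t) ≟ (u * t + w)
    root⇔ : ∀ u w t → t * u + 1# * w ≡ u * t + w
    root⇔ = solve 3 (λ u w t → t :* u :+ con 𝟙 :* w := u :* t :+ w) refl
    roots₁ : ∀ t → HasCount (λ v → ⊤ × Root v t) q
    roots₁ t = count-cong {P = λ (u , w) → t * u + 1# * w ≡ t * t}
      (λ {(u , w)} e → tt , sym (trans (sym (root⇔ u w t)) e)) (λ {(u , w)} (_ , e) → trans (root⇔ u w t) (sym e))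
      (affine-line t 1# (t * t) (inj₂ 1≢0))
    roots₂ : ∀ t s → s ≢ t → HasCount (λ v → ⊤ × Root v t × Root v s) 1
    roots₂ t s ne = count-cong {P = λ (u , w) → (t * u + 1# * w ≡ t * t) × (s * u + 1# * w ≡ s * s)}
      (λ {(u , w)} (e , f) → tt , sym (trans (sym (root⇔ u w t)) e) , sym (trans (sym (root⇔ u w s)) f))
      (λ {(u , w)} (_ , e , f) → trans (root⇔ u w t) (sym e) , trans (root⇔ u w s) (sym f))
      (cramer t 1# (t * t) s 1# (s * s) λ e → ne (combine ((- 1#) ⊛ e)
        (solve 2 (λ t s → s := t :+ (:- con 𝟙) :* (t :* con 𝟙 :- con 𝟙 :* s :- con 𝟘)) refl t s)))
    no-three-roots : ∀ v t → ¬ Triples (Root v) t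
    no-three-roots (u , w) (r , s , t) (er , (es , s≢r) , (et , t≢r) , t≢s) =
      t≢s (trans (root-sum t t≢r et) (sym (root-sum s s≢r es)))
      where
      root-sum : ∀ s → s ≢ r → s * s ≡ u * s + w → s ≡ u - r
      root-sum s s≢r es = *-cancelˡ (difference-≢0 s≢r) (combine (1# ⊛ es ⊞ (- 1#) ⊛ er) (solve 4 (λ u w r s →
        (s :- r) :* s := (s :- r) :* (u :- r) :+ (con 𝟙 :* (s :* s :- (u :* s :+ w)) :+ (:- con 𝟙) :* (r :* r :-
            (u :* r :+ w)))) refl u w r s))

-- EnΓ-lines, in the whole space and in a plane

module EnΓLines (F : FiniteField) (3≡0 : Characteristic-3 F)
  (p : ℕ) (q≡1+p : FiniteField.q F ≡ suc p) (1≤p : 1 ℕ.≤ p) where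
  open Geometry F
  open ImaginaryChords F 3≡0 p q≡1+p 1≤p public

  Free : V4 → Set
  Free M = ∀ b → ¬ Thru M b

  free⇒NoCPoint : ∀ M → Free M → NoCPoint (skewLine M)
  free⇒NoCPoint M free x _ on c = let b , e = OnC-pt c in
    free b (on⇒Thru M b (subst (OnLine (skewLine M)) (sym e) on))

  NoCPoint⇒free : ∀ M → NoCPoint (skewLine M) → Free M
  NoCPoint⇒free M none b t = none (pt b) (pt-isPoint b) (Thru⇒on M b t) (pt-OnC b)

  -- The extra condition `Z` is trivial for the count in space and is containment in π for the count
  -- in a plane.
  EnΓ-parametrisation : ∀ {Z : Line → Set} {n} →
    HasCount (λ M → (Z (skewLine M) × Free M) × ¬ ImaginarySkew M) n → HasCount (λ L → IsEnΓLine L × Z L) n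
  EnΓ-parametrisation {Z} h = count-image {P = λ M → (Z (skewLine M) × Free M) × ¬ ImaginarySkew M} {Q = λ L → IsEnΓLine L × Z L}
    skewLine h (λ {M} {M′} _ _ → skewLine-injective M M′)
    (λ {M} ((z , free) , ¬im) →
      (skewLine-isLine M , free⇒NoCPoint M free , skewLine-missesΓ M , λ im → ¬im (imaginary⇒skew im)) , z)
    onto
    where
    onto : ∀ {L} → IsEnΓLine L × Z L → ∃ λ M → ((Z (skewLine M) × Free M) × ¬ ImaginarySkew M) × skewLine M ≡ L
    onto ((isLine , none , misses , ¬im) , z) with missesΓ⇒skew isLine misses
    ... | M , refl = M , ((z , NoCPoint⇒free M none) , λ im → ¬im (skew⇒imaginary {M} im)) , refl

  open +-*-Solver using () renaming (solve to solveℕ; _:=_ to _:≡_; con to conℕ; _:+_ to _⊹_; _:*_ to _⊗_)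

  -- The free skew lines less the q(q - 1)/2 imaginary chords number q⁴ - q³ - q² + q = q(q - 1)²(q
  -- + 1).
  count-EnΓ : ∃ λ N → HasCount IsEnΓLine N × N ≡ suc p ℕ.* (p ℕ.* p) ℕ.* suc (suc p)
  count-EnΓ =
    let u , free , eu = count-free
        i , n , im , rest , split = count-split free ImaginarySkew?
        k , irr , ek = count-irreducible
        i≡k = count-unique im (count-image {P = Irr} {Q = λ M → (⊤ × Free M) × ImaginarySkew M} chordMatrix irr
                chordMatrix-injective
                (λ {v} i → (tt , ImaginarySkew-free (chordMatrix v) (v , i , refl)) , v , i , refl)
                (λ (_ , v , i , e) → v , i , e))
    in n , count-cong {P = λ L → IsEnΓLine L × ⊤} {Q = IsEnΓLine} proj₁ (_, tt) (EnΓ-parametrisation {Z = λ _ → ⊤} rest) ,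
       arithmetic q≡1+p k n (subst (λ u → 2 ℕ.* u ℕ.+ 2 ℕ.* (suc q ℕ.* (q ℕ.* q)) ≡ (q ℕ.* (q ℕ.* (q ℕ.* q))) ℕ.* 2 ℕ.+ suc q ℕ.* q ℕ.* 1)
                        (trans (sym split) (cong (ℕ._+ n) i≡k)) eu) ek
    where
    arithmetic : ∀ {q} → q ≡ suc p → ∀ k n →
      2 ℕ.* (k ℕ.+ n) ℕ.+ 2 ℕ.* (suc q ℕ.* (q ℕ.* q)) ≡ (q ℕ.* (q ℕ.* (q ℕ.* q))) ℕ.* 2 ℕ.+ suc q ℕ.* q ℕ.* 1 →
      2 ℕ.* k ℕ.+ 2 ℕ.* (q ℕ.* q) ≡ (q ℕ.* q) ℕ.* 2 ℕ.+ q ℕ.* (q ∸ 1) ℕ.* 1 →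
      n ≡ suc p ℕ.* (p ℕ.* p) ℕ.* suc (suc p)
    arithmetic refl k n e₁ e₂ = ℕₚ.*-cancelˡ-≡ _ _ 2 (ℕₚ.+-cancelʳ-≡ extra _ _
      (trans (solveℕ 3 (λ k n p → let q = conℕ 1 ⊹ p ; q+1 = conℕ 1 ⊹ q in
          conℕ 2 ⊗ n ⊹ ((conℕ 2 ⊗ k ⊹ conℕ 2 ⊗ (q ⊗ q)) ⊹ conℕ 2 ⊗ (q+1 ⊗ (q ⊗ q))) :≡
          (conℕ 2 ⊗ (k ⊹ n) ⊹ conℕ 2 ⊗ (q+1 ⊗ (q ⊗ q))) ⊹ conℕ 2 ⊗ (q ⊗ q)) refl k n p)
      (trans (cong (ℕ._+ 2 ℕ.* (suc p ℕ.* suc p)) e₁)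
      (trans (solveℕ 1 (λ p → let q = conℕ 1 ⊹ p ; q+1 = conℕ 1 ⊹ q in
          ((q ⊗ (q ⊗ (q ⊗ q))) ⊗ conℕ 2 ⊹ q+1 ⊗ q ⊗ conℕ 1) ⊹ conℕ 2 ⊗ (q ⊗ q) :≡
          conℕ 2 ⊗ (q ⊗ (p ⊗ p) ⊗ q+1) ⊹ ((q ⊗ q ⊗ conℕ 2 ⊹ q ⊗ p ⊗ conℕ 1) ⊹ conℕ 2 ⊗ (q+1 ⊗ (q ⊗ q)))) refl p)
        (cong (λ x → 2 ℕ.* (suc p ℕ.* (p ℕ.* p) ℕ.* suc (suc p)) ℕ.+ (x ℕ.+ 2 ℕ.* (suc (suc p) ℕ.* (suc p ℕ.* suc p)))) (sym e₂))))))
      where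
      extra = (2 ℕ.* k ℕ.+ 2 ℕ.* (suc p ℕ.* suc p)) ℕ.+ 2 ℕ.* (suc (suc p) ℕ.* (suc p ℕ.* suc p))

  ChordIn : V4 → Carrier × Carrier → Set
  ChordIn π (u , w) = Irr (u , w) × LineInPlane (chord u w) π

  -- The imaginary chords in π are to be removed from its free skew lines, so n = q² - dq + d(d -
  -- 1)/2 - i. The value of i depends on d and is found below.
  EnΓ-inPlane : ∀ {π d i} → ¬ ThroughAxis π → HasCount (On π) d → HasCount (ChordIn π) i →
    ∃ λ n → LinesIn IsEnΓLine π n × 2 ℕ.* (i ℕ.+ n) ℕ.+ 2 ℕ.* (d ℕ.* q) ≡ (q ℕ.* q) ℕ.* 2 ℕ.+ d ℕ.* (d ∸ 1) ℕ.* 1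
  EnΓ-inPlane {π} {d} {i} ¬axial hd hi =
    let u , free , eu = InPlaneCounts.count-skew-free π ¬axial {d} hd
        i′ , n , im , rest , split = count-split free ImaginarySkew?
        i′≡i = count-unique im imaginary
    in n , EnΓ-parametrisation {Z = λ L → LineInPlane L π} (count-cong
         {P = λ M → (SkewIn π M × Free M) × ¬ ImaginarySkew M}
         {Q = λ M → (LineInPlane (skewLine M) π × Free M) × ¬ ImaginarySkew M}
         (λ {M} ((s , f) , ¬i) → (~-inPlane {π = π} (~-sym (skewLine-~ M)) s , f) , ¬i)
         (λ {M} ((s , f) , ¬i) → (~-inPlane {π = π} (skewLine-~ M) s , f) , ¬i) rest) ,
       subst (λ u → 2 ℕ.* u ℕ.+ 2 ℕ.* (d ℕ.* q) ≡ (q ℕ.* q) ℕ.* 2 ℕ.+ d ℕ.* (d ∸ 1) ℕ.* 1)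
             (trans (sym split) (cong (ℕ._+ n) i′≡i)) eu
    where
    imaginary : HasCount (λ M → (SkewIn π M × Free M) × ImaginarySkew M) i
    imaginary = count-image {P = ChordIn π} {Q = λ M → (SkewIn π M × Free M) × ImaginarySkew M} chordMatrix hi
      (λ (i , _) (i′ , _) → chordMatrix-injective i i′)
      (λ {v} (i , l) → (~-inPlane {π = π} (~-sym (chordMatrix-~ (proj₁ v) (proj₂ v) i)) l ,
                        ImaginarySkew-free (chordMatrix v) (v , i , refl)) , v , i , refl)
      (λ {M} ((s , _) , v , i , e) → v , (i , ~-inPlane {π = π} (chordMatrix-~ (proj₁ v) (proj₂ v) i)
          (subst (SkewIn π) (sym e) s)) , e)

  divide : ∀ {x} → x ≢ 0# → ∀ y → ∃ λ z → x * z ≡ y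
  divide {x} x≢0 y = inv x≢0 * y , trans (sym (*-assoc x _ y)) (trans (cong (_* y) (inv-* x≢0)) (*-identityˡ y))

  -- A plane contains the chord of T² − uT − w iff this quadratic divides its binary cubic form;
  -- the cofactor is p₀ T + (p₁ + u p₀).
  module _ (p₀ p₁ p₂ p₃ : Carrier) where
    private
      π : V4
      π = p₀ , p₁ , p₂ , p₃

    On-∞ : On π nothing → p₀ ≡ 0#
    On-∞ z = trans (solve 4 (λ p₀ p₁ p₂ p₃ →
      p₀ := p₀ :* con 𝟙 :+ p₁ :* con 𝟘 :+ p₂ :* con 𝟘 :+ p₃ :* con 𝟘) refl p₀ p₁ p₂ p₃) z

    ∞-On : p₀ ≡ 0# → On π nothing
    ∞-On e = trans (solve 4 (λ p₀ p₁ p₂ p₃ →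
      p₀ :* con 𝟙 :+ p₁ :* con 𝟘 :+ p₂ :* con 𝟘 :+ p₃ :* con 𝟘 := p₀) refl p₀ p₁ p₂ p₃) e

    -- Division of the form by the quadratic leaves the remainder π(R) + T π(I), which is zero for a
    -- contained chord. The quadratic has no roots, so every root of the form is one of the
    -- cofactor.
    chordIn-cofactor : ∀ {u w} → ChordIn π (u , w) → ∀ b → On π b → p₀ * X b + (p₁ + u * p₀) * Y b ≡ 0#
    chordIn-cofactor {u} {w} _ nothing z = combine (1# ⊛ On-∞ z) (solve 3 (λ p₀ p₁ u →
      p₀ :* con 𝟙 :+ (p₁ :+ u :* p₀) :* con 𝟘 := con 𝟘 :+ con 𝟙 :* (p₀ :- con 𝟘)) refl p₀ p₁ u)
    chordIn-cofactor {u} {w} (irr , zR , zI) (just t) z = no-zero-divisors {t * t - (u * t + w)}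
      (combine (1# ⊛ z ⊞ (- 1#) ⊛ zR ⊞ (- t) ⊛ zI) (solve 7 (λ p₀ p₁ p₂ p₃ u w t →
        (t :* t :- (u :* t :+ w)) :* (p₀ :* t :+ (p₁ :+ u :* p₀) :* con 𝟙) := con 𝟘 :+
          (con 𝟙 :* (p₀ :* (t :* t :* t) :+ p₁ :* (t :* t) :+ p₂ :* t :+ p₃ :* con 𝟙 :- con 𝟘) :+
          ((:- con 𝟙) :* (p₀ :* (u :* w) :+ p₁ :* w :+ p₂ :* con 𝟘 :+ p₃ :* con 𝟙 :- con 𝟘) :+
           (:- t) :* (p₀ :* (u :* u :+ w) :+ p₁ :* u :+ p₂ :* con 𝟙 :+ p₃ :* con 𝟘 :- con 𝟘))))
        refl p₀ p₁ p₂ p₃ u w t))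
      (difference-≢0 (irr t))

    -- The leading coefficient of the linear cofactor is nonzero because P(∞) is off the plane, so
    -- the cofactor has a root, and this is a point of the cubic in the plane.
    no-chord-0 : (∀ b → ¬ On π b) → ∀ v → ¬ ChordIn π v
    no-chord-0 none (u , w) (irr , zR , zI) = let t , e = divide p₀≢0 (- (p₁ + u * p₀)) in none (just t) (root t e)
      where
      p₀≢0 : p₀ ≢ 0#
      p₀≢0 e = none nothing (∞-On e)
      root : ∀ t → p₀ * t ≡ - (p₁ + u * p₀) → On π (just t)
      root t e = combine ((t * t - (u * t + w)) ⊛ e ⊞ 1# ⊛ zR ⊞ t ⊛ zI) (solve 7 (λ p₀ p₁ p₂ p₃ u w t →
        p₀ :* (t :* t :* t) :+ p₁ :* (t :* t) :+ p₂ :* t :+ p₃ :* con 𝟙 := con 𝟘 :+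
          ((t :* t :- (u :* t :+ w)) :* (p₀ :* t :- (:- (p₁ :+ u :* p₀))) :+
          (con 𝟙 :* (p₀ :* (u :* w) :+ p₁ :* w :+ p₂ :* con 𝟘 :+ p₃ :* con 𝟙 :- con 𝟘) :+
           t :* (p₀ :* (u :* u :+ w) :+ p₁ :* u :+ p₂ :* con 𝟙 :+ p₃ :* con 𝟘 :- con 𝟘))))
        refl p₀ p₁ p₂ p₃ u w t)

    degenerate : ∀ {u w} → LineInPlane (chord u w) π → p₀ ≡ 0# → p₁ + u * p₀ ≡ 0# → ThroughAxis π
    degenerate {u} {w} (_ , zI) e₀ e₁ =
      combine (1# ⊛ e₁ ⊞ (- u) ⊛ e₀) (solve 3 (λ p₀ p₁ u → p₁ := con 𝟘 :+
        (con 𝟙 :* (p₁ :+ u :* p₀ :- con 𝟘) :+ (:- u) :* (p₀ :- con 𝟘))) refl p₀ p₁ u) ,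
      combine (1# ⊛ zI ⊞ (- u) ⊛ e₁ ⊞ (- w) ⊛ e₀) (solve 6 (λ p₀ p₁ p₂ p₃ u w → p₂ := con 𝟘 :+
        (con 𝟙 :* (p₀ :* (u :* u :+ w) :+ p₁ :* u :+ p₂ :* con 𝟙 :+ p₃ :* con 𝟘 :- con 𝟘) :+
        ((:- u) :* (p₁ :+ u :* p₀ :- con 𝟘) :+ (:- w) :* (p₀ :- con 𝟘)))) refl p₀ p₁ p₂ p₃ u w)

    -- A linear cofactor with two distinct roots vanishes identically, and by `degenerate` the plane
    -- then passes through the axis.
    no-chord-2 : ¬ ThroughAxis π → ∀ b b′ → b′ ≢ b → On π b → On π b′ → ∀ v → ¬ ChordIn π v
    no-chord-2 ¬axial b b′ ne z z′ (u , w) c = ¬axial (degenerate (proj₂ c)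
      (proj₁ (cramer-zero det≢0 (flip-* b (chordIn-cofactor c b z)) (flip-* b′ (chordIn-cofactor c b′ z′))))
      (proj₂ (cramer-zero det≢0 (flip-* b (chordIn-cofactor c b z)) (flip-* b′ (chordIn-cofactor c b′ z′)))))
      where
      det≢0 = det-≢0 {b} {b′} (ne ∘ sym)
      flip-* : ∀ b {x y} → x * X b + y * Y b ≡ 0# → X b * x + Y b * y ≡ 0#
      flip-* b {x} {y} e = trans (cong₂ _+_ (*-comm (X b) x) (*-comm (Y b) y)) e

    chordIn-root : ∀ {u w} → LineInPlane (chord u w) π → ∀ t → t * t ≡ u * t + w → On π (just t)
    chordIn-root {u} {w} (zR , zI) t e = combine ((p₀ * t + (p₁ + u * p₀)) ⊛ e ⊞ 1# ⊛ zR ⊞ t ⊛ zI) (solve 7 (λ p₀ p₁ p₂ p₃ u w t →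
      p₀ :* (t :* t :* t) :+ p₁ :* (t :* t) :+ p₂ :* t :+ p₃ :* con 𝟙 := con 𝟘 :+
        ((p₀ :* t :+ (p₁ :+ u :* p₀)) :* (t :* t :- (u :* t :+ w)) :+
        (con 𝟙 :* (p₀ :* (u :* w) :+ p₁ :* w :+ p₂ :* con 𝟘 :+ p₃ :* con 𝟙 :- con 𝟘) :+
         t :* (p₀ :* (u :* u :+ w) :+ p₁ :* u :+ p₂ :* con 𝟙 :+ p₃ :* con 𝟘 :- con 𝟘))))
      refl p₀ p₁ p₂ p₃ u w t)

    -- With the root at infinity taken off, the form is p₁T² + p₂T + p₃; made monic, this is the
    -- only candidate, and it is irreducible because the form has no finite root.
    one-chord-∞ : p₀ ≡ 0# → p₁ ≢ 0# → (∀ t → ¬ On π (just t)) → HasCount (ChordIn π) 1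
    one-chord-∞ p₀≡0 p₁≢0 none =
      let u , eu = divide p₁≢0 (- p₂) ; w , ew = divide p₁≢0 (- p₃) in
      count-one {P = ChordIn π} (u , w) (member u w eu ew) (λ {(u′ , w′)} c → unique u w eu ew u′ w′ c)
      where
      lies : ∀ u w → p₁ * u ≡ - p₂ → p₁ * w ≡ - p₃ → LineInPlane (chord u w) π
      lies u w eu ew =
        combine ((u * w) ⊛ p₀≡0 ⊞ 1# ⊛ ew) (solve 6 (λ p₀ p₁ p₂ p₃ u w →
          p₀ :* (u :* w) :+ p₁ :* w :+ p₂ :* con 𝟘 :+ p₃ :* con 𝟙 := con 𝟘 :+
          (u :* w :* (p₀ :- con 𝟘) :+ con 𝟙 :* (p₁ :* w :- (:- p₃)))) refl p₀ p₁ p₂ p₃ u w) ,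
        combine ((u * u + w) ⊛ p₀≡0 ⊞ 1# ⊛ eu) (solve 6 (λ p₀ p₁ p₂ p₃ u w →
          p₀ :* (u :* u :+ w) :+ p₁ :* u :+ p₂ :* con 𝟙 :+ p₃ :* con 𝟘 := con 𝟘 :+
          ((u :* u :+ w) :* (p₀ :- con 𝟘) :+ con 𝟙 :* (p₁ :* u :- (:- p₂)))) refl p₀ p₁ p₂ p₃ u w)
      member : ∀ u w → p₁ * u ≡ - p₂ → p₁ * w ≡ - p₃ → ChordIn π (u , w)
      member u w eu ew = (λ t e → none t (chordIn-root {u} {w} (lies u w eu ew) t e)) , lies u w eu ew
      unique : ∀ u w → p₁ * u ≡ - p₂ → p₁ * w ≡ - p₃ → ∀ u′ w′ → ChordIn π (u′ , w′) → (u′ , w′) ≡ (u , w)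
      unique u w eu ew u′ w′ (_ , zR′ , zI′) = cong₂ _,_
        (*-cancelˡ p₁≢0 (combine (1# ⊛ zI′ ⊞ (- (u′ * u′ + w′)) ⊛ p₀≡0 ⊞ (- 1#) ⊛ eu) (solve 7 (λ p₀ p₁ p₂ p₃ u u′ w′ →
          p₁ :* u′ := p₁ :* u :+ (con 𝟙 :* (p₀ :* (u′ :* u′ :+ w′) :+ p₁ :* u′ :+ p₂ :* con 𝟙 :+ p₃ :* con 𝟘 :- con 𝟘) :+
          ((:- (u′ :* u′ :+ w′)) :* (p₀ :- con 𝟘) :+ (:- con 𝟙) :* (p₁ :* u :- (:- p₂))))) refl p₀ p₁ p₂ p₃ u u′ w′)))
        (*-cancelˡ p₁≢0 (combine (1# ⊛ zR′ ⊞ (- (u′ * w′)) ⊛ p₀≡0 ⊞ (- 1#) ⊛ ew) (solve 7 (λ p₀ p₁ p₂ p₃ w u′ w′ →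
          p₁ :* w′ := p₁ :* w :+ (con 𝟙 :* (p₀ :* (u′ :* w′) :+ p₁ :* w′ :+ p₂ :* con 𝟘 :+ p₃ :* con 𝟙 :- con 𝟘) :+
          ((:- (u′ :* w′)) :* (p₀ :- con 𝟘) :+ (:- con 𝟙) :* (p₁ :* w :- (:- p₃))))) refl p₀ p₁ p₂ p₃ w u′ w′)))

    -- The quadratic is the form divided by T - t and made monic: p₀u = -p₀t - p₁ and p₀w = -(p₀t² +
    -- p₁t + p₂), the latter rewritten by means of u.
    one-chord-finite : ¬ ThroughAxis π → p₀ ≢ 0# → ∀ t → On π (just t) → (∀ s → On π (just s) → s ≡ t) →
      HasCount (ChordIn π) 1
    one-chord-finite ¬axial p₀≢0 t z only =
      let u , eu = divide p₀≢0 (- (p₀ * t) - p₁) ; w , ew = divide p₀≢0 (p₀ * u * t - p₂) in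
      count-one {P = ChordIn π} (u , w) (member u w eu ew) (λ {(u′ , w′)} c → unique u w eu ew u′ w′ c)
      where
      lies : ∀ u w → p₀ * u ≡ - (p₀ * t) - p₁ → p₀ * w ≡ p₀ * u * t - p₂ → LineInPlane (chord u w) π
      lies u w eu ew =
        combine (1# ⊛ z ⊞ (w - t * t) ⊛ eu ⊞ (- t) ⊛ ew) (solve 7 (λ p₀ p₁ p₂ p₃ u w t →
          p₀ :* (u :* w) :+ p₁ :* w :+ p₂ :* con 𝟘 :+ p₃ :* con 𝟙 := con 𝟘 :+
          (con 𝟙 :* (p₀ :* (t :* t :* t) :+ p₁ :* (t :* t) :+ p₂ :* t :+ p₃ :* con 𝟙 :- con 𝟘) :+
          ((w :- t :* t) :* (p₀ :* u :- (:- (p₀ :* t) :- p₁)) :+ (:- t) :* (p₀ :* w :- (p₀ :* u :* t :- p₂)))))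
          refl p₀ p₁ p₂ p₃ u w t) ,
        combine (u ⊛ eu ⊞ 1# ⊛ ew) (solve 7 (λ p₀ p₁ p₂ p₃ u w t →
          p₀ :* (u :* u :+ w) :+ p₁ :* u :+ p₂ :* con 𝟙 :+ p₃ :* con 𝟘 := con 𝟘 :+
          (u :* (p₀ :* u :- (:- (p₀ :* t) :- p₁)) :+ con 𝟙 :* (p₀ :* w :- (p₀ :* u :* t :- p₂))))
          refl p₀ p₁ p₂ p₃ u w t)
      -- A root s, and then also the root u − s, would be t, so u = 2t = − t and the form would be p₀ (T − t)³ = p₀ (T³ − t³).
      irreducible : ∀ u w → p₀ * u ≡ - (p₀ * t) - p₁ → p₀ * w ≡ p₀ * u * t - p₂ → Irreducible u w
      irreducible u w eu ew s e = ¬axial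
        (combine (1# ⊛ eu ⊞ p₀ ⊛ u≡) (solve 4 (λ p₀ p₁ u t → p₁ := con 𝟘 :+
          (con 𝟙 :* (p₀ :* u :- (:- (p₀ :* t) :- p₁)) :+ p₀ :* (:- t :- u))) refl p₀ p₁ u t) ,
         combine (1# ⊛ ew ⊞ p₀ ⊛ w≡ ⊞ (- (p₀ * t)) ⊛ u≡) (solve 5 (λ p₀ p₂ u w t → p₂ := con 𝟘 :+
          (con 𝟙 :* (p₀ :* w :- (p₀ :* u :* t :- p₂)) :+ (p₀ :* (t :* t :+ t :* t :- w) :+
           (:- (p₀ :* t)) :* (:- t :- u)))) refl p₀ p₂ u w t))
        where
        is-t : ∀ s → s * s ≡ u * s + w → s ≡ t
        is-t s e = only s (chordIn-root {u} {w} (lies u w eu ew) s e)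
        s≡t : s ≡ t
        s≡t = is-t s e
        u-s≡t : u - s ≡ t
        u-s≡t = is-t (u - s) (combine (1# ⊛ e) (solve 3 (λ u w s → (u :- s) :* (u :- s) := u :* (u :- s) :+ w :+
          con 𝟙 :* (s :* s :- (u :* s :+ w))) refl u w s))
        u≡ : - t ≡ u
        u≡ = combine ((- 1#) ⊛ u-s≡t ⊞ (- 1#) ⊛ s≡t) (solve 3 (λ u s t → :- t := u :+
          ((:- con 𝟙) :* (u :- s :- t) :+ (:- con 𝟙) :* (s :- t))) refl u s t)
        w≡ : t * t + t * t ≡ w
        w≡ = combine (1# ⊛ e ⊞ (- (s + t + t)) ⊛ s≡t ⊞ (- s) ⊛ u≡) (solve 4 (λ u w s t → t :* t :+ t :* t := w :+
          (con 𝟙 :* (s :* s :- (u :* s :+ w)) :+ ((:- (s :+ t :+ t)) :* (s :- t) :+ (:- s) :* (:- t :- u)))) refl u w s t)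
      member : ∀ u w → p₀ * u ≡ - (p₀ * t) - p₁ → p₀ * w ≡ p₀ * u * t - p₂ → ChordIn π (u , w)
      member u w eu ew = irreducible u w eu ew , lies u w eu ew
      unique : ∀ u w → p₀ * u ≡ - (p₀ * t) - p₁ → p₀ * w ≡ p₀ * u * t - p₂ →
        ∀ u′ w′ → ChordIn π (u′ , w′) → (u′ , w′) ≡ (u , w)
      unique u w eu ew u′ w′ c@(_ , zR′ , zI′) = cong₂ _,_ u′≡u (*-cancelˡ p₀≢0
        (combine (1# ⊛ zI′ ⊞ (- u′) ⊛ cofactor ⊞ (- 1#) ⊛ ew ⊞ (p₀ * t) ⊛ u′≡u) (solve 9 (λ p₀ p₁ p₂ p₃ u w t u′ w′ →
          p₀ :* w′ := p₀ :* w :+ (con 𝟙 :* (p₀ :* (u′ :* u′ :+ w′) :+ p₁ :* u′ :+ p₂ :* con 𝟙 :+ p₃ :* con 𝟘 :- con 𝟘) :+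
          ((:- u′) :* (p₀ :* t :+ (p₁ :+ u′ :* p₀) :* con 𝟙 :- con 𝟘) :+
          ((:- con 𝟙) :* (p₀ :* w :- (p₀ :* u :* t :- p₂)) :+ p₀ :* t :* (u′ :- u))))) refl p₀ p₁ p₂ p₃ u w t u′ w′)))
        where
        cofactor : p₀ * t + (p₁ + u′ * p₀) * 1# ≡ 0#
        cofactor = chordIn-cofactor {u′} {w′} c (just t) z
        u′≡u : u′ ≡ u
        u′≡u = *-cancelˡ p₀≢0 (combine (1# ⊛ cofactor ⊞ (- 1#) ⊛ eu) (solve 5 (λ p₀ p₁ t u u′ → p₀ :* u′ := p₀ :* u :+
          (con 𝟙 :* (p₀ :* t :+ (p₁ :+ u′ :* p₀) :* con 𝟙 :- con 𝟘) :+ (:- con 𝟙) :* (p₀ :* u :- (:- (p₀ :* t) :- p₁)))) refl p₀ p₁ t u u′))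

    one-chord : ¬ ThroughAxis π → ∀ b → On π b → (∀ b′ → On π b′ → b′ ≡ b) → HasCount (ChordIn π) 1
    one-chord ¬axial nothing z only = one-chord-∞ p₀≡0 p₁≢0 none
      where
      p₀≡0 : p₀ ≡ 0#
      p₀≡0 = On-∞ z
      none : ∀ t → ¬ On π (just t)
      none t z = contradiction (only (just t) z) λ ()
      -- Otherwise the form is p₂T + p₃, which has a finite root unless p₂ = 0; but then the plane
      -- passes through the axis.
      p₁≢0 : p₁ ≢ 0#
      p₁≢0 p₁≡0 = ¬axial (p₁≡0 , decidable-stable (p₂ ≟ 0#) λ p₂≢0 →
        let t , et = divide p₂≢0 (- p₃) in none t (linear t et))
        where
        linear : ∀ t → p₂ * t ≡ - p₃ → On π (just t)
        linear t e = combine ((t * t * t) ⊛ p₀≡0 ⊞ (t * t) ⊛ p₁≡0 ⊞ 1# ⊛ e) (solve 5 (λ p₀ p₁ p₂ p₃ t →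
          p₀ :* (t :* t :* t) :+ p₁ :* (t :* t) :+ p₂ :* t :+ p₃ :* con 𝟙 := con 𝟘 :+
          (t :* t :* t :* (p₀ :- con 𝟘) :+ (t :* t :* (p₁ :- con 𝟘) :+ con 𝟙 :* (p₂ :* t :- (:- p₃)))))
          refl p₀ p₁ p₂ p₃ t)
    one-chord ¬axial (just t) z only = one-chord-finite ¬axial
      (λ p₀≡0 → contradiction (only nothing (∞-On p₀≡0)) λ ()) t z (λ s o → Maybeₚ.just-injective (only (just s) o))

-- EA-lines

module EALines (F : FiniteField) (3≡0 : Characteristic-3 F)
  (p : ℕ) (q≡1+p : FiniteField.q F ≡ suc p) (1≤p : 1 ℕ.≤ p) where
  open Geometry F
  open EnΓLines F 3≡0 p q≡1+p 1≤p public

  -- Points of the axis, and a complementary direction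

  axisPoint : ℙ¹ → V4
  axisPoint α = 0# , Y α , X α , 0#

  S₁ S₂ : ℙ¹ → Carrier
  S₁ nothing = 1#
  S₁ (just _) = 0#
  S₂ nothing = 0#
  S₂ (just _) = 1#

  complementary : ∀ α → S₁ α * X α - S₂ α * Y α ≢ 0#
  complementary nothing e = 1≢0 (trans (solve 0 (con 𝟙 := con 𝟙 :* con 𝟙 :- con 𝟘 :* con 𝟘) refl) e)
  complementary (just y) e = 1≢0 (combine ((- 1#) ⊛ e)
    (solve 1 (λ y → con 𝟙 := con 𝟘 :+ (:- con 𝟙) :* (con 𝟘 :* y :- con 𝟙 :* con 𝟙 :- con 𝟘)) refl y))

  complement-zero : ∀ α {k n} → k * S₁ α + n * Y α ≡ 0# → k * S₂ α + n * X α ≡ 0# → k ≡ 0#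
  complement-zero α {k} {n} e e′ = proj₁ (cramer-zero {S₁ α} {Y α} {S₂ α} {X α} {k} {n}
    (λ z → complementary α (trans (solve 4 (λ a b c d → a :* d :- c :* b := a :* d :- b :* c) refl (S₁ α) (Y α) (S₂ α) (X α)) z))
    (trans (cong₂ _+_ (*-comm (S₁ α) k) (*-comm (Y α) n)) e) (trans (cong₂ _+_ (*-comm (S₂ α) k) (*-comm (X α) n)) e′))

  decompose : ∀ α e₁ e₂ → ∃₂ λ k n → e₁ ≡ k * S₁ α + n * Y α × e₂ ≡ k * S₂ α + n * X α
  decompose nothing e₁ e₂ = e₁ , e₂ ,
    solve 2 (λ a b → a := a :* con 𝟙 :+ b :* con 𝟘) refl e₁ e₂ , solve 2 (λ a b → b := a :* con 𝟘 :+ b :* con 𝟙) refl e₁ e₂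
  decompose (just y) e₁ e₂ = e₂ - e₁ * y , e₁ ,
    solve 3 (λ a b y → a := (b :- a :* y) :* con 𝟘 :+ a :* con 𝟙) refl e₁ e₂ y ,
    solve 3 (λ a b y → b := (b :- a :* y) :* con 𝟙 :+ a :* y) refl e₁ e₂ y

  X∨Y : ∀ α → X α ≢ 0# ⊎ Y α ≢ 0#
  X∨Y nothing = inj₁ 1≢0
  X∨Y (just _) = inj₂ 1≢0

  axisPoint-≢0 : ∀ α → (Y α , X α , 0#) ≢ (0# , 0# , 0#)
  axisPoint-≢0 α e with X∨Y α
  ... | inj₁ x≢0 = x≢0 (cong (proj₁ ∘ proj₂) e)
  ... | inj₂ y≢0 = y≢0 (cong proj₁ e)

  -- Index (b , α , k): the line joining the axis point α to the translate by k of the point b of the cubic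

  Index : Set
  Index = ℙ¹ × ℙ¹ × Carrier

  translate : Index → V4
  translate (b , α , k) = X b * X b * X b , X b * X b * Y b + k * S₁ α , X b * Y b * Y b + k * S₂ α , Y b * Y b * Y b

  eaBasis : Index → Line
  eaBasis i@(_ , α , _) = translate i , axisPoint α

  cubes-cancel : ∀ b {m} → m * (X b * X b * X b) ≡ 0# → m * (Y b * Y b * Y b) ≡ 0# → m ≡ 0#
  cubes-cancel b {m} ex ey with cubes-≢0 b
  ... | inj₁ x≢0 = no-zero-divisors (trans (*-comm _ m) ex) x≢0
  ... | inj₂ y≢0 = no-zero-divisors (trans (*-comm _ m) ey) y≢0

  -- The Γ-plane through a point off the axis is given by the ratio of x₀ to x₃, and a ratio of
  -- cubes determines the ratio of the roots; so a Γ-plane determines its point of the cubic.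
  proportional-cubes : ∀ {b b′ m} → X b′ * X b′ * X b′ ≡ m * (X b * X b * X b) →
    Y b′ * Y b′ * Y b′ ≡ m * (Y b * Y b * Y b) → b′ ≡ b × m ≡ 1#
  proportional-cubes {b} {b′} {m} ex ey = b′≡b , m≡1 (subst (λ c → X c * X c * X c ≡ _) b′≡b ex) (subst (λ c → Y c * Y c * Y c ≡ _) b′≡b ey)
    where
    b′≡b : b′ ≡ b
    b′≡b = decidable-stable (Finite._≟_ finiteℙ¹ b′ b) λ ne → let d≢0 = det-≢0 {b′} {b} ne in
      *-nonzero d≢0 (*-nonzero d≢0 d≢0) (combine ((Y b * Y b * Y b) ⊛ ex ⊞ (- (X b * X b * X b)) ⊛ ey)
        (solve 5 (λ x y x′ y′ m → (x′ :* y :- y′ :* x) :* ((x′ :* y :- y′ :* x) :* (x′ :* y :- y′ :* x)) := con 𝟘 :+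
          (y :* y :* y :* (x′ :* x′ :* x′ :- m :* (x :* x :* x)) :+ (:- (x :* x :* x)) :* (y′ :* y′ :* y′ :- m :* (y :* y :* y))))
          refl (X b) (Y b) (X b′) (Y b′) m))
    m≡1 : X b * X b * X b ≡ m * (X b * X b * X b) → Y b * Y b * Y b ≡ m * (Y b * Y b * Y b) → m ≡ 1#
    m≡1 ex ey = combine (1# ⊛ cubes-cancel b {m - 1#} (vanish ex) (vanish ey))
      (solve 1 (λ m → m := con 𝟙 :+ con 𝟙 :* (m :- con 𝟙 :- con 𝟘)) refl m)
      where
      vanish : ∀ {x} → x ≡ m * x → (m - 1#) * x ≡ 0#
      vanish {x} e = combine ((- 1#) ⊛ e) (solve 2 (λ m x → (m :- con 𝟙) :* x := con 𝟘 :+ (:- con 𝟙) :* (x :- m :* x)) refl m x)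

  private
    +0 : ∀ m n x → m * x + n * 0# ≡ m * x
    +0 = solve 3 (λ m n x → m :* x :+ n :* con 𝟘 := m :* x) refl

  -- Beyond injectivity of the parametrisation, the case k′ = 0 shows that a line with k nonzero
  -- carries no point of the cubic.
  same-translate : ∀ {b b′ α k k′} → OnLine (eaBasis (b , α , k)) (translate (b′ , α , k′)) → b′ ≡ b × k′ ≡ k
  same-translate {b} {b′} {α} {k} {k′} (m , n , e) =
    let b′≡b , m≡1 = proportional-cubes {b} {b′} (trans (cong proj₁ e) (+0 m n _)) (trans (cong (proj₂ ∘ proj₂ ∘ proj₂) e) (+0 m n _))
    in b′≡b , finish b′≡b m≡1 e
    where
    finish : b′ ≡ b → m ≡ 1# → translate (b′ , α , k′) ≡ (m • translate (b , α , k)) ⊕ (n • axisPoint α) → k′ ≡ k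
    finish refl refl e = combine (1# ⊛ complement-zero α {k′ - k} {(- n)} (shift _ _ _ (cong (proj₁ ∘ proj₂) e)) (shift _ _ _
        (cong (proj₁ ∘ proj₂ ∘ proj₂) e)))
      (solve 2 (λ k k′ → k′ := k :+ con 𝟙 :* (k′ :- k :- con 𝟘)) refl k k′)
      where
      shift : ∀ c s y → c + k′ * s ≡ 1# * (c + k * s) + n * y → (k′ - k) * s + (- n) * y ≡ 0#
      shift c s y e = combine (1# ⊛ e) (solve 6 (λ c s y k k′ n → (k′ :- k) :* s :+ (:- n) :* y := con 𝟘 :+
        con 𝟙 :* (c :+ k′ :* s :- (con 𝟙 :* (c :+ k :* s) :+ n :* y))) refl c s y k k′ n)

  same-axisPoint : ∀ {b α k α′} → OnLine (eaBasis (b , α , k)) (axisPoint α′) → α′ ≡ α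
  same-axisPoint {b} {α} {k} {α′} (m , n , e) with
    refl ← cubes-cancel b (sym (trans (cong proj₁ e) (+0 m n _))) (sym (trans (cong (proj₂ ∘ proj₂ ∘ proj₂) e) (+0 m n _)))
    = decidable-stable (Finite._≟_ finiteℙ¹ α′ α) λ ne → det-≢0 {α′} {α} ne
      (combine ((- X α) ⊛ cong (proj₁ ∘ proj₂) e ⊞ Y α ⊛ cong (proj₁ ∘ proj₂ ∘ proj₂) e)
        (solve 7 (λ x y x′ y′ n r s → x′ :* y :- y′ :* x := con 𝟘 :+
          ((:- x) :* (y′ :- (con 𝟘 :* r :+ n :* y)) :+ y :* (x′ :- (con 𝟘 :* s :+ n :* x))))
          refl (X α) (Y α) (X α′) (Y α′) n (X b * X b * Y b + k * S₁ α) (X b * Y b * Y b + k * S₂ α)))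

  eaBasis-injective : ∀ i j → eaBasis i ~ eaBasis j → i ≡ j
  eaBasis-injective (b , α , k) (b′ , α′ , k′) ((u∈ , a∈) , _) = finish (same-axisPoint {b} {α} {k} {α′} a∈) u∈
    where
    finish : α′ ≡ α → OnLine (eaBasis (b , α , k)) (translate (b′ , α′ , k′)) → (b , α , k) ≡ (b′ , α′ , k′)
    finish refl u∈ = let b≡ , k≡ = same-translate {b} {b′} {α} u∈ in cong₂ (λ b k → b , α , k) (sym b≡) (sym k≡)

  reduce′ : ∀ d a b c x y z → d ≢ 0# → (x , y , z) ≢ (0# , 0# , 0#) →
    ∃ λ L → IsLine L × L ~ ((d , a , b , c) , (0# , x , y , z))
  reduce′ d a b c x y z d≢0 ≢0 =
    let i = inv d≢0
        L , isLine , L~ = reduce (i * a) (i * b) (i * c) x y z ≢0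
    in L , isLine , ~-trans L~ (~-sym (~-trans (~-scaleˡ (inv-≢0 d≢0) (d , a , b , c) (0# , x , y , z))
         (≡⇒~ (cong (_, (0# , x , y , z)) (vector-≡ (trans (*-comm i d) (inv-* d≢0)) refl refl refl)))))

  -- The Γ-plane x₀ = 0, where the point of the cubic is (0 , 0 , 0 , 1)
  private
    reduce-0 : ∀ α k → k ≢ 0# → ∃ λ L → IsLine L × L ~ ((0# , k * S₁ α , k * S₂ α , 1#) , axisPoint α)
    reduce-0 nothing k k≢0 = let i = inv k≢0 ; u = 0# , k * 1# , k * 0# , 1# ; v = 0# , 0# , 1# , 0# in
      _ , inj₂ (inj₂ (inj₂ (inj₁ (i * 1# , 0# , vector-≡ (zeroʳ i) i*k
          (solve 2 (λ i k → i :* (k :* con 𝟘) := con 𝟘) refl i k) refl , refl)))) ,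
      ~-sym (~-scaleˡ (inv-≢0 k≢0) u v)
      where
      i*k : inv k≢0 * (k * 1#) ≡ 1#
      i*k = trans (cong (inv k≢0 *_) (*-identityʳ k)) (trans (*-comm _ k) (inv-* k≢0))
    reduce-0 (just y) k k≢0 = let i = inv k≢0 ; u = 0# , k * 0# , k * 1# , 1# ; v = 0# , 1# , y , 0# in
      _ , inj₂ (inj₂ (inj₂ (inj₁ (_ , _ ,
        vector-≡ (solve 2 (λ i y → con 𝟘 :+ :- y :* (i :* con 𝟘) := con 𝟘) refl i y)
                 (solve 3 (λ i y k → con 𝟙 :+ :- y :* (i :* (k :* con 𝟘)) := con 𝟙) refl i y k)
                 (combine ((- y) ⊛ inv-* k≢0) (solve 3
                     (λ i y k → y :+ :- y :* (i :* (k :* con 𝟙)) := con 𝟘 :+ (:- y) :* (k :* i :- con 𝟙)) refl i y k)) refl ,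
        vector-≡ (zeroʳ i) (solve 2 (λ i k → i :* (k :* con 𝟘) := con 𝟘) refl i k) i*k refl)))) ,
      ~-sym (~-trans (~-swap u v) (~-trans (~-scaleʳ (inv-≢0 k≢0) v u) (~-addˡ (- y) v (i • u))))
      where
      i*k : inv k≢0 * (k * 1#) ≡ 1#
      i*k = trans (cong (inv k≢0 *_) (*-identityʳ k)) (trans (*-comm _ k) (inv-* k≢0))

    reduced : ∀ i → proj₂ (proj₂ i) ≢ 0# → ∃ λ L → IsLine L × L ~ eaBasis i
    reduced (nothing , α , k) k≢0 = reduce′ _ _ _ _ (Y α) (X α) 0# (*-nonzero (*-nonzero 1≢0 1≢0) 1≢0) (axisPoint-≢0 α)
    reduced (just t , α , k) k≢0 with t ≟ 0#
    ... | no t≢0 = reduce′ _ _ _ _ (Y α) (X α) 0# (*-nonzero (*-nonzero t≢0 t≢0) t≢0) (axisPoint-≢0 α)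
    ... | yes refl = let L , isLine , L~ = reduce-0 α k k≢0 in L , isLine , ~-trans L~ (≡⇒~ (cong (_, axisPoint α) (vector-≡
      (solve 0 (con 𝟘 := con 𝟘 :* con 𝟘 :* con 𝟘) refl)
      (solve 1 (λ s → s := con 𝟘 :* con 𝟘 :* con 𝟙 :+ s) refl (k * S₁ α))
      (solve 1 (λ s → s := con 𝟘 :* con 𝟙 :* con 𝟙 :+ s) refl (k * S₂ α))
      (solve 0 (con 𝟙 := con 𝟙 :* con 𝟙 :* con 𝟙) refl))))

  Proper : Index → Set
  Proper (_ , _ , k) = k ≢ 0#

  -- Junk value outside Proper.
  eaLine : Index → Line
  eaLine i with proj₂ (proj₂ i) ≟ 0#
  ... | yes _ = 0⃗ , 0⃗
  ... | no k≢0 = proj₁ (reduced i k≢0)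

  eaLine-isLine : ∀ i → Proper i → IsLine (eaLine i)
  eaLine-isLine i k≢0 with proj₂ (proj₂ i) ≟ 0#
  ... | yes k≡0 = contradiction k≡0 k≢0
  ... | no k≢0 = proj₁ (proj₂ (reduced i k≢0))

  eaLine-~ : ∀ i → Proper i → eaLine i ~ eaBasis i
  eaLine-~ i k≢0 with proj₂ (proj₂ i) ≟ 0#
  ... | yes k≡0 = contradiction k≡0 k≢0
  ... | no k≢0 = proj₂ (proj₂ (reduced i k≢0))

  Axial : V4 → Set
  Axial (x₀ , _ , _ , x₃) = x₀ ≡ 0# × x₃ ≡ 0#

  OnAxis⇒axial : ∀ {x} → OnAxis x → Axial x
  OnAxis⇒axial {x₀ , x₁ , x₂ , x₃} on =
    trans (solve 4 (λ a b c d → a := con 𝟙 :* a :+ con 𝟘 :* b :+ con 𝟘 :* c :+ con 𝟘 :* d) refl x₀ x₁ x₂ x₃)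
          (on (axisPlane nothing) (axisPlane-isPlane nothing) (axisPlane-Γ nothing)) ,
    trans (solve 4 (λ a b c d → d := con 𝟘 :* a :+ con 𝟘 :* b :+ con 𝟘 :* c :+ con 𝟙 :* d) refl x₀ x₁ x₂ x₃)
          (on (axisPlane (just 0#)) (axisPlane-isPlane (just 0#)) (axisPlane-Γ (just 0#)))

  axial⇒OnAxis : ∀ {x} → Axial x → OnAxis x
  axial⇒OnAxis {x₀ , x₁ , x₂ , x₃} (e₀ , e₃) π@(p₀ , p₁ , p₂ , p₃) _ γ = let e₁ , e₂ = Γ⇒throughAxis γ in
    combine ((p₀ ⊛ e₀ ⊞ p₃ ⊛ e₃) ⊞ x₁ ⊛ e₁ ⊞ x₂ ⊛ e₂) (solve 8 (λ p₀ p₁ p₂ p₃ x₀ x₁ x₂ x₃ →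
      p₀ :* x₀ :+ p₁ :* x₁ :+ p₂ :* x₂ :+ p₃ :* x₃ := con 𝟘 :+
      ((p₀ :* (x₀ :- con 𝟘) :+ p₃ :* (x₃ :- con 𝟘)) :+ (x₁ :* (p₁ :- con 𝟘) :+ x₂ :* (p₂ :- con 𝟘)))) refl p₀ p₁ p₂ p₃ x₀ x₁ x₂ x₃)

  normalize-on : ∀ {L} x → x ≢ 0⃗ → OnLine L x → ∃₂ λ k w → k ≢ 0# × IsPoint w × OnLine L w × k • w ≡ x
  normalize-on {L} x x≢0 on =
    let k , w , k≢0 , n , e = normalize x x≢0
        i = inv k≢0
        w≡ : i • x ≡ w
        w≡ = trans (cong (i •_) (sym e)) (trans (•-• i k w) (trans (cong (_• w) (trans (*-comm i k) (inv-* k≢0))) (1• w)))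
    in k , w , k≢0 , n , subst (OnLine L) w≡ (span-• i on) , e

  proper⇒EA : ∀ i → Proper i → IsEALine (eaLine i)
  proper⇒EA i@(b , α , k) k≢0 = eaLine-isLine i k≢0 , no-C , not-axis , meets-axis
    where
    no-C : NoCPoint (eaLine i)
    no-C x _ on c =
      let b′ , e = OnC-pt c
          -- A point of the cubic is its own translate by 0, which `same-translate` compares with
          -- the translate by k.
          on′ : OnLine (eaBasis i) (translate (b′ , α , 0#))
          on′ = subst (OnLine (eaBasis i)) (trans (sym e) (trans (pt-cubic b′) (vector-≡ refl (sym (+0*0 _ _)) (sym (+0*0 _ _)) refl)))
                  (~-on (eaLine-~ i k≢0) on)
          b′≡b , 0≡k = same-translate {b} {b′} {α} on′
      in k≢0 (sym 0≡k)
      where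
      +0*0 : ∀ x s → x + 0# * s ≡ x
      +0*0 = solve 2 (λ x s → x :+ con 𝟘 :* s := x) refl
    not-axis : ¬ IsAxis (eaLine i)
    not-axis axis =
      let u = translate i
          u-on = ~-on (~-sym (eaLine-~ i k≢0)) (left-∈ u (axisPoint α))
          u≢0 : u ≢ 0⃗
          u≢0 e = [ (λ x≢0 → x≢0 (cong proj₁ e)) , (λ y≢0 → y≢0 (cong (proj₂ ∘ proj₂ ∘ proj₂) e)) ]′ (cubes-≢0 b)
          c , w , _ , n , w-on , e = normalize-on {eaLine i} u u≢0 u-on
          w₀ , w₃ = OnAxis⇒axial (Equivalence.to (axis w n) w-on)
      in [ (λ x≢0 → x≢0 (trans (sym (cong proj₁ e)) (trans (cong (c *_) w₀) (zeroʳ c))))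
         , (λ y≢0 → y≢0 (trans (sym (cong (proj₂ ∘ proj₂ ∘ proj₂) e)) (trans (cong (c *_) w₃) (zeroʳ c)))) ]′ (cubes-≢0 b)
    meets-axis : ∃ λ x → IsPoint x × OnLine (eaLine i) x × OnAxis x
    meets-axis =
      let a = axisPoint α
          a-on = ~-on (~-sym (eaLine-~ i k≢0)) (right-∈ (translate i) a)
          c , w , c≢0 , n , w-on , e = normalize-on {eaLine i} a (λ e → axisPoint-≢0 α (cong₂
              (λ y x → y , x , 0#) (cong (proj₁ ∘ proj₂) e) (cong (proj₁ ∘ proj₂ ∘ proj₂) e))) a-on
      in w , n , w-on , axial⇒OnAxis (no-zero-divisors (cong proj₁ e) c≢0 , no-zero-divisors (cong (proj₂ ∘ proj₂ ∘ proj₂) e) c≢0)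

  axial⇒axisPoint : ∀ x → x ≢ 0⃗ → Axial x → ∃₂ λ α c → c ≢ 0# × x ≡ c • axisPoint α
  axial⇒axisPoint (x₀ , x₁ , x₂ , x₃) x≢0 (refl , refl) with x₁ ≟ 0#
  ... | no x₁≢0 = let y , e = divide x₁≢0 x₂ in
    just y , x₁ , x₁≢0 , vector-≡ (sym (zeroʳ x₁)) (sym (*-identityʳ x₁)) (sym e) (sym (zeroʳ x₁))
  ... | yes refl = nothing , x₂ , (λ { refl → x≢0 refl }) ,
    vector-≡ (sym (zeroʳ x₂)) (sym (zeroʳ x₂)) (sym (*-identityʳ x₂)) (sym (zeroʳ x₂))

  -- Scaling makes the outer coordinates of a point off the axis a pair of cubes, by surjectivity of
  -- cubing; b is then the point of the cubic in the same Γ-plane.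
  common-cubes : ∀ z₀ z₃ → ¬ (z₀ ≡ 0# × z₃ ≡ 0#) → ∃₂ λ b c → c ≢ 0# × c * z₀ ≡ X b * X b * X b × c * z₃ ≡ Y b * Y b * Y b
  common-cubes z₀ z₃ ≢0 with z₃ ≟ 0#
  ... | yes refl = let z₀≢0 = λ e → ≢0 (e , refl) in nothing , inv z₀≢0 , inv-≢0 z₀≢0 ,
    trans (*-comm _ z₀) (trans (inv-* z₀≢0) (solve 0 (con 𝟙 := con 𝟙 :* con 𝟙 :* con 𝟙) refl)) ,
    solve 1 (λ i → i :* con 𝟘 := con 𝟘 :* con 𝟘 :* con 𝟘) refl (inv z₀≢0)
  ... | no z₃≢0 = let t , e = cube-root (inv z₃≢0 * z₀) in just t , inv z₃≢0 , inv-≢0 z₃≢0 , sym e ,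
    trans (*-comm _ z₃) (trans (inv-* z₃≢0) (solve 0 (con 𝟙 := con 𝟙 :* con 𝟙 :* con 𝟙) refl))

  -- Replace the basis z, r by c z + n a, a, where a = s z + t r is the axis point.
  spanned : ∀ z r x → ¬ Axial z → Axial x → x ≢ 0⃗ → InSpan z r x → ∃ λ i → (z , r) ~ eaBasis i
  spanned z@(z₀ , z₁ , z₂ , z₃) r@(r₀ , r₁ , r₂ , r₃) x ¬axial axial x≢0 x∈ =
    let α , d , d≢0 , x≡ = axial⇒axisPoint x x≢0 axial
        s , t , a≡ = rescale d d≢0 x≡
        b , c , c≢0 , ex , ey = common-cubes z₀ z₃ ¬axial
        k , n , e₁ , e₂ = decompose α (c * z₁ - X b * X b * Y b) (c * z₂ - X b * Y b * Y b)
        a = axisPoint α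
    in (b , α , k) ,
       ~-trans (~-swap z r) (~-trans (~-scaleˡ (t≢0 α s t a≡) r z) (~-trans (~-addˡ s (t • r) z)
         (~-trans (~-swap ((t • r) ⊕ (s • z)) z) (~-trans (≡⇒~ (cong (z ,_) (trans (flip s t) (sym a≡))))
           (~-trans (~-scaleˡ c≢0 z a) (~-trans (~-addˡ (- n) (c • z) a) (≡⇒~ (cong (_, a)
             (vector-≡ (trans (minus-0 (c * z₀) n) ex) (moved e₁) (moved e₂) (trans (minus-0 (c * z₃) n) ey)))))))))) 
    where
    rescale : ∀ {a} d → d ≢ 0# → x ≡ d • a → InSpan z r a
    rescale {a} d d≢0 x≡ = subst (InSpan z r)
      (trans (cong (inv d≢0 •_) x≡) (trans (•-• _ d a) (trans (cong (_• a) (trans (*-comm _ d) (inv-* d≢0))) (1• a))))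
      (span-• (inv d≢0) x∈)
    t≢0 : ∀ α s t → axisPoint α ≡ (s • z) ⊕ (t • r) → t ≢ 0#
    t≢0 α s t a≡ refl = axisPoint-≢0 α (cong₂ (λ y x → y , x , 0#)
      (trans (cong (proj₁ ∘ proj₂) a≡) (collapse z₁ r₁)) (trans (cong (proj₁ ∘ proj₂ ∘ proj₂) a≡) (collapse z₂ r₂)))
      where
      keep : ∀ z r → s * z + 0# * r ≡ s * z
      keep z r = solve 3 (λ s z r → s :* z :+ con 𝟘 :* r := s :* z) refl s z r
      s≡0 : s ≡ 0#
      s≡0 = decidable-stable (s ≟ 0#) λ s≢0 → ¬axial
        (no-zero-divisors (trans (sym (keep z₀ r₀)) (sym (cong proj₁ a≡))) s≢0 ,
         no-zero-divisors (trans (sym (keep z₃ r₃)) (sym (cong (proj₂ ∘ proj₂ ∘ proj₂) a≡))) s≢0)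
      collapse : ∀ z r → s * z + 0# * r ≡ 0#
      collapse z r = trans (keep z r) (trans (cong (_* z) s≡0) (zeroˡ z))
    flip : ∀ s t → (t • r) ⊕ (s • z) ≡ (s • z) ⊕ (t • r)
    flip s t = vector-≡ (+-comm _ _) (+-comm _ _) (+-comm _ _) (+-comm _ _)
      where
      +-comm : ∀ x y → x + y ≡ y + x
      +-comm = solve 2 (λ x y → x :+ y := y :+ x) refl
    minus-0 : ∀ x n → x + - n * 0# ≡ x
    minus-0 = solve 2 (λ x n → x :+ :- n :* con 𝟘 := x) refl
    moved : ∀ {x y ks n a} → x - y ≡ ks + n * a → x + - n * a ≡ y + ks
    moved {x} {y} {ks} {n} {a} e = combine (1# ⊛ e) (solve 5 (λ x y ks n a →
      x :+ :- n :* a := y :+ ks :+ con 𝟙 :* (x :- y :- (ks :+ n :* a))) refl x y ks n a)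

  axial-line⇒axis : ∀ {L} → IsLine L → Axial (proj₁ L) → Axial (proj₂ L) → IsAxis L
  axial-line⇒axis (inj₁ (_ , _ , _ , _ , refl , refl)) (e , _) _ = contradiction e 1≢0
  axial-line⇒axis (inj₂ (inj₁ (_ , _ , _ , refl , refl))) (e , _) _ = contradiction e 1≢0
  axial-line⇒axis (inj₂ (inj₂ (inj₁ (_ , _ , refl , refl)))) (e , _) _ = contradiction e 1≢0
  axial-line⇒axis (inj₂ (inj₂ (inj₂ (inj₁ (_ , _ , refl , refl))))) (_ , refl) (_ , refl) x _ = mk⇔
    (λ { (k , l , refl) → axial⇒OnAxis (zero-sum k l , zero-sum k l) })
    (λ on → let e₀ , e₃ = OnAxis⇒axial on ; (_ , x₁ , x₂ , _) = x in x₁ , x₂ ,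
      vector-≡ (trans e₀ (sym (zero-sum x₁ x₂)))
        (solve 2 (λ k l → k := k :* con 𝟙 :+ l :* con 𝟘) refl x₁ x₂) (solve 2 (λ k l → l := k :* con 𝟘 :+ l :* con 𝟙) refl x₁ x₂)
        (trans e₃ (sym (zero-sum x₁ x₂))))
    where
    zero-sum : ∀ k l → k * 0# + l * 0# ≡ 0#
    zero-sum = solve 2 (λ k l → k :* con 𝟘 :+ l :* con 𝟘 := con 𝟘) refl
  axial-line⇒axis (inj₂ (inj₂ (inj₂ (inj₂ (inj₁ (_ , refl , refl)))))) _ (_ , e) = contradiction e 1≢0
  axial-line⇒axis (inj₂ (inj₂ (inj₂ (inj₂ (inj₂ (refl , refl)))))) _ (_ , e) = contradiction e 1≢0

  axial? : Decidable Axial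
  axial? (x₀ , _ , _ , x₃) = (x₀ ≟ 0#) ×-dec (x₃ ≟ 0#)

  EA⇒proper : ∀ {L} → IsEALine L → ∃ λ i → Proper i × eaLine i ≡ L
  EA⇒proper {L@(r₁ , r₂)} (isLine , none , ¬axis , x , n , x∈ , onAxis) =
    let i , L~ = basis
        proper = k≢0 i L~
    in i , proper , line-≡ (eaLine-isLine i proper) isLine (~-trans (eaLine-~ i proper) (~-sym L~))
    where
    axial = OnAxis⇒axial {x} onAxis
    basis : ∃ λ i → L ~ eaBasis i
    basis with axial? r₁ | axial? r₂
    ... | no ¬a | _ = spanned r₁ r₂ x ¬a axial (normalized-≢0 n) x∈
    ... | yes a | yes a′ = contradiction (axial-line⇒axis isLine a a′) ¬axis
    ... | yes _ | no ¬a = let i , e = spanned r₂ r₁ x ¬a axial (normalized-≢0 n) (~-on (~-swap r₁ r₂) x∈)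
                          in i , ~-trans (~-swap r₁ r₂) e
    -- With displacement 0 the line would pass through the point b of the cubic itself.
    k≢0 : ∀ i → L ~ eaBasis i → Proper i
    k≢0 (b , α , k) L~ refl = none (pt b) (pt-isPoint b)
      (~-on (~-sym L~) (subst (OnLine (eaBasis (b , α , 0#))) (trans (vector-≡ refl (+0*0 _ _) (+0*0 _ _) refl) (sym (pt-cubic b)))
        (left-∈ (translate (b , α , 0#)) (axisPoint α)))) (pt-OnC b)
      where
      +0*0 : ∀ x s → x + 0# * s ≡ x
      +0*0 = solve 2 (λ x s → x :+ con 𝟘 :* s := x) refl

  EA-parametrisation : ∀ {Z : Line → Set} {n} → HasCount (λ i → Proper i × Z (eaLine i)) n → HasCount (λ L → IsEALine L × Z L) n
  EA-parametrisation {Z} h = count-image {P = λ i → Proper i × Z (eaLine i)} {Q = λ L → IsEALine L × Z L} eaLine h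
    (λ {i} {j} (pi , _) (pj , _) e → eaBasis-injective i j
      (~-trans (~-sym (eaLine-~ i pi)) (~-trans (≡⇒~ e) (eaLine-~ j pj))))
    (λ {i} (pi , z) → proper⇒EA i pi , z)
    (λ (ea , z) → let i , pi , e = EA⇒proper ea in i , (pi , subst Z (sym e) z) , e)

  count-EA : HasCount IsEALine (suc q ℕ.* (suc q ℕ.* (q ∸ 1)))
  count-EA = count-cong {P = λ L → IsEALine L × ⊤} {Q = IsEALine} proj₁ (_, tt) (EA-parametrisation {Z = λ _ → ⊤}
    (count-cong {Q = λ i → Proper i × ⊤} (λ (_ , _ , _ , k≢0) → k≢0 , tt) (λ (k≢0 , _) → tt , tt , tt , k≢0)
      (count-Σ (Finite.all finiteℙ¹) λ _ → count-Σ (Finite.all finiteℙ¹) λ _ → count-remove _≟_ (Finite.all finite) 0# tt)))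

  -- The plane meets the axis in a single point α, and `κ` is its nonzero value on the complementary
  -- direction at α. For each b there is one displacement that brings the translate into the plane,
  -- and it is nonzero exactly when b lies off the plane.
  EA-inPlane : ∀ π {d} → ¬ ThroughAxis π → HasCount (On π) d → ∃ λ n → LinesIn IsEALine π n × d ℕ.+ n ≡ suc q
  EA-inPlane π@(p₀ , p₁ , p₂ , p₃) {d} ¬axial hd =
    let i , n , on , off , split = count-split (Finite.all finiteℙ¹) (On? π)
        α , eα = vanishing
        κ≢0 = κ-≢0 α eα
    in n , EA-parametrisation {Z = λ L → LineInPlane L π} (indices α eα κ≢0 off) ,
       trans (cong (ℕ._+ n) (count-unique hd (count-cong {Q = On π} proj₂ (tt ,_) on))) split
    where
    κ : ℙ¹ → Carrier
    κ α = p₁ * S₁ α + p₂ * S₂ α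
    Vanishing : ℙ¹ → Set
    Vanishing α = p₁ * Y α + p₂ * X α ≡ 0#
    vanishing : ∃ Vanishing
    vanishing with p₂ ≟ 0#
    ... | yes refl = nothing , solve 1 (λ p → p :* con 𝟘 :+ con 𝟘 :* con 𝟙 := con 𝟘) refl p₁
    ... | no p₂≢0 = let y , e = divide p₂≢0 (- p₁) in just y ,
      combine (1# ⊛ e) (solve 3 (λ p₁ p₂ y → p₁ :* con 𝟙 :+ p₂ :* y := con 𝟘 :+ con 𝟙 :* (p₂ :* y :- (:- p₁))) refl p₁ p₂ y)
    flip-* : ∀ {x y z w} → x * y + z * w ≡ 0# → y * x + w * z ≡ 0#
    flip-* {x} {y} {z} {w} e = trans (cong₂ _+_ (*-comm y x) (*-comm w z)) e
    κ-≢0 : ∀ α → Vanishing α → κ α ≢ 0#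
    κ-≢0 α e e′ = ¬axial (cramer-zero {S₁ α} {S₂ α} {Y α} {X α} {p₁} {p₂} (complementary α) (flip-* e′) (flip-* e))
    vanishing-unique : ∀ {α α′} → Vanishing α → Vanishing α′ → α ≡ α′
    vanishing-unique {α} {α′} e e′ = decidable-stable (Finite._≟_ finiteℙ¹ α α′) λ ne →
      let e₂ , e₁ = cramer-zero {X α} {Y α} {X α′} {Y α′} {p₂} {p₁} (det-≢0 {α} {α′} ne) (flip-+ α e) (flip-+ α′ e′) in ¬axial (e₁ , e₂)
      where
      flip-+ : ∀ α → p₁ * Y α + p₂ * X α ≡ 0# → X α * p₂ + Y α * p₁ ≡ 0#
      flip-+ α e = trans (solve 4 (λ p₁ p₂ x y → x :* p₂ :+ y :* p₁ := p₁ :* y :+ p₂ :* x) refl p₁ p₂ (X α) (Y α)) e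
    dot-axisPoint : ∀ α → dot π (axisPoint α) ≡ p₁ * Y α + p₂ * X α
    dot-axisPoint α = solve 6 (λ p₀ p₁ p₂ p₃ x y → p₀ :* con 𝟘 :+ p₁ :* y :+ p₂ :* x :+ p₃ :* con 𝟘 := p₁ :* y :+ p₂ :* x)
      refl p₀ p₁ p₂ p₃ (X α) (Y α)
    dot-translate : ∀ b α k → dot π (translate (b , α , k)) ≡ dot π (pt b) + k * κ α
    dot-translate b α k = trans (general p₀ p₁ p₂ p₃ _ _ _ _ (S₁ α) (S₂ α)) (cong (λ v → dot π v + k * κ α) (sym (pt-cubic b)))
      where
      general : ∀ p₀ p₁ p₂ p₃ x₀ x₁ x₂ x₃ s₁ s₂ →
        p₀ * x₀ + p₁ * (x₁ + k * s₁) + p₂ * (x₂ + k * s₂) + p₃ * x₃ ≡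
        (p₀ * x₀ + p₁ * x₁ + p₂ * x₂ + p₃ * x₃) + k * (p₁ * s₁ + p₂ * s₂)
      general p₀ p₁ p₂ p₃ x₀ x₁ x₂ x₃ s₁ s₂ = solve 9 (λ a d p₁ p₂ x₁ x₂ s₁ s₂ k →
        a :+ p₁ :* (x₁ :+ k :* s₁) :+ p₂ :* (x₂ :+ k :* s₂) :+ d := (a :+ p₁ :* x₁ :+ p₂ :* x₂ :+ d) :+ k :* (p₁ :* s₁ :+ p₂ :* s₂))
        refl (p₀ * x₀) (p₃ * x₃) p₁ p₂ x₁ x₂ s₁ s₂ k
    indices : ∀ α → Vanishing α → κ α ≢ 0# → ∀ {n} → HasCount (λ b → ⊤ × ¬ On π b) n →
      HasCount (λ i → Proper i × LineInPlane (eaLine i) π) n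
    indices α eα κ≢0 off = count-image {P = λ b → ⊤ × ¬ On π b} {Q = λ i → Proper i × LineInPlane (eaLine i) π}
      index off (λ _ _ e → cong proj₁ e)
      (λ {b} (_ , ¬on) → proper b ¬on , ~-inPlane {π = π} (~-sym (eaLine-~ (index b) (proper b ¬on)))
        (trans (dot-translate b α (level b)) (cancel b) , trans (dot-axisPoint α) eα))
      onto
      where
      -- The solution k of π(pt b) + k κ(α) = 0.
      level : ℙ¹ → Carrier
      level b = - (dot π (pt b) * inv κ≢0)
      index : ℙ¹ → Index
      index b = b , α , level b
      cancel : ∀ b → dot π (pt b) + level b * κ α ≡ 0#
      cancel b = combine ((- dot π (pt b)) ⊛ inv-* κ≢0) (solve 3 (λ d i κ → d :+ (:- (d :* i)) :* κ := con 𝟘 :+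
        (:- d) :* (κ :* i :- con 𝟙)) refl (dot π (pt b)) (inv κ≢0) (κ α))
      proper : ∀ b → ¬ On π b → level b ≢ 0#
      proper b ¬on e = *-nonzero ¬on (inv-≢0 κ≢0) (combine ((- 1#) ⊛ e)
        (solve 1 (λ x → x := con 𝟘 :+ (:- con 𝟙) :* (:- x :- con 𝟘)) refl (dot π (pt b) * inv κ≢0)))
      onto : ∀ {i} → Proper i × LineInPlane (eaLine i) π → ∃ λ b → (⊤ × ¬ On π b) × index b ≡ i
      onto {b , α′ , k} (k≢0 , l) = finish (vanishing-unique {α′} {α} (trans (sym (dot-axisPoint α′)) za) eα)
        where
        inBasis = ~-inPlane {π = π} (eaLine-~ (b , α′ , k) k≢0) l
        zu = trans (sym (dot-translate b α′ k)) (proj₁ inBasis)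
        za = proj₂ inBasis
        finish : α′ ≡ α → ∃ λ b′ → (⊤ × ¬ On π b′) × index b′ ≡ (b , α′ , k)
        finish refl = b , (tt , λ on → *-nonzero k≢0 κ≢0 (trans (sym (+-identityˡ _)) (trans (cong (_+ k * κ α) (sym on)) zu))) ,
          cong (λ k → b , α , k) (combine ((- inv κ≢0) ⊛ zu ⊞ k ⊛ inv-* κ≢0) (solve 4 (λ d i κ k → :- (d :* i) := k :+
            ((:- i) :* (d :+ k :* κ :- con 𝟘) :+ k :* (κ :* i :- con 𝟙))) refl (dot π (pt b)) (inv κ≢0) (κ α) k))

-- The numbers of lines in a plane and the averages

module Counts (F : FiniteField) (3≡0 : Characteristic-3 F)
  (p : ℕ) (q≡1+p : FiniteField.q F ≡ suc p) (1≤p : 1 ℕ.≤ p) (5≤q : 5 ℕ.≤ FiniteField.q F) where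
  open Geometry F
  open EALines F 3≡0 p q≡1+p 1≤p public

  open +-*-Solver using () renaming (solve to solveℕ; _:=_ to _:≡_; con to conℕ; _:+_ to _⊹_; _:*_ to _⊗_)

  not-axial : ∀ {π d} → IsPlane π → Is-dC d π → d ≢ 1 → ¬ ThroughAxis π
  not-axial {π} n c d≢1 t = d≢1 (count-unique (dC⇒count {π = π} c) (Γ-meets n (throughAxis⇒Γ n t)))

  bar-not-axial : ∀ {π} → IsPlane π → Is1barC π → ¬ ThroughAxis π
  bar-not-axial n (¬γ , _) t = ¬γ (throughAxis⇒Γ n t)

  EA-3C : ∀ π → IsPlane π → Is3C π → LinesIn IsEALine π (q ∸ 2)
  EA-3C π n c = let m , h , e = EA-inPlane π (not-axial n c λ ()) (dC⇒count {π = π} c) in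
    subst (LinesIn IsEALine π) (cong (_∸ 3) e) h

  EA-1C : ∀ π → IsPlane π → Is1barC π → LinesIn IsEALine π q
  EA-1C π n c = let m , h , e = EA-inPlane π (bar-not-axial n c) (dC⇒count {π = π} (proj₂ c)) in
    subst (LinesIn IsEALine π) (ℕₚ.suc-injective e) h

  EA-0C : ∀ π → IsPlane π → Is0C π → LinesIn IsEALine π (q ℕ.+ 1)
  EA-0C π n c = let m , h , e = EA-inPlane π (not-axial n c λ ()) (dC⇒count {π = π} c) in
    subst (LinesIn IsEALine π) (trans e (ℕₚ.+-comm 1 q)) h

  -- Here d = 3 and no imaginary chord lies in the plane, two of the three points being enough to
  -- exclude one; thus q² - 3q + 3.
  EnΓ-3C : ∀ π → IsPlane π → Is3C π → LinesIn IsEnΓLine π (q ℕ.* q ∸ 3 ℕ.* q ℕ.+ 3)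
  EnΓ-3C π n c =
    let ¬axial = not-axial n c λ ()
        h = dC⇒count {π = π} c
        m , hm , e = EnΓ-inPlane {π} ¬axial h (count-none (λ v → no-chord h ¬axial v))
    in subst (LinesIn IsEnΓLine π) (arithmetic m e) hm
    where
    no-chord : HasCount (On π) 3 → ¬ ThroughAxis π → ∀ v → ¬ ChordIn π v
    no-chord h ¬axial = let b , b′ , ne , z , z′ = two-elements h (ℕ.s≤s (ℕ.s≤s ℕ.z≤n)) in
      no-chord-2 _ _ _ _ ¬axial b b′ ne z z′
    arithmetic : ∀ m → 2 ℕ.* (0 ℕ.+ m) ℕ.+ 2 ℕ.* (3 ℕ.* q) ≡ (q ℕ.* q) ℕ.* 2 ℕ.+ 3 ℕ.* 2 ℕ.* 1 → m ≡ q ℕ.* q ∸ 3 ℕ.* q ℕ.+ 3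
    arithmetic m e = begin
      m                              ≡⟨ ℕₚ.m+n∸n≡m m (3 ℕ.* q) ⟨
      m ℕ.+ 3 ℕ.* q ∸ 3 ℕ.* q        ≡⟨ cong (_∸ 3 ℕ.* q) halved ⟩
      -- Truncated subtraction commutes with adding 3 only because 3q is at most q².
      q ℕ.* q ℕ.+ 3 ∸ 3 ℕ.* q        ≡⟨ ℕₚ.+-∸-comm 3 (ℕₚ.*-monoˡ-≤ q (ℕₚ.≤-trans (ℕ.s≤s (ℕ.s≤s (ℕ.s≤s ℕ.z≤n))) 5≤q)) ⟩
      q ℕ.* q ∸ 3 ℕ.* q ℕ.+ 3        ∎
      where
      open ≡-Reasoning
      halved : m ℕ.+ 3 ℕ.* q ≡ q ℕ.* q ℕ.+ 3
      halved = ℕₚ.*-cancelˡ-≡ _ _ 2 (trans (ℕₚ.*-distribˡ-+ 2 m (3 ℕ.* q)) (trans e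
        (trans (cong (ℕ._+ 6) (ℕₚ.*-comm (q ℕ.* q) 2)) (sym (ℕₚ.*-distribˡ-+ 2 (q ℕ.* q) 3)))))

  -- Here d = 1, and the one imaginary chord in the plane accounts for the final - 1 of q² - q - 1.
  EnΓ-1C : ∀ π → IsPlane π → Is1barC π → LinesIn IsEnΓLine π (q ℕ.* q ∸ q ∸ 1)
  EnΓ-1C π n c =
    let ¬axial = bar-not-axial n c
        h = dC⇒count {π = π} (proj₂ c)
        m , hm , e = EnΓ-inPlane {π} ¬axial h (chord-count h ¬axial)
    in subst (LinesIn IsEnΓLine π) (arithmetic m e) hm
    where
    chord-count : HasCount (On π) 1 → ¬ ThroughAxis π → HasCount (ChordIn π) 1
    chord-count h ¬axial = let b , z , only = unique-element h in one-chord _ _ _ _ ¬axial b z only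
    arithmetic : ∀ m → 2 ℕ.* (1 ℕ.+ m) ℕ.+ 2 ℕ.* (1 ℕ.* q) ≡ (q ℕ.* q) ℕ.* 2 ℕ.+ 1 ℕ.* 0 ℕ.* 1 → m ≡ q ℕ.* q ∸ q ∸ 1
    arithmetic m e = begin
      m                        ≡⟨⟩
      suc m ∸ 1                ≡⟨ cong (_∸ 1) (ℕₚ.m+n∸n≡m (suc m) q) ⟨
      suc m ℕ.+ q ∸ q ∸ 1      ≡⟨ cong (λ x → x ∸ q ∸ 1) halved ⟩
      q ℕ.* q ∸ q ∸ 1          ∎
      where
      open ≡-Reasoning
      halved : suc m ℕ.+ q ≡ q ℕ.* q
      halved = ℕₚ.*-cancelˡ-≡ _ _ 2 (trans (ℕₚ.*-distribˡ-+ 2 (suc m) q)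
        (trans (cong (λ x → 2 ℕ.* suc m ℕ.+ 2 ℕ.* x) (sym (ℕₚ.*-identityˡ q))) (trans e
          (trans (ℕₚ.+-identityʳ _) (ℕₚ.*-comm (q ℕ.* q) 2)))))

  EnΓ-0C : ∀ π → IsPlane π → Is0C π → LinesIn IsEnΓLine π (q ℕ.* q)
  EnΓ-0C π n c =
    let h = dC⇒count {π = π} c
        m , hm , e = EnΓ-inPlane {π} (not-axial n c λ ()) h (count-none (no-chord-0 _ _ _ _ (count-zero h)))
    in subst (LinesIn IsEnΓLine π) (arithmetic m e) hm
    where
    arithmetic : ∀ m → 2 ℕ.* (0 ℕ.+ m) ℕ.+ 2 ℕ.* (0 ℕ.* q) ≡ (q ℕ.* q) ℕ.* 2 ℕ.+ 0 ℕ.* 0 ℕ.* 1 → m ≡ q ℕ.* q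
    arithmetic m e = ℕₚ.*-cancelˡ-≡ _ _ 2 (trans (sym (ℕₚ.+-identityʳ _)) (trans e (trans (ℕₚ.+-identityʳ _) (ℕₚ.*-comm (q ℕ.* q) 2))))

  -- Every plane of type `T` carries Λ lines, so there are a·Λ incident pairs. The number of planes
  -- is known in the form a = k/c, and `e` is the part of the denominator that comes from k/N.
  average : ∀ {T : V4 → Set} {λ-line : Line → Set} {num a Λ N c k e} →
    HasCount (λ π → IsPlane π × T π) a → (∀ π → IsPlane π → T π → LinesIn λ-line π Λ) → HasCount λ-line N →
    c ℕ.* a ≡ k → 0 ℕ.< N → k ℕ.* (Λ ℕ.* e) ≡ num ℕ.* N → AvgPlanes T λ-line num (c ℕ.* e)
  average {T} {λ-line} {num} {a} {Λ} {N} {c} {k} {e} planes lines count-N ca≡k positive balance =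
    N , a ℕ.* Λ , count-N , incidences , positive ,
    trans (solveℕ 4 (λ a l c e → a ⊗ l ⊗ (c ⊗ e) :≡ (c ⊗ a) ⊗ (l ⊗ e)) refl a Λ c e)
          (trans (cong (ℕ._* (Λ ℕ.* e)) ca≡k) balance)
    where
    incidences : HasCount (λ ((L , π) : Line × V4) → λ-line L × IsPlane π × T π × LineInPlane L π) (a ℕ.* Λ)
    incidences = count-cong {P = λ (L , π) → (IsPlane π × T π) × (λ-line L × LineInPlane L π)}
      (λ ((n , t) , l , i) → l , n , t , i) (λ (l , n , t , i) → (n , t) , l , i)
      (count-swap (count-Σ planes λ {π} (n , t) → lines π n t))

  *-positive : ∀ {m n} → 0 ℕ.< m → 0 ℕ.< n → 0 ℕ.< m ℕ.* n
  *-positive {suc _} {suc _} _ _ = ℕ.s≤s ℕ.z≤n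

  EA-positive : 0 ℕ.< suc q ℕ.* (suc q ℕ.* (q ∸ 1))
  EA-positive = *-positive {suc q} (ℕ.s≤s ℕ.z≤n) (*-positive {suc q} {q ∸ 1} (ℕ.s≤s ℕ.z≤n)
    (subst (λ q → 1 ℕ.≤ q ∸ 1) (sym q≡1+p) 1≤p))

  EnΓ-positive : 0 ℕ.< suc p ℕ.* (p ℕ.* p) ℕ.* suc (suc p)
  EnΓ-positive = *-positive {suc p ℕ.* (p ℕ.* p)} {suc (suc p)}
    (*-positive {suc p} {p ℕ.* p} (ℕ.s≤s ℕ.z≤n) (*-positive {p} {p} 1≤p 1≤p)) (ℕ.s≤s ℕ.z≤n)

  private
    p≡q-1 : p ≡ q ∸ 1
    p≡q-1 = cong (_∸ 1) (sym q≡1+p)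

    -- With k = (q + 1)q(q - 1) and N = (q + 1)²(q - 1) the ratio k/N is q/(q + 1), for all three
    -- types of planes.
    EA-balance : ∀ Λ → suc q ℕ.* (q ℕ.* p) ℕ.* (Λ ℕ.* (q ℕ.+ 1)) ≡ q ℕ.* Λ ℕ.* (suc q ℕ.* (suc q ℕ.* (q ∸ 1)))
    EA-balance Λ = trans (solveℕ 3 (λ q p l → (conℕ 1 ⊹ q) ⊗ (q ⊗ p) ⊗ (l ⊗ (q ⊹ conℕ 1)) :≡
      q ⊗ l ⊗ ((conℕ 1 ⊹ q) ⊗ ((conℕ 1 ⊹ q) ⊗ p))) refl q p Λ) (cong (λ p → q ℕ.* Λ ℕ.* (suc q ℕ.* (suc q ℕ.* p))) p≡q-1)

    -- With N = q(q - 1)²(q + 1) the ratio k/N is 1/(q - 1).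
    EnΓ-balance : ∀ Λ {N} → N ≡ suc p ℕ.* (p ℕ.* p) ℕ.* suc (suc p) → suc q ℕ.* (q ℕ.* p) ℕ.* (Λ ℕ.* (q ∸ 1)) ≡ Λ ℕ.* N
    EnΓ-balance Λ refl = trans (cong (λ r → suc q ℕ.* (q ℕ.* p) ℕ.* (Λ ℕ.* r)) (sym p≡q-1))
      (trans (solveℕ 3 (λ q p l → (conℕ 1 ⊹ q) ⊗ (q ⊗ p) ⊗ (l ⊗ p) :≡ l ⊗ (q ⊗ (p ⊗ p) ⊗ (conℕ 1 ⊹ q))) refl q p Λ)
        (cong (λ q → Λ ℕ.* (q ℕ.* (p ℕ.* p) ℕ.* suc q)) q≡1+p))

  EA-average-3C : AvgPlanes Is3C IsEALine (q ℕ.* (q ∸ 2)) (6 ℕ.* (q ℕ.+ 1))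
  EA-average-3C = let a , h , e = count-3C in
    average {T = Is3C} {λ-line = IsEALine} {num = q ℕ.* (q ∸ 2)} {c = 6} {e = q ℕ.+ 1} h EA-3C count-EA e EA-positive (EA-balance (q ∸ 2))

  EA-average-1C : AvgPlanes Is1barC IsEALine (q ℕ.* q) (2 ℕ.* (q ℕ.+ 1))
  EA-average-1C = let a , h , e = count-1C in
    average {T = Is1barC} {λ-line = IsEALine} {num = q ℕ.* q} {c = 2} {e = q ℕ.+ 1} h EA-1C count-EA e EA-positive (EA-balance q)

  EA-average-0C : AvgPlanes Is0C IsEALine q 3
  EA-average-0C = let a , h , e = count-0C in
    average {T = Is0C} {λ-line = IsEALine} {num = q} {c = 3} {e = 1} h EA-0C count-EA e EA-positive
      -- Here Λ = q + 1 cancels the denominator, so e = 1; exchanging these two factors reduces the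
      -- claim to `EA-balance` at 1.
      (trans (cong (suc q ℕ.* (q ℕ.* p) ℕ.*_) (trans (ℕₚ.*-identityʳ _) (sym (ℕₚ.*-identityˡ _))))
        (trans (EA-balance 1) (cong (ℕ._* (suc q ℕ.* (suc q ℕ.* (q ∸ 1)))) (ℕₚ.*-identityʳ q))))

  EnΓ-average-3C : AvgPlanes Is3C IsEnΓLine (q ℕ.* q ∸ 3 ℕ.* q ℕ.+ 3) (6 ℕ.* (q ∸ 1))
  EnΓ-average-3C = let a , h , e = count-3C ; N , hN , eN = count-EnΓ in
    average {T = Is3C} {λ-line = IsEnΓLine} {num = q ℕ.* q ∸ 3 ℕ.* q ℕ.+ 3} {c = 6} {e = q ∸ 1} h EnΓ-3C hN e (subst (0 ℕ.<_)
        (sym eN) EnΓ-positive) (EnΓ-balance (q ℕ.* q ∸ 3 ℕ.* q ℕ.+ 3) eN)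

  EnΓ-average-1C : AvgPlanes Is1barC IsEnΓLine (q ℕ.* q ∸ q ∸ 1) (2 ℕ.* (q ∸ 1))
  EnΓ-average-1C = let a , h , e = count-1C ; N , hN , eN = count-EnΓ in
    average {T = Is1barC} {λ-line = IsEnΓLine} {num = q ℕ.* q ∸ q ∸ 1} {c = 2} {e = q ∸ 1} h EnΓ-1C hN e (subst (0 ℕ.<_)
        (sym eN) EnΓ-positive) (EnΓ-balance (q ℕ.* q ∸ q ∸ 1) eN)

  EnΓ-average-0C : AvgPlanes Is0C IsEnΓLine (q ℕ.* q) (3 ℕ.* (q ∸ 1))
  EnΓ-average-0C = let a , h , e = count-0C ; N , hN , eN = count-EnΓ in
    average {T = Is0C} {λ-line = IsEnΓLine} {num = q ℕ.* q} {c = 3} {e = q ∸ 1} h EnΓ-0C hN e (subst (0 ℕ.<_)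
        (sym eN) EnΓ-positive) (EnΓ-balance (q ℕ.* q) eN)

open import Data.Nat using (_+_; _*_; _^_; _≤_)

theorem6p3 : (F : FiniteField) →
  (Σ ℕ λ k → (Geometry.q F) ≡ 3 ^ k) → 5 ≤ (Geometry.q F) →
  (∀ π → (Geometry.IsPlane F) π → (Geometry.Is3C F) π → (Geometry.LinesIn F) (Geometry.IsEALine F) π ((Geometry.q F) ∸ 2))
  × (∀ π → (Geometry.IsPlane F) π → (Geometry.Is1barC F) π → (Geometry.LinesIn F) (Geometry.IsEALine F) π (Geometry.q F))
  × (∀ π → (Geometry.IsPlane F) π → (Geometry.Is0C F) π → (Geometry.LinesIn F) (Geometry.IsEALine F) π ((Geometry.q F) + 1))
  × (∀ π → (Geometry.IsPlane F) π → (Geometry.Is3C F) π → (Geometry.LinesIn F) (Geometry.IsEnΓLine F) π ((Geometry.q F) * (Geometry.q F) ∸ 3 * (Geometry.q F) + 3))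
  × (∀ π → (Geometry.IsPlane F) π → (Geometry.Is1barC F) π → (Geometry.LinesIn F) (Geometry.IsEnΓLine F) π ((Geometry.q F) * (Geometry.q F) ∸ (Geometry.q F) ∸ 1))
  × (∀ π → (Geometry.IsPlane F) π → (Geometry.Is0C F) π → (Geometry.LinesIn F) (Geometry.IsEnΓLine F) π ((Geometry.q F) * (Geometry.q F)))
  × (Geometry.AvgPlanes F) (Geometry.Is3C F) (Geometry.IsEALine F) ((Geometry.q F) * ((Geometry.q F) ∸ 2)) (6 * ((Geometry.q F) + 1))
  × (Geometry.AvgPlanes F) (Geometry.Is1barC F) (Geometry.IsEALine F) ((Geometry.q F) * (Geometry.q F)) (2 * ((Geometry.q F) + 1))
  × (Geometry.AvgPlanes F) (Geometry.Is0C F) (Geometry.IsEALine F) (Geometry.q F) 3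
  × (Geometry.AvgPlanes F) (Geometry.Is3C F) (Geometry.IsEnΓLine F) ((Geometry.q F) * (Geometry.q F) ∸ 3 * (Geometry.q F) + 3) (6 * ((Geometry.q F) ∸ 1))
  × (Geometry.AvgPlanes F) (Geometry.Is1barC F) (Geometry.IsEnΓLine F) ((Geometry.q F) * (Geometry.q F) ∸ (Geometry.q F) ∸ 1) (2 * ((Geometry.q F) ∸ 1))
  × (Geometry.AvgPlanes F) (Geometry.Is0C F) (Geometry.IsEnΓLine F) ((Geometry.q F) * (Geometry.q F)) (3 * ((Geometry.q F) ∸ 1))
theorem6p3 F (k , q≡3^k) 5≤q =
  EA-3C , EA-1C , EA-0C , EnΓ-3C , EnΓ-1C , EnΓ-0C ,
  EA-average-3C , EA-average-1C , EA-average-0C , EnΓ-average-3C , EnΓ-average-1C , EnΓ-average-0C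
  where
  open Counts F (FieldProperties.characteristic-3 F k q≡3^k) (FiniteField.q F ∸ 1)
    (sym (ℕₚ.m+[n∸m]≡n {1} (ℕₚ.≤-trans (ℕ.s≤s ℕ.z≤n) 5≤q)))
    (ℕₚ.∸-monoˡ-≤ {2} 1 (ℕₚ.≤-trans (ℕ.s≤s (ℕ.s≤s ℕ.z≤n)) 5≤q)) 5≤q
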